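{- Let $t\ge2$, $\omega$ a primitive $t$-th root of unity, and $\lambda\in\mathcal P_t$. Let $(\lambda^{(0)},\dots,\lambda^{(t-1)})$, $n_i(\lambda)$, $\sigma_\lambda$ be the $t$-quotient, residue counts and sorting permutation computed from $\beta(\lambda,t)$. Then $\mathfrak o_\lambda(1,\omega,\dots,\omega^{t-1})$ is nonzero if and only if the $t$-core of $\lambda$ is orthogonal, $\ell(\lambda^{(i)})+\ell(\lambda^{(t-i)})\le1$ for all $1\le i\le\lfloor t/2\rfloor$ with $i\neq t-i$, $\lambda^{(0)}\in\{\emptyset,(1)\}$, and, when $t$ is even, $\lambda^{(t/2)}=\emptyset$. In that case, if the $t$-core has rank $r$, \[ \mathfrak o_\lambda(1,\omega,\dots,\omega^{t-1})=(-1)^{\epsilon}\operatorname{sgn}(\sigma_\lambda), \] where $\epsilon=-\sum_{i=\lfloor(t+2)/2\rfloor}^{t-1}\binom{n_i(\lambda)+1}{2}+r+\begin{cases}1+r & t\text{ even},\\0 & t\text{ odd}.\end{cases}$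
   Context: Partitions $\lambda=(\lambda_1\ge\dots\ge0)$, $\ell$ = number of nonzero parts, $\mathcal P_m$ = partitions with $\ell\le m$, $\emptyset$ the empty partition. Beta-set $\beta(\lambda,m)=(\lambda_j+m-j)_{1\le j\le m}$; $n_i(\lambda)$ = number of its entries congruent to $i$ mod $t$. $t$-core: list the integers $tj+i$ ($0\le i\le t-1$, $0\le j\le n_i-1$) decreasingly as $b_1>\dots>b_m$; the $t$-core has parts $b_j-m+j$. $t$-quotient: writing entries congruent to $i$ decreasingly as $tc^{(i)}_1+i>\dots>tc^{(i)}_{n_i}+i$, $\lambda^{(i)}$ has parts $c^{(i)}_j-n_i+j$. $\sigma_\lambda\in S_m$: $(\beta_{\sigma_\lambda(1)},\dots,\beta_{\sigma_\lambda(m)})$ lists entries $\equiv0$ mod $t$ decreasingly, then $\equiv1$, ..., then $\equiv t-1$. Rank of $\nu$: largest $k$ with $\nu_k\ge k$; $\nu$ of rank $r$ is orthogonal if $\nu_i-i=\nu'_i-i+1$ for $1\le i\le r$. $h_k$ complete homogeneous symmetric polynomial ($h_0=1$, $h_k=0$ for $k<0$). Universal orthogonal character in a finite list of variables $Z$: $\mathfrak o_\lambda(Z)=\det(h_{\lambda_i-i+j}(Z)-h_{\lambda_i-i-j}(Z))_{1\le i,j\le N}$, $N\ge\ell(\lambda)$. -}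

module Defs where

open import Level using (Level)
open import Data.Nat as Nat using (_+_; _*_)
open import Data.Nat using (ℕ; zero; suc; _∸_; _≤_; _<_; _≤ᵇ_; _<ᵇ_; _≡ᵇ_; _⊔_)
open import Data.Nat.DivMod using (_%_; _/_)
open import Data.Nat.Combinatorics using (_C_)
open import Data.Integer as ℤ using (ℤ; +_; -[1+_]; ∣_∣)
open import Data.List as L using (List; []; _∷_; length; map; upTo; concat; foldr)
open import Data.Nat.ListAction using (sum)
open import Data.Bool using (Bool; true; false; if_then_else_)
open import Data.Vec as V using (Vec)
open import Data.Fin as F using (Fin)
open import Data.Product using (_×_; _,_; proj₁; proj₂)
open import Data.Sum using (_⊎_)
open import Relation.Nullary using (¬_)
open import Relation.Binary.PropositionalEquality using (_≡_)
open import Algebra.Bundles using (CommutativeRing)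

bfilter : {A : Set} → (A → Bool) → List A → List A
bfilter p [] = []
bfilter p (x ∷ xs) = if p x then x ∷ bfilter p xs else bfilter p xs

-- 1-indexed access, default 0 (partitions padded with zeros)
nth : List ℕ → ℕ → ℕ
nth [] _ = 0
nth (x ∷ xs) zero = 0
nth (x ∷ xs) (suc zero) = x
nth (x ∷ xs) (suc (suc k)) = nth xs (suc k)

insertDesc : ℕ → List ℕ → List ℕ
insertDesc x [] = x ∷ []
insertDesc x (y ∷ ys) = if y ≤ᵇ x then x ∷ y ∷ ys else y ∷ insertDesc x ys

sortDesc : List ℕ → List ℕ
sortDesc = foldr insertDesc []

-- residue mod t (t ≥ 2 in all uses)
res : ℕ → ℕ → ℕ
res zero m = m
res (suc n) m = m % suc n

quot : ℕ → ℕ → ℕ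
quot zero m = 0
quot (suc n) m = m / suc n

-- Partitions as lists of parts (weakly decreasing, trailing zeros allowed)

-- a vector of t parts is a partition with at most t nonzero parts
Decreasing : {t : ℕ} → Vec ℕ t → Set
Decreasing {t} v = (i j : Fin t) → F.toℕ i ≤ F.toℕ j → V.lookup v j ≤ V.lookup v i

nonzeroParts : List ℕ → List ℕ
nonzeroParts = bfilter (λ x → 1 ≤ᵇ x)

len : List ℕ → ℕ
len ν = length (nonzeroParts ν)

conj : List ℕ → ℕ → ℕ
conj ν i = length (bfilter (λ x → i ≤ᵇ x) ν)

rank : List ℕ → ℕ
rank ν = foldr _⊔_ 0 (bfilter (λ k → k ≤ᵇ nth ν k) (map suc (upTo (length ν))))

Orthogonal : List ℕ → Set
Orthogonal ν = ∀ i → 1 ≤ i → i ≤ rank ν →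
  (+ nth ν i) ℤ.- (+ i) ≡ ((+ conj ν i) ℤ.- (+ i)) ℤ.+ (+ 1)

-- Beta-set, residue counts, t-core, t-quotient, sorting permutation
-- (λ is given as its list of m parts, padded with zeros; here m = t)

betaGo : ℕ → ℕ → List ℕ → List ℕ
betaGo m j [] = []
betaGo m j (x ∷ xs) = (x + m ∸ j) ∷ betaGo m (suc j) xs

beta : List ℕ → List ℕ
beta lam = betaGo (length lam) 1 lam

resClass : ℕ → List ℕ → ℕ → List ℕ
resClass t lam i = bfilter (λ b → res t b ≡ᵇ i) (beta lam)

nres : ℕ → List ℕ → ℕ → ℕ
nres t lam i = length (resClass t lam i)

coreGo : ℕ → ℕ → List ℕ → List ℕ
coreGo m j [] = []
coreGo m j (b ∷ bs) = ((b + j) ∸ m) ∷ coreGo m (suc j) bs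

core : ℕ → List ℕ → List ℕ
core t lam = coreGo (length bs) 1 bs
  where
  bs : List ℕ
  bs = sortDesc (concat (map (λ i → map (λ j → t * j + i) (upTo (nres t lam i))) (upTo t)))

quotGo : ℕ → ℕ → ℕ → List ℕ → List ℕ
quotGo t n j [] = []
quotGo t n j (b ∷ bs) = ((quot t b + j) ∸ n) ∷ quotGo t n (suc j) bs

quotient : ℕ → List ℕ → ℕ → List ℕ
quotient t lam i = quotGo t (nres t lam i) 1 (resClass t lam i)

-- σ_λ as the list (σ(1),…,σ(m)): indices of the entries ≡ 0 mod t in
-- decreasing order of the entries, then ≡ 1, …, then ≡ t-1
indexed : ℕ → List ℕ → List (ℕ × ℕ)
indexed j [] = []
indexed j (x ∷ xs) = (j , x) ∷ indexed (suc j) xs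

sigma : ℕ → List ℕ → List ℕ
sigma t lam = concat (map (λ i → map proj₁
  (bfilter (λ p → res t (proj₂ p) ≡ᵇ i) (indexed 1 (beta lam)))) (upTo t))

inversions : List ℕ → ℕ
inversions [] = 0
inversions (x ∷ xs) = length (bfilter (λ y → y <ᵇ x) xs) + inversions xs

isEven : ℕ → Bool
isEven n = n % 2 ≡ᵇ 0

epsilon : ℕ → List ℕ → ℤ
epsilon t lam =
  ℤ.- (+ sum (map (λ i → suc (nres t lam i) C 2) (map (λ k → k + a) (upTo (t ∸ a)))))
  ℤ.+ (+ r)
  ℤ.+ (if isEven t then + (1 + r) else + 0)
  where
  a = (t + 2) / 2
  r = rank (core t lam)

Condition : ℕ → List ℕ → Set
Condition t lam =
  Orthogonal (core t lam)
  × (∀ i → 1 ≤ i → i ≤ t / 2 → ¬ (i ≡ t ∸ i) →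
       len (quotient t lam i) + len (quotient t lam (t ∸ i)) ≤ 1)
  × (nonzeroParts (quotient t lam 0) ≡ [] ⊎ nonzeroParts (quotient t lam 0) ≡ 1 ∷ [])
  × (isEven t ≡ true → nonzeroParts (quotient t lam (t / 2)) ≡ [])

module RingDefs {c ℓ : Level} (R : CommutativeRing c ℓ) where
  open CommutativeRing R renaming (_+_ to _+R_; _*_ to _*R_)

  pow : Carrier → ℕ → Carrier
  pow x zero = 1#
  pow x (suc n) = x *R pow x n

  natR : ℕ → Carrier
  natR zero = 0#
  natR (suc n) = 1# +R natR n

  sumR : List Carrier → Carrier
  sumR = foldr _+R_ 0#

  signN : ℕ → Carrier
  signN n = if isEven n then 1# else - 1#

  signZ : ℤ → Carrier
  signZ e = signN ∣ e ∣

  hN : ℕ → List Carrier → Carrier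
  hN k [] = if k ≡ᵇ 0 then 1# else 0#
  hN k (x ∷ xs) = sumR (map (λ j → pow x j *R hN (k ∸ j) xs) (upTo (suc k)))

  h : ℤ → List Carrier → Carrier
  h (+ k) Z = hN k Z
  h -[1+ k ] Z = 0#

  det : {n : ℕ} → (Fin n → Fin n → Carrier) → Carrier
  det {zero} M = 1#
  det {suc n} M = sumR (L.map
    (λ j → signN (F.toℕ j) *R (M F.zero j *R det (λ a b → M (F.suc a) (F.punchIn j b))))
    (L.allFin (suc n)))

  orthChar : List ℕ → ℕ → List Carrier → Carrier
  orthChar lam N Z = det {N} (λ i j →
    h ((+ nth lam (ii i)) ℤ.- (+ ii i) ℤ.+ (+ ii j)) Z
      - h ((+ nth lam (ii i)) ℤ.- (+ ii i) ℤ.- (+ ii j)) Z)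
    where
    ii : Fin N → ℕ
    ii k = suc (F.toℕ k)

  rootsList : Carrier → ℕ → List Carrier
  rootsList ω t = map (pow ω) (upTo t)

{-# OPTIONS --safe #-}
-- Comparing the two ways of adjoining a variable to (1, ω, …, ω ^ (s - 1)) gives h_k(1, ω, …, ω ^ (t - 1)) = [t ∣ k].
-- Hence, on the columns c = t - j, the row of a beta number b with residue ρ and quotient q mod t is
-- e_ρ, minus e_{t-ρ} when ρ ≥ 1 and q ≥ 1, minus e_0 when ρ = 0 and q ≥ 2.
-- The determinant is alternating, so up to the sign of σ_λ the rows can be grouped by residue; residue 0
-- and then the pairs {i, t - i}, outermost first, are split off, each pair contributing a 2 × 2 minor.
-- A class with the wrong number of rows forces the value 0; otherwise the minor is 0 or ±1.
-- On the other side, an orthogonal t-core means that x ↦ 2t - x exchanges the beads above t with the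
-- gaps below t, that is n_0 = 1 and n_i + n_{t-i} = 2, so the two descriptions agree.
module Submission where

open import Defs
open import Level using (Level)
open import Data.Nat using (ℕ; zero; suc; _+_; _∸_; _≤_; _<_; _>_; _≥_; _⊔_; _≡ᵇ_; _≤ᵇ_; _<ᵇ_; z≤n; s≤s; s≤s⁻¹) renaming (_*_ to _·_)
import Data.Nat.Properties as ℕ
open import Data.Nat.DivMod using (_%_; _/_; m≡m%n+[m/n]*n; m%n<n; m%n≤m; [m+kn]%n≡m%n; m<n⇒m%n≡m; m*n%n≡0; m*n/n≡m; m≥n⇒m/n>0; m/n*n≤m; /-monoˡ-≤; +-distrib-/)
open import Data.Nat.Combinatorics using (_C_)
open import Data.Nat.ListAction using (sum)
open import Data.Nat.ListAction.Properties using (sum-++)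
import Data.Nat.Tactic.RingSolver as ℕSolver
open import Data.Integer as ℤ using (+_; _⊖_; ∣_∣)
import Data.Integer.Properties as ℤ
import Data.Integer.Tactic.RingSolver as ℤSolver
open import Data.Bool using (Bool; true; false; T; not; if_then_else_; _∧_; _∨_)
open import Data.Fin as Fin using (Fin)
open import Data.Fin.Properties using (toℕ<n)
open import Data.List using (List; []; _∷_; length; map; foldr; tabulate; upTo; applyUpTo; concat; _++_; _∷ʳ_)
open import Data.List.Properties using (map-tabulate; map-applyUpTo; map-upTo; map-++; map-∘; upTo-∷ʳ; tabulate-cong; length-tabulate; foldr-++; length-map; length-++; concat-++; ++-assoc; ++-identityʳ)
open import Data.List.Membership.Propositional using (_∈_)
open import Data.List.Membership.Propositional.Properties using (∈-map⁺; ∈-upTo⁺)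
open import Data.List.Relation.Unary.Any using (here; there)
open import Data.List.Relation.Unary.All as All using (All; []; _∷_)
import Data.List.Relation.Unary.All.Properties as All
open import Data.List.Relation.Unary.AllPairs using (AllPairs; []; _∷_)
import Data.List.Relation.Unary.AllPairs.Properties as AllPairs
open import Data.Vec as Vec using (Vec; toList)
open import Data.Vec.Properties using (length-toList)
open import Data.Product using (_×_; _,_; proj₁; proj₂; ∃-syntax)
open import Data.Sum using (_⊎_; inj₁; inj₂)
open import Data.Unit using (tt)
open import Data.Empty using (⊥-elim)
open import Function using (_∘_; id)
open import Relation.Nullary using (¬_; Dec; contradiction; yes; no)
open import Relation.Binary using (tri<; tri≈; tri>)
open import Relation.Binary.PropositionalEquality as ≡ using (_≡_; _≢_)
open import Algebra.Bundles using (CommutativeRing)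
import Algebra.Properties.Ring as RingProperties
import Algebra.Properties.CommutativeSemigroup as CommutativeSemigroupProperties
import Relation.Binary.Reasoning.Setoid as SetoidReasoning

-- Booleans and filters

-- The difficulty is the sign, not the vanishing: beta numbers of different residues are interleaved
-- arbitrarily. A determinant is therefore treated as a function of a list of rows and a list of
-- columns, and multiplied by the sign of the inversions of the residue sequence. The product does
-- not see how different residues are interleaved, and the correction is the sign of `σ_λ`, because
-- the sorting is stable inside each class. The columns run t - 1, ..., 1, 0. Residue 0 owns the
-- last one; once it is removed, the columns of the outermost pair are the two ends of an interval,
-- and removing them leaves a shorter interval of the same symmetric kind. Every sign that arises
-- then depends only on the length of the interval and on the sizes of the two classes. As `≈` need
-- not be decidable, each step decides a combinatorial condition on the classes and attaches to
-- either outcome a value or a proof of vanishing. On the side of the core, orthogonality yields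
-- only the inequalities `Bounded`; the fact that there are exactly t beads turns them into
-- equalities.

T⇒true : ∀ {b} → T b → b ≡ true
T⇒true {true} _ = ≡.refl

true⇒T : ∀ {b} → b ≡ true → T b
true⇒T ≡.refl = tt

¬T⇒false : ∀ {b} → ¬ T b → b ≡ false
¬T⇒false {true} ¬t = ⊥-elim (¬t tt)
¬T⇒false {false} _ = ≡.refl

false⇒¬T : ∀ {b} → b ≡ false → ¬ T b
false⇒¬T ≡.refl ()

≡ᵇ-true : ∀ {m n} → m ≡ n → (m ≡ᵇ n) ≡ true
≡ᵇ-true {m} {n} e = T⇒true (ℕ.≡⇒≡ᵇ m n e)

≡ᵇ-false : ∀ {m n} → m ≢ n → (m ≡ᵇ n) ≡ false
≡ᵇ-false {m} {n} ne = ¬T⇒false (λ t → ne (ℕ.≡ᵇ⇒≡ m n t))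

≡ᵇ-true⁻¹ : ∀ {m n} → (m ≡ᵇ n) ≡ true → m ≡ n
≡ᵇ-true⁻¹ {m} {n} e = ℕ.≡ᵇ⇒≡ m n (true⇒T e)

≡ᵇ-false⁻¹ : ∀ {m n} → (m ≡ᵇ n) ≡ false → m ≢ n
≡ᵇ-false⁻¹ {m} {n} e eq = false⇒¬T e (ℕ.≡⇒≡ᵇ m n eq)

≤ᵇ-true : ∀ {m n} → m ≤ n → (m ≤ᵇ n) ≡ true
≤ᵇ-true l = T⇒true (ℕ.≤⇒≤ᵇ l)

≤ᵇ-false : ∀ {m n} → ¬ (m ≤ n) → (m ≤ᵇ n) ≡ false
≤ᵇ-false {m} {n} nl = ¬T⇒false (λ t → nl (ℕ.≤ᵇ⇒≤ m n t))

≤ᵇ-true⁻¹ : ∀ {m n} → (m ≤ᵇ n) ≡ true → m ≤ n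
≤ᵇ-true⁻¹ {m} {n} e = ℕ.≤ᵇ⇒≤ m n (true⇒T e)

≤ᵇ-false⁻¹ : ∀ {m n} → (m ≤ᵇ n) ≡ false → ¬ (m ≤ n)
≤ᵇ-false⁻¹ e l = false⇒¬T e (ℕ.≤⇒≤ᵇ l)

<ᵇ-true : ∀ {m n} → m < n → (m <ᵇ n) ≡ true
<ᵇ-true l = T⇒true (ℕ.<⇒<ᵇ l)

<ᵇ-false : ∀ {m n} → ¬ (m < n) → (m <ᵇ n) ≡ false
<ᵇ-false {m} {n} nl = ¬T⇒false (λ t → nl (ℕ.<ᵇ⇒< m n t))

isEven-suc : ∀ n → isEven (suc n) ≡ not (isEven n)
isEven-suc zero = ≡.refl
isEven-suc (suc zero) = ≡.refl
isEven-suc (suc (suc n)) = isEven-suc n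

count : (ℕ → Bool) → List ℕ → ℕ
count q = length ∘ bfilter q

module _ {A : Set} where

  bfilter-all : ∀ {p : A → Bool} {xs} → All (λ x → p x ≡ true) xs → bfilter p xs ≡ xs
  bfilter-all [] = ≡.refl
  bfilter-all (e ∷ es) rewrite e = ≡.cong (_ ∷_) (bfilter-all es)

  bfilter-none : ∀ {p : A → Bool} {xs} → All (λ x → p x ≡ false) xs → bfilter p xs ≡ []
  bfilter-none [] = ≡.refl
  bfilter-none (e ∷ es) rewrite e = bfilter-none es

  bfilter-sound : ∀ (p : A → Bool) xs → All (λ x → p x ≡ true) (bfilter p xs)
  bfilter-sound p [] = []
  bfilter-sound p (x ∷ xs) with p x in e
  ... | true = e ∷ bfilter-sound p xs
  ... | false = bfilter-sound p xs

  bfilter-All : ∀ {ℓ} {P : A → Set ℓ} (p : A → Bool) {xs} → All P xs → All P (bfilter p xs)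
  bfilter-All p [] = []
  bfilter-All p {x ∷ _} (px ∷ pxs) with p x
  ... | true = px ∷ bfilter-All p pxs
  ... | false = bfilter-All p pxs

  bfilter-AllPairs : ∀ {ℓ} {_~_ : A → A → Set ℓ} (p : A → Bool) {xs} →
    AllPairs _~_ xs → AllPairs _~_ (bfilter p xs)
  bfilter-AllPairs p [] = []
  bfilter-AllPairs p {x ∷ _} (r ∷ rs) with p x
  ... | true = bfilter-All p r ∷ bfilter-AllPairs p rs
  ... | false = bfilter-AllPairs p rs

  -- This identifies a residue class of a sublist selected by residues with the same class of the
  -- whole list.
  bfilter-absorb : ∀ {p q : A → Bool} → (∀ x → p x ≡ true → q x ≡ true) →
    ∀ xs → bfilter p (bfilter q xs) ≡ bfilter p xs
  bfilter-absorb imp [] = ≡.refl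
  bfilter-absorb {p} {q} imp (x ∷ xs) with p x in ep | q x in eq
  ... | true | true rewrite ep = ≡.cong (x ∷_) (bfilter-absorb imp xs)
  ... | true | false = contradiction (≡.trans (≡.sym (imp x ep)) eq) λ ()
  ... | false | true rewrite ep = bfilter-absorb imp xs
  ... | false | false = bfilter-absorb imp xs

  bfilter-++ : ∀ (p : A → Bool) xs ys → bfilter p (xs ++ ys) ≡ bfilter p xs ++ bfilter p ys
  bfilter-++ p [] ys = ≡.refl
  bfilter-++ p (x ∷ xs) ys with p x
  ... | true = ≡.cong (x ∷_) (bfilter-++ p xs ys)
  ... | false = bfilter-++ p xs ys

  length-bfilter : ∀ (p : A → Bool) xs → length (bfilter p xs) ≤ length xs
  length-bfilter p [] = z≤n
  length-bfilter p (x ∷ xs) with p x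
  ... | true = s≤s (length-bfilter p xs)
  ... | false = ℕ.m≤n⇒m≤1+n (length-bfilter p xs)

  length-bfilter-not : ∀ (p : A → Bool) xs →
    length (bfilter p xs) + length (bfilter (not ∘ p) xs) ≡ length xs
  length-bfilter-not p [] = ≡.refl
  length-bfilter-not p (x ∷ xs) with p x
  ... | true = ≡.cong suc (length-bfilter-not p xs)
  ... | false = ≡.trans (ℕ.+-suc _ _) (≡.cong suc (length-bfilter-not p xs))

∨-true⁻¹ : ∀ {a b} → a ∨ b ≡ true → a ≡ true ⊎ b ≡ true
∨-true⁻¹ {true} _ = inj₁ ≡.refl
∨-true⁻¹ {false} e = inj₂ e

∨-false⁻¹ˡ : ∀ {a b} → a ∨ b ≡ false → a ≡ false
∨-false⁻¹ˡ {false} _ = ≡.refl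

∨-false⁻¹ʳ : ∀ {a b} → a ∨ b ≡ false → b ≡ false
∨-false⁻¹ʳ {false} e = e

not-true⁻¹ : ∀ {a} → not a ≡ true → a ≡ false
not-true⁻¹ {false} _ = ≡.refl

not-false⁻¹ : ∀ {a} → not a ≡ false → a ≡ true
not-false⁻¹ {true} _ = ≡.refl

-- Signs are compared through this: suitable doubles are added to both exponents until they have a
-- common form.
isEven-double : ∀ a x → isEven (a + a + x) ≡ isEven x
isEven-double zero x = ≡.refl
isEven-double (suc a) x = ≡.trans (≡.cong (λ y → isEven (suc (y + x))) (ℕ.+-suc a a)) (isEven-double a x)

-- Finite sums and counting, sorted lists

sumBelow : (ℕ → ℕ) → ℕ → ℕ
sumBelow f zero = 0
sumBelow f (suc n) = sumBelow f n + f n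

sumBelow-cong : ∀ {f g} n → (∀ i → i < n → f i ≡ g i) → sumBelow f n ≡ sumBelow g n
sumBelow-cong zero e = ≡.refl
sumBelow-cong (suc n) e = ≡.cong₂ _+_ (sumBelow-cong n (λ i l → e i (ℕ.m<n⇒m<1+n l))) (e n ℕ.≤-refl)

sumBelow-∷ : ∀ f n → sumBelow f (suc n) ≡ f 0 + sumBelow (f ∘ suc) n
sumBelow-∷ f zero = ≡.sym (ℕ.+-identityʳ (f 0))
sumBelow-∷ f (suc n) = ≡.trans (≡.cong (_+ f (suc n)) (sumBelow-∷ f n)) (ℕ.+-assoc (f 0) _ _)

sumBelow-reverse : ∀ f n → sumBelow f n ≡ sumBelow (λ i → f (n ∸ suc i)) n
sumBelow-reverse f zero = ≡.refl
sumBelow-reverse f (suc n) = ≡.trans (ℕ.+-comm (sumBelow f n) (f n))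
  (≡.trans (≡.cong (_+_ (f n)) (sumBelow-reverse f n)) (≡.sym (sumBelow-∷ (λ i → f (suc n ∸ suc i)) n)))

sumBelow-+ : ∀ f g n → sumBelow (λ i → f i + g i) n ≡ sumBelow f n + sumBelow g n
sumBelow-+ f g zero = ≡.refl
sumBelow-+ f g (suc n) = ≡.trans (≡.cong (_+ (f n + g n)) (sumBelow-+ f g n))
  (lem (sumBelow f n) (sumBelow g n) (f n) (g n))
  where
  lem : ∀ a b c d → a + b + (c + d) ≡ a + c + (b + d)
  lem = ℕSolver.solve-∀

sumBelow-≤ : ∀ f c n → (∀ i → i < n → f i ≤ c) → sumBelow f n ≤ n · c
sumBelow-≤ f c zero l = z≤n
sumBelow-≤ f c (suc n) l = ℕ.≤-trans (ℕ.+-mono-≤ (sumBelow-≤ f c n (λ i i<n → l i (ℕ.m<n⇒m<1+n i<n))) (l n ℕ.≤-refl))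
  (ℕ.≤-reflexive (ℕ.+-comm (n · c) c))

-- No summand can fall short of `c`, because the others cannot make up for it.
sumBelow-saturated : ∀ f c n → (∀ i → i < n → f i ≤ c) → n · c ≤ sumBelow f n →
  ∀ i → i < n → f i ≡ c
sumBelow-saturated f c (suc n) l s i i<1+n with i ℕ.≟ n
... | yes ≡.refl = ℕ.≤-antisym (l n ℕ.≤-refl) (ℕ.+-cancelʳ-≤ (n · c) c (f n) (ℕ.≤-trans s
      (ℕ.≤-trans (ℕ.≤-reflexive (ℕ.+-comm (sumBelow f n) (f n)))
        (ℕ.+-monoʳ-≤ (f n) (sumBelow-≤ f c n (λ i i<n → l i (ℕ.m<n⇒m<1+n i<n)))))))
... | no i≢n = sumBelow-saturated f c n (λ i i<n → l i (ℕ.m<n⇒m<1+n i<n))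
      (ℕ.+-cancelˡ-≤ c _ _ (ℕ.≤-trans s (ℕ.≤-trans (ℕ.+-monoʳ-≤ (sumBelow f n) (l n ℕ.≤-refl))
        (ℕ.≤-reflexive (ℕ.+-comm (sumBelow f n) c))))) i (ℕ.≤∧≢⇒< (s≤s⁻¹ i<1+n) i≢n)

sumBelow-single : ∀ a r n → sumBelow (λ i → if r ≡ᵇ i then a else 0) n ≡ (if r <ᵇ n then a else 0)
sumBelow-single a r zero = ≡.refl
sumBelow-single a r (suc n) rewrite sumBelow-single a r n with ℕ.<-cmp r n
... | tri< l ne _ rewrite <ᵇ-true l | <ᵇ-true (ℕ.m<n⇒m<1+n l) | ≡ᵇ-false ne = ℕ.+-identityʳ a
... | tri≈ nl e _ rewrite <ᵇ-false nl | <ᵇ-true (s≤s (ℕ.≤-reflexive e)) | ≡ᵇ-true e = ≡.refl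
... | tri> nl ne l rewrite <ᵇ-false nl | <ᵇ-false (ℕ.≤⇒≯ l) | ≡ᵇ-false ne = ≡.refl

count-++ : ∀ q xs ys → count q (xs ++ ys) ≡ count q xs + count q ys
count-++ q xs ys = ≡.trans (≡.cong length (bfilter-++ q xs ys)) (length-++ (bfilter q xs))

count-concat : ∀ q (f : ℕ → List ℕ) n → count q (concat (map f (upTo n))) ≡ sumBelow (count q ∘ f) n
count-concat q f zero = ≡.refl
count-concat q f (suc n) = begin
  count q (concat (map f (upTo (suc n))))
    ≡⟨ ≡.cong (count q ∘ concat ∘ map f) (upTo-∷ʳ n) ⟨
  count q (concat (map f (upTo n ∷ʳ n)))
    ≡⟨ ≡.cong (count q ∘ concat) (map-++ f (upTo n) (n ∷ [])) ⟩
  count q (concat (map f (upTo n) ++ f n ∷ []))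
    ≡⟨ ≡.cong (count q) (concat-++ (map f (upTo n)) (f n ∷ [])) ⟨
  count q (concat (map f (upTo n)) ++ (f n ++ []))
    ≡⟨ count-++ q (concat (map f (upTo n))) (f n ++ []) ⟩
  count q (concat (map f (upTo n))) + count q (f n ++ [])
    ≡⟨ ≡.cong₂ _+_ (count-concat q f n) (≡.cong (count q) (++-identityʳ (f n))) ⟩
  sumBelow (count q ∘ f) (suc n) ∎
  where
  open ≡.≡-Reasoning

count-single : ∀ (q : ℕ → Bool) c → count q (c ∷ []) ≡ (if q c then 1 else 0)
count-single q c with q c
... | true = ≡.refl
... | false = ≡.refl

count-map-upTo : ∀ q (g : ℕ → ℕ) n →
  count q (map g (upTo n)) ≡ sumBelow (λ j → if q (g j) then 1 else 0) n
count-map-upTo q g zero = ≡.refl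
count-map-upTo q g (suc n) = begin
  count q (map g (upTo (suc n)))
    ≡⟨ ≡.cong (count q ∘ map g) (upTo-∷ʳ n) ⟨
  count q (map g (upTo n ∷ʳ n))
    ≡⟨ ≡.cong (count q) (map-++ g (upTo n) (n ∷ [])) ⟩
  count q (map g (upTo n) ++ g n ∷ [])
    ≡⟨ count-++ q (map g (upTo n)) (g n ∷ []) ⟩
  count q (map g (upTo n)) + count q (g n ∷ [])
    ≡⟨ ≡.cong₂ _+_ (count-map-upTo q g n) (count-single q (g n)) ⟩
  _ ∎
  where
  open ≡.≡-Reasoning

count-zero⇒none : ∀ q xs → count q xs ≡ 0 → All (λ x → q x ≡ false) xs
count-zero⇒none q [] e = []
count-zero⇒none q (x ∷ xs) e with q x in qx
... | false = qx ∷ count-zero⇒none q xs e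

-- Decreasing lists and their conjugates

multiplicity : ℕ → List ℕ → ℕ
multiplicity v = count (v ≡ᵇ_)

conj-zero : ∀ l → conj l 0 ≡ length l
conj-zero l = ≡.cong length (bfilter-all (All.universal (λ _ → ≡.refl) l))

conj-≤-length : ∀ l v → conj l v ≤ length l
conj-≤-length l v = length-bfilter (v ≤ᵇ_) l

-- `conj` is applied to lists of beads as well as to partitions; there it counts the beads from
-- position `v` on, and its jumps are the beads.
conj-suc : ∀ l v → conj l v ≡ conj l (suc v) + multiplicity v l
conj-suc [] v = ≡.refl
conj-suc (x ∷ l) v with ℕ.<-cmp v x
... | tri< lt ne _ rewrite ≤ᵇ-true (ℕ.<⇒≤ lt) | <ᵇ-true lt | ≡ᵇ-false ne = ≡.cong suc (conj-suc l v)
... | tri≈ nl ≡.refl _ rewrite ≤ᵇ-true (ℕ.≤-refl {v}) | <ᵇ-false nl | ≡ᵇ-true {v} ≡.refl =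
      ≡.trans (≡.cong suc (conj-suc l v)) (≡.sym (ℕ.+-suc (conj l (suc v)) _))
... | tri> nl ne gt rewrite ≤ᵇ-false (ℕ.<⇒≱ gt) | <ᵇ-false nl | ≡ᵇ-false ne = conj-suc l v

nth-≤ : ∀ {x l} c → All (_≤ x) l → nth l c ≤ x
nth-≤ c [] = z≤n
nth-≤ zero (_ ∷ _) = z≤n
nth-≤ (suc zero) (p ∷ _) = p
nth-≤ (suc (suc c)) (_ ∷ ps) = nth-≤ (suc c) ps

-- Together with the next lemma, the Galois connection between a decreasing list and its conjugate.
-- `1 ≤ v` keeps away the default value 0 of `nth` beyond the end of the list.
≤-nth⇒≤-conj : ∀ {l} v c → AllPairs _≥_ l → 1 ≤ v → 1 ≤ c → v ≤ nth l c → c ≤ conj l v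
≤-nth⇒≤-conj v c [] 1≤v 1≤c p = contradiction (ℕ.≤-trans 1≤v p) λ ()
≤-nth⇒≤-conj {x ∷ l} v c (xs ∷ ps) 1≤v 1≤c p with v ℕ.≤? x
... | no nl = contradiction (ℕ.≤-trans p (nth-≤ c (ℕ.≤-refl ∷ xs))) nl
... | yes le rewrite ≤ᵇ-true le with c
...   | suc zero = s≤s z≤n
...   | suc (suc c) = s≤s (≤-nth⇒≤-conj v (suc c) ps 1≤v (s≤s z≤n) p)

-- Here `1 ≤ c` is the guard, since `nth` is 0 at index 0.
≤-conj⇒≤-nth : ∀ {l} v c → AllPairs _≥_ l → 1 ≤ c → c ≤ conj l v → v ≤ nth l c
≤-conj⇒≤-nth v c [] 1≤c p = contradiction (ℕ.≤-trans 1≤c p) λ ()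
≤-conj⇒≤-nth {x ∷ l} v c (xs ∷ ps) 1≤c p with v ℕ.≤? x
... | no nl = contradiction (ℕ.≤-trans 1≤c (ℕ.≤-trans p (ℕ.≤-reflexive empty))) λ ()
  where
  empty : conj (x ∷ l) v ≡ 0
  empty = ≡.cong length (bfilter-none (≤ᵇ-false nl ∷ All.map (λ y≤x → ≤ᵇ-false (λ v≤y → nl (ℕ.≤-trans v≤y y≤x))) xs))
... | yes le rewrite ≤ᵇ-true le with c | p
...   | suc zero | _ = le
...   | suc (suc c) | s≤s p = ≤-conj⇒≤-nth v (suc c) ps (s≤s z≤n) p

-- An occurrence of `v` makes `conj` drop between `v` and `v + 1`, so the entry with index
-- `conj l v` reaches `v` but not `v + 1`. This recovers the index of a bead from its position.
nth-conj : ∀ {l} v → AllPairs _≥_ l → 1 ≤ multiplicity v l → nth l (conj l v) ≡ v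
nth-conj {l} v ps m = ℕ.≤-antisym
  (ℕ.≮⇒≥ (λ gt → ℕ.<⇒≱ below (≤-nth⇒≤-conj (suc v) (conj l v) ps (s≤s z≤n) 1≤conj gt)))
  (≤-conj⇒≤-nth v (conj l v) ps 1≤conj ℕ.≤-refl)
  where
  below : conj l (suc v) < conj l v
  below = ℕ.<-≤-trans (ℕ.m<m+n (conj l (suc v)) m) (ℕ.≤-reflexive (≡.sym (conj-suc l v)))
  1≤conj : 1 ≤ conj l v
  1≤conj = ℕ.≤-trans (s≤s z≤n) below

multiplicity-nth : ∀ l c → 1 ≤ c → c ≤ length l → 1 ≤ multiplicity (nth l c) l
multiplicity-nth (x ∷ l) (suc zero) _ _ rewrite ≡ᵇ-true {x} ≡.refl = s≤s z≤n
multiplicity-nth (x ∷ l) (suc (suc c)) _ (s≤s p) with multiplicity-nth l (suc c) (s≤s z≤n) p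
... | ih with nth l (suc c) ≡ᵇ x
...   | true = s≤s z≤n
...   | false = ih

count-insertDesc : ∀ q x l → count q (insertDesc x l) ≡ count q (x ∷ l)
count-insertDesc q x [] = ≡.refl
count-insertDesc q x (y ∷ l) with y ≤ᵇ x
... | true = ≡.refl
... | false with q x | q y | count-insertDesc q x l
...   | true | true | ih = ≡.cong suc ih
...   | true | false | ih = ih
...   | false | true | ih = ≡.cong suc ih
...   | false | false | ih = ih

count-sortDesc : ∀ q l → count q (sortDesc l) ≡ count q l
count-sortDesc q [] = ≡.refl
count-sortDesc q (x ∷ l) = ≡.trans (count-insertDesc q x (sortDesc l)) (cons {sortDesc l} {l} (count-sortDesc q l))
  where
  cons : ∀ {l l'} → count q l ≡ count q l' → count q (x ∷ l) ≡ count q (x ∷ l')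
  cons e with q x
  ... | true = ≡.cong suc e
  ... | false = e

insertDesc-bound : ∀ {z} x l → x ≤ z → All (_≤ z) l → All (_≤ z) (insertDesc x l)
insertDesc-bound x [] x≤z [] = x≤z ∷ []
insertDesc-bound x (y ∷ l) x≤z (p ∷ ps) with y ≤ᵇ x
... | true = x≤z ∷ p ∷ ps
... | false = p ∷ insertDesc-bound x l x≤z ps

insertDesc-sorted : ∀ x l → AllPairs _≥_ l → AllPairs _≥_ (insertDesc x l)
insertDesc-sorted x [] [] = [] ∷ []
insertDesc-sorted x (y ∷ l) (p ∷ ps) with y ≤ᵇ x in e
... | true = (≤ᵇ-true⁻¹ e ∷ All.map (λ z≤y → ℕ.≤-trans z≤y (≤ᵇ-true⁻¹ e)) p) ∷ p ∷ ps
... | false = insertDesc-bound x l (ℕ.<⇒≤ (ℕ.≰⇒> (≤ᵇ-false⁻¹ e))) p ∷ insertDesc-sorted x l ps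

sortDesc-sorted : ∀ l → AllPairs _≥_ (sortDesc l)
sortDesc-sorted [] = []
sortDesc-sorted (x ∷ l) = insertDesc-sorted x (sortDesc l) (sortDesc-sorted l)

sorted-strict : ∀ {l} → AllPairs _≥_ l → (∀ v → multiplicity v l ≤ 1) → AllPairs _>_ l
sorted-strict [] _ = []
sorted-strict {x ∷ l} (p ∷ ps) m = go p (count-zero⇒none (x ≡ᵇ_) l (ℕ.n≤0⇒n≡0 (s≤s⁻¹ (m' x (m x)))))
  ∷ sorted-strict ps (λ v → ℕ.≤-trans (tail-≤ v) (m v))
  where
  m' : ∀ x → multiplicity x (x ∷ l) ≤ 1 → suc (multiplicity x l) ≤ 1
  m' x p rewrite ≡ᵇ-true {x} ≡.refl = p
  go : ∀ {l} → All (x ≥_) l → All (λ y → (x ≡ᵇ y) ≡ false) l → All (x >_) l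
  go [] [] = []
  go (y≤x ∷ ps) (ne ∷ qs) = ℕ.≤∧≢⇒< y≤x (≡ᵇ-false⁻¹ ne ∘ ≡.sym) ∷ go ps qs
  tail-≤ : ∀ v → multiplicity v l ≤ multiplicity v (x ∷ l)
  tail-≤ v with v ≡ᵇ x
  ... | true = ℕ.n≤1+n _
  ... | false = ℕ.≤-refl

length-coreGo : ∀ m j bs → length (coreGo m j bs) ≡ length bs
length-coreGo m j [] = ≡.refl
length-coreGo m j (b ∷ bs) = ≡.cong suc (length-coreGo m (suc j) bs)

nth-coreGo : ∀ m j bs c → c < length bs →
  nth (coreGo m j bs) (suc c) ≡ (nth bs (suc c) + (j + c)) ∸ m
nth-coreGo m j (b ∷ bs) zero _ = ≡.cong (λ i → (b + i) ∸ m) (≡.sym (ℕ.+-identityʳ j))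
nth-coreGo m j (b ∷ bs) (suc c) (s≤s l) = ≡.trans (nth-coreGo m (suc j) bs c l)
  (≡.cong (λ i → (nth bs (suc c) + i) ∸ m) (≡.sym (ℕ.+-suc j c)))

-- Each bead is at least one below the preceding one, which pays for the shift `j` growing by one.
coreGo-bound : ∀ m j b bs → AllPairs _>_ (b ∷ bs) → All (_≤ (b + j) ∸ m) (coreGo m (suc j) bs)
coreGo-bound m j b [] _ = []
coreGo-bound m j b (b' ∷ bs) ((b>b' ∷ _) ∷ ps) =
  step ∷ All.map (λ z≤ → ℕ.≤-trans z≤ step) (coreGo-bound m (suc j) b' bs ps)
  where
  step : (b' + suc j) ∸ m ≤ (b + j) ∸ m
  step = ℕ.∸-monoˡ-≤ m (ℕ.≤-trans (ℕ.≤-reflexive (ℕ.+-suc b' j)) (ℕ.+-monoˡ-≤ j b>b'))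

coreGo-sorted : ∀ m j bs → AllPairs _>_ bs → AllPairs _≥_ (coreGo m j bs)
coreGo-sorted m j [] [] = []
coreGo-sorted m j (b ∷ bs) (p ∷ ps) = coreGo-bound m j b bs (p ∷ ps) ∷ coreGo-sorted m (suc j) bs ps

max-upper : ∀ (q : ℕ → Bool) {x xs} → x ∈ xs → q x ≡ true → x ≤ foldr _⊔_ 0 (bfilter q xs)
max-upper q {x} (here ≡.refl) e rewrite e = ℕ.m≤m⊔n x _
max-upper q {x} {y ∷ _} (there p) e with q y
... | true = ℕ.≤-trans (max-upper q p e) (ℕ.m≤n⊔m y _)
... | false = max-upper q p e

max-least : ∀ (q : ℕ → Bool) {z} xs → All (λ x → q x ≡ true → x ≤ z) xs → foldr _⊔_ 0 (bfilter q xs) ≤ z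
max-least q [] [] = z≤n
max-least q (x ∷ xs) (p ∷ ps) with q x
... | true = ℕ.⊔-lub (p ≡.refl) (max-least q xs ps)
... | false = max-least q xs ps

-- A positive lower bound excludes the case in which the subtraction is truncated.
≤∸⇒+≤ : ∀ {i n t} → 1 ≤ i → i ≤ n ∸ t → i + t ≤ n
≤∸⇒+≤ {i} {n} {t} 1≤i p with t ℕ.≤? n
... | yes t≤n = ℕ.≤-trans (ℕ.+-monoˡ-≤ t p) (ℕ.≤-reflexive (ℕ.m∸n+n≡m t≤n))
... | no t≰n = contradiction (ℕ.≤-trans 1≤i (ℕ.≤-trans p (ℕ.≤-reflexive (ℕ.m≤n⇒m∸n≡0 (ℕ.<⇒≤ (ℕ.≰⇒> t≰n)))))) λ ()

-- The abacus and orthogonal cores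

module Abacus (u : ℕ) (n : ℕ → ℕ) (total : sumBelow n (suc u) ≡ suc u) where

  t : ℕ
  t = suc u

  -- The abacus of the t-core: the beads with residue `i` are pushed down to the heights 0, ...,
  -- `n i` - 1.
  runner : ℕ → List ℕ
  runner i = map (λ j → t · j + i) (upTo (n i))

  -- Spelled like the list inside `core`, so that `Core.ν` is the t-core by definition.
  beads : List ℕ
  beads = sortDesc (concat (map runner (upTo t)))

  count-beads : ∀ q → count q beads ≡ sumBelow (count q ∘ runner) t
  count-beads q = ≡.trans (count-sortDesc q (concat (map runner (upTo t)))) (count-concat q runner t)

  length-beads : length beads ≡ t
  length-beads = ≡.trans (≡.sym (conj-zero beads)) (≡.trans (count-beads (0 ≤ᵇ_))
    (≡.trans (sumBelow-cong t (λ i _ → ≡.trans (count-map-upTo (0 ≤ᵇ_) (λ j → t · j + i) (n i)) (ones (n i)))) total))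
    where
    ones : ∀ m → sumBelow (λ _ → 1) m ≡ m
    ones zero = ≡.refl
    ones (suc m) = ≡.trans (ℕ.+-comm (sumBelow (λ _ → 1) m) 1) (≡.cong suc (ones m))

  residue : ∀ j i → i < t → (t · j + i) % t ≡ i
  residue j i l = ≡.trans (≡.cong (_% t) (≡.trans (ℕ.+-comm (t · j) i) (≡.cong (_+_ i) (ℕ.*-comm t j))))
    (≡.trans ([m+kn]%n≡m%n i j t) (m<n⇒m%n≡m l))

  quotient-≡ : ∀ j i → i < t → (t · j + i) / t ≡ j
  quotient-≡ j i l = ℕ.*-cancelˡ-≡ _ j t (ℕ.+-cancelˡ-≡ i _ _ (≡.sym (begin
    i + t · j                                  ≡⟨ ℕ.+-comm i (t · j) ⟩
    t · j + i                                  ≡⟨ m≡m%n+[m/n]*n (t · j + i) t ⟩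
    (t · j + i) % t + (t · j + i) / t · t      ≡⟨ ≡.cong₂ _+_ (residue j i l) (ℕ.*-comm ((t · j + i) / t) t) ⟩
    i + t · ((t · j + i) / t)                  ∎)))
    where
    open ≡.≡-Reasoning

  multiplicity-runner : ∀ v i → i < t →
    multiplicity v (runner i) ≡ (if v % t ≡ᵇ i then (if v / t <ᵇ n i then 1 else 0) else 0)
  multiplicity-runner v i l = ≡.trans (count-map-upTo (v ≡ᵇ_) (λ j → t · j + i) (n i)) (cases (v % t ℕ.≟ i))
    where
    cases : _ → sumBelow (λ j → if v ≡ᵇ t · j + i then 1 else 0) (n i)
      ≡ (if v % t ≡ᵇ i then (if v / t <ᵇ n i then 1 else 0) else 0)
    cases (no ne) rewrite ≡ᵇ-false ne = zeros (n i)
      where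
      zeros : ∀ m → sumBelow (λ j → if v ≡ᵇ t · j + i then 1 else 0) m ≡ 0
      zeros zero = ≡.refl
      zeros (suc m) rewrite zeros m
        | ≡ᵇ-false {v} {t · m + i} (λ e → ne (≡.trans (≡.cong (_% t) e) (residue m i l))) = ≡.refl
    cases (yes e) rewrite ≡ᵇ-true e = ≡.trans
      (sumBelow-cong (n i) (λ j _ → ≡.cong (if_then 1 else 0) (same j)))
      (sumBelow-single 1 (v / t) (n i))
      where
      same : ∀ j → (v ≡ᵇ t · j + i) ≡ (v / t ≡ᵇ j)
      same j with v / t ℕ.≟ j
      ... | yes q≡j = ≡.trans (≡ᵇ-true (≡.trans (m≡m%n+[m/n]*n v t) (≡.trans (ℕ.+-comm (v % t) _)
            (≡.cong₂ _+_ (≡.trans (≡.cong (_· t) q≡j) (ℕ.*-comm j t)) e)))) (≡.sym (≡ᵇ-true q≡j))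
      ... | no q≢j = ≡.trans (≡ᵇ-false {v} {t · j + i} (λ v≡ → q≢j (≡.trans (≡.cong (_/ t) v≡) (quotient-≡ j i l))))
            (≡.sym (≡ᵇ-false q≢j))

  multiplicity-beads : ∀ v → multiplicity v beads ≡ (if v / t <ᵇ n (v % t) then 1 else 0)
  multiplicity-beads v = begin
    multiplicity v beads
      ≡⟨ count-beads (v ≡ᵇ_) ⟩
    sumBelow (multiplicity v ∘ runner) t
      ≡⟨ sumBelow-cong t (λ i l → ≡.trans (multiplicity-runner v i l) (same i)) ⟩
    sumBelow (λ i → if v % t ≡ᵇ i then (if v / t <ᵇ n (v % t) then 1 else 0) else 0) t
      ≡⟨ sumBelow-single _ (v % t) t ⟩
    (if v % t <ᵇ t then (if v / t <ᵇ n (v % t) then 1 else 0) else 0)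
      ≡⟨ ≡.cong (if_then (if v / t <ᵇ n (v % t) then 1 else 0) else 0) (<ᵇ-true (m%n<n v t)) ⟩
    (if v / t <ᵇ n (v % t) then 1 else 0) ∎
    where
    open ≡.≡-Reasoning
    same : ∀ i → (if v % t ≡ᵇ i then (if v / t <ᵇ n i then 1 else 0) else 0)
      ≡ (if v % t ≡ᵇ i then (if v / t <ᵇ n (v % t) then 1 else 0) else 0)
    same i with v % t ≡ᵇ i in e
    ... | true = ≡.cong (λ k → if v / t <ᵇ n k then 1 else 0) (≡.sym (≡ᵇ-true⁻¹ e))
    ... | false = ≡.refl

  bead-≡ : ∀ j i → i < t → multiplicity (t · j + i) beads ≡ (if j <ᵇ n i then 1 else 0)
  bead-≡ j i l = ≡.trans (multiplicity-beads (t · j + i))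
    (≡.cong₂ (λ q r → if q <ᵇ n r then 1 else 0) (quotient-≡ j i l) (residue j i l))

  multiplicity-≤1 : ∀ v → multiplicity v beads ≤ 1
  multiplicity-≤1 v = ℕ.≤-trans (ℕ.≤-reflexive (multiplicity-beads v)) (bound (v / t <ᵇ n (v % t)))
    where
    bound : ∀ p → (if p then 1 else 0) ≤ 1
    bound true = ℕ.≤-refl
    bound false = z≤n

  beads-sorted : AllPairs _≥_ beads
  beads-sorted = sortDesc-sorted (concat (map runner (upTo t)))

  -- Only the bottom bead of a runner lies below `t`; the truncated subtraction covers the empty
  -- runners.
  conj-beads-t : conj beads t ≡ sumBelow (λ i → n i ∸ 1) t
  conj-beads-t = ≡.trans (count-beads (t ≤ᵇ_)) (sumBelow-cong t (λ i l →
    ≡.trans (count-map-upTo (t ≤ᵇ_) (λ j → t · j + i) (n i)) (above i l (n i))))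
    where
    above : ∀ i → i < t → ∀ m → sumBelow (λ j → if t ≤ᵇ t · j + i then 1 else 0) m ≡ m ∸ 1
    above i l zero = ≡.refl
    above i l (suc zero) rewrite ℕ.*-zeroʳ u | ≤ᵇ-false (ℕ.<⇒≱ l) = ≡.refl
    above i l (suc (suc m)) = ≡.trans (≡.cong₂ _+_ (above i l (suc m)) (≡.cong (if_then 1 else 0)
      (≤ᵇ-true {t} {t · suc m + i} (ℕ.≤-trans (ℕ.m≤m*n t (suc m)) (ℕ.m≤m+n _ i))))) (ℕ.+-comm m 1)

-- The indices `i` and `j` may coincide, so for even `t` the runner `t / 2` is covered: it has at
-- most, respectively exactly, one bead.
Bounded Balanced : ℕ → (ℕ → ℕ) → Set
Bounded t n = n 0 ≤ 1 × (∀ i j → 1 ≤ i → 1 ≤ j → i + j ≡ t → n i + n j ≤ 2)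
Balanced t n = n 0 ≡ 1 × (∀ i j → 1 ≤ i → 1 ≤ j → i + j ≡ t → n i + n j ≡ 2)

-- Let `N` be the number of beads outside runner 0. Then `n 0 ≤ 1` forces `N ≥ u`, while adding the
-- pair bounds over all `i`, which counts every such bead twice, forces `N ≤ u`. Hence all the
-- bounds are attained.
bounded⇒balanced : ∀ u n → sumBelow n (suc u) ≡ suc u → Bounded (suc u) n → Balanced (suc u) n
bounded⇒balanced u n total (n₀≤1 , pair-≤2) = n₀≡1 , pairs
  where
  N : ℕ
  N = sumBelow (n ∘ suc) u
  g : ℕ → ℕ
  g i = n (suc i) + n (suc (u ∸ suc i))
  n₀+N : n 0 + N ≡ suc u
  n₀+N = ≡.trans (≡.sym (sumBelow-∷ n u)) total
  sum-g : sumBelow g u ≡ N + N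
  sum-g = ≡.trans (sumBelow-+ (n ∘ suc) (λ i → n (suc (u ∸ suc i))) u)
    (≡.cong (_+_ N) (≡.sym (sumBelow-reverse (n ∘ suc) u)))
  u*2 : u · 2 ≡ u + u
  u*2 = ≡.trans (ℕ.*-comm u 2) (≡.cong (_+_ u) (ℕ.+-identityʳ u))
  g-≤2 : ∀ i → i < u → g i ≤ 2
  g-≤2 i i<u = pair-≤2 (suc i) (suc (u ∸ suc i)) (s≤s z≤n) (s≤s z≤n)
    (≡.cong suc (≡.trans (ℕ.+-suc i _) (ℕ.m+[n∸m]≡n i<u)))
  u≤N : u ≤ N
  u≤N = s≤s⁻¹ (ℕ.≤-trans (ℕ.≤-reflexive (≡.sym n₀+N)) (ℕ.+-monoˡ-≤ N n₀≤1))
  N≤u : N ≤ u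
  N≤u = ℕ.≮⇒≥ λ u<N → ℕ.<⇒≱ (ℕ.+-mono-< u<N u<N)
    (ℕ.≤-trans (ℕ.≤-reflexive (≡.sym sum-g)) (ℕ.≤-trans (sumBelow-≤ g 2 u g-≤2) (ℕ.≤-reflexive u*2)))
  n₀≡1 : n 0 ≡ 1
  n₀≡1 = ℕ.+-cancelʳ-≡ N _ _ (≡.trans n₀+N (≡.cong suc (ℕ.≤-antisym u≤N N≤u)))
  saturated : ∀ i → i < u → g i ≡ 2
  saturated = sumBelow-saturated g 2 u g-≤2 (ℕ.≤-trans (ℕ.≤-reflexive u*2)
    (ℕ.≤-trans (ℕ.+-mono-≤ u≤N u≤N) (ℕ.≤-reflexive (≡.sym sum-g))))
  pairs : ∀ i j → 1 ≤ i → 1 ≤ j → i + j ≡ suc u → n i + n j ≡ 2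
  pairs (suc i) (suc j) _ _ e = ≡.trans
    (≡.cong (λ k → n (suc i) + n (suc k)) (ℕ.+-cancelˡ-≡ (suc i) _ _ (≡.trans i+j≡u (≡.sym (ℕ.m+[n∸m]≡n i<u)))))
    (saturated i i<u)
    where
    i+j≡u : suc i + j ≡ u
    i+j≡u = ≡.trans (≡.sym (ℕ.+-suc i j)) (ℕ.suc-injective e)
    i<u : i < u
    i<u = ℕ.≤-trans (ℕ.m≤m+n (suc i) j) (ℕ.≤-reflexive i+j≡u)

-- Orthogonality of the core in terms of the runner sizes

module Core (t : ℕ) (1≤t : 1 ≤ t) (n : ℕ → ℕ)
  (beads : List ℕ) (length-beads : length beads ≡ t) (beads-sorted : AllPairs _≥_ beads)
  (multiplicity-≤1 : ∀ v → multiplicity v beads ≤ 1)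
  (bead-≡ : ∀ j i → i < t → multiplicity (t · j + i) beads ≡ (if j <ᵇ n i then 1 else 0)) where

  ν : List ℕ
  ν = coreGo (length beads) 1 beads

  bead : ℕ → ℕ → ℕ
  bead j i = multiplicity (t · j + i) beads

  bead-present : ∀ j i → i < t → j < n i → bead j i ≡ 1
  bead-present j i l p = ≡.trans (bead-≡ j i l) (≡.cong (if_then 1 else 0) (<ᵇ-true p))

  bead-absent : ∀ j i → i < t → n i ≤ j → bead j i ≡ 0
  bead-absent j i l p = ≡.trans (bead-≡ j i l) (≡.cong (if_then 1 else 0) (<ᵇ-false (ℕ.≤⇒≯ p)))

  ν-sorted : AllPairs _≥_ ν
  ν-sorted = coreGo-sorted (length beads) 1 beads (sorted-strict beads-sorted multiplicity-≤1)

  length-ν : length ν ≡ t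
  length-ν = ≡.trans (length-coreGo (length beads) 1 beads) length-beads

  nth-ν : ∀ c → 1 ≤ c → c ≤ t → nth ν c ≡ (nth beads c + c) ∸ t
  nth-ν (suc c) _ l = ≡.trans (nth-coreGo (length beads) 1 beads c (ℕ.≤-trans l (ℕ.≤-reflexive (≡.sym length-beads))))
    (≡.cong (_∸_ (nth beads (suc c) + suc c)) length-beads)

  conj-≤t : ∀ v → conj beads v ≤ t
  conj-≤t v = ℕ.≤-trans (conj-≤-length beads v) (ℕ.≤-reflexive length-beads)

  conj-ν-≤t : ∀ v → conj ν v ≤ t
  conj-ν-≤t v = ℕ.≤-trans (conj-≤-length ν v) (ℕ.≤-reflexive length-ν)

  -- The k-th part is b_k - t + k for the k-th bead b_k, so it is at least k exactly if b_k ≥ t.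
  rank-≡ : rank ν ≡ conj beads t
  rank-≡ = ℕ.≤-antisym
    (max-least test indices (All.map⁺ (All.map (λ {k} k<len → upper k k<len) (All.all-upTo (length ν)))))
    (lower (conj beads t) ≡.refl)
    where
    test : ℕ → Bool
    test k = k ≤ᵇ nth ν k
    indices : List ℕ
    indices = map suc (upTo (length ν))
    upper : ∀ k → k < length ν → test (suc k) ≡ true → suc k ≤ conj beads t
    upper k k<len e = ≤-nth⇒≤-conj t (suc k) beads-sorted 1≤t (s≤s z≤n)
      (ℕ.+-cancelʳ-≤ (suc k) _ _ (ℕ.≤-trans (ℕ.≤-reflexive (ℕ.+-comm t (suc k))) (≤∸⇒+≤ (s≤s z≤n)
        (ℕ.≤-trans (≤ᵇ-true⁻¹ {suc k} e)
          (ℕ.≤-reflexive (nth-ν (suc k) (s≤s z≤n) (ℕ.≤-trans k<len (ℕ.≤-reflexive length-ν))))))))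
    lower : ∀ r → conj beads t ≡ r → r ≤ rank ν
    lower zero _ = z≤n
    lower (suc r) e = max-upper test (∈-map⁺ suc (∈-upTo⁺ (ℕ.≤-trans r<t (ℕ.≤-reflexive (≡.sym length-ν)))))
      (≤ᵇ-true (ℕ.≤-trans (ℕ.m+n≤o⇒m≤o∸n (suc r) (ℕ.≤-trans (ℕ.≤-reflexive (ℕ.+-comm (suc r) t)) (ℕ.+-monoˡ-≤ (suc r)
        (≤-conj⇒≤-nth t (suc r) beads-sorted (s≤s z≤n) (ℕ.≤-reflexive (≡.sym e))))))
        (ℕ.≤-reflexive (≡.sym (nth-ν (suc r) (s≤s z≤n) r<t)))))
      where
      r<t : suc r ≤ t
      r<t = ℕ.≤-trans (ℕ.≤-reflexive (≡.sym e)) (conj-≤t t)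

  orthogonal⇒≡ : ∀ {a i c} → (+ a) ℤ.- (+ i) ≡ ((+ c) ℤ.- (+ i)) ℤ.+ (+ 1) → a ≡ suc c
  orthogonal⇒≡ {a} {i} {c} e = ≡.trans (ℤ.+-injective (≡.trans (lhs (+ a) (+ i))
    (≡.trans (≡.cong (ℤ._+ + i) e) (rhs (+ c) (+ i))))) (ℕ.+-comm c 1)
    where
    lhs : ∀ A I → A ≡ (A ℤ.- I) ℤ.+ I
    lhs = ℤSolver.solve-∀
    rhs : ∀ C I → ((C ℤ.- I) ℤ.+ (+ 1)) ℤ.+ I ≡ C ℤ.+ (+ 1)
    rhs = ℤSolver.solve-∀

  ≡⇒orthogonal : ∀ {a i c} → a ≡ suc c → (+ a) ℤ.- (+ i) ≡ ((+ c) ℤ.- (+ i)) ℤ.+ (+ 1)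
  ≡⇒orthogonal {_} {i} {c} ≡.refl = lem (+ c) (+ i)
    where
    lem : ∀ C I → ((+ 1) ℤ.+ C) ℤ.- I ≡ (C ℤ.- I) ℤ.+ (+ 1)
    lem = ℤSolver.solve-∀

  -- If the mirror image y of x were a bead, the c-th one, then the defining equation of
  -- orthogonality at x would make i ≤ ν_c and c ≤ ν′_i inequivalent.
  mirror : Orthogonal ν → ∀ x → t ≤ x → 1 ≤ multiplicity x beads →
    ∃[ y ] (x + y ≡ t + t × multiplicity y beads ≡ 0)
  mirror orth x t≤x x∈ = y , x+y≡ , ℕ.n<1⇒n≡0 (ℕ.≰⇒> y∉)
    where
    i K y : ℕ
    i = conj beads x
    K = conj ν i
    y = t + t ∸ x
    nth≡x : nth beads i ≡ x
    nth≡x = nth-conj x beads-sorted x∈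
    1≤i : 1 ≤ i
    1≤i = ℕ.≤-trans x∈ (ℕ.≤-trans (ℕ.m≤n+m _ _) (ℕ.≤-reflexive (≡.sym (conj-suc beads x))))
    i≤rank : i ≤ rank ν
    i≤rank = ℕ.≤-trans (≤-nth⇒≤-conj t i beads-sorted 1≤t 1≤i (ℕ.≤-trans t≤x (ℕ.≤-reflexive (≡.sym nth≡x))))
      (ℕ.≤-reflexive (≡.sym rank-≡))
    -- The orthogonality equation at index `i`, with the i-th part of `ν` written as x + i - t.
    star : x + i ≡ t + suc K
    star = begin
      x + i                ≡⟨ ℕ.m+[n∸m]≡n (ℕ.≤-trans t≤x (ℕ.m≤m+n x i)) ⟨
      t + ((x + i) ∸ t)    ≡⟨ ≡.cong (λ z → t + ((z + i) ∸ t)) nth≡x ⟨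
      t + ((nth beads i + i) ∸ t) ≡⟨ ≡.cong (_+_ t) (nth-ν i 1≤i (conj-≤t x)) ⟨
      t + nth ν i          ≡⟨ ≡.cong (_+_ t) (orthogonal⇒≡ {nth ν i} {i} {K} (orth i 1≤i i≤rank)) ⟩
      t + suc K            ∎
      where
      open ≡.≡-Reasoning
    -- No part of the conjugate exceeds the number `t` of parts of `ν`; with `star` this shows that
    -- the subtraction defining `y` is not truncated.
    x≤2t : x ≤ t + t
    x≤2t = ℕ.+-cancelʳ-≤ 1 x (t + t) (begin
      x + 1              ≤⟨ ℕ.+-monoʳ-≤ x 1≤i ⟩
      x + i              ≡⟨ star ⟩
      t + suc K          ≡⟨ ≡.cong (_+_ t) (ℕ.+-comm 1 K) ⟩
      t + (K + 1)        ≡⟨ ℕ.+-assoc t K 1 ⟨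
      t + K + 1          ≤⟨ ℕ.+-monoˡ-≤ 1 (ℕ.+-monoʳ-≤ t (conj-ν-≤t i)) ⟩
      t + t + 1          ∎)
      where
      open ℕ.≤-Reasoning
    x+y≡ : x + y ≡ t + t
    x+y≡ = ℕ.m+[n∸m]≡n x≤2t
    y∉ : ¬ (1 ≤ multiplicity y beads)
    y∉ y∈ = cases (c ℕ.≤? K)
      where
      c : ℕ
      c = conj beads y
      1≤c : 1 ≤ c
      1≤c = ℕ.≤-trans y∈ (ℕ.≤-trans (ℕ.m≤n+m _ _) (ℕ.≤-reflexive (≡.sym (conj-suc beads y))))
      nth-c : nth ν c ≡ (y + c) ∸ t
      nth-c = ≡.trans (nth-ν c 1≤c (conj-≤t y)) (≡.cong (λ z → (z + c) ∸ t) (nth-conj y beads-sorted y∈))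
      cases : _ → _
      cases (yes c≤K) = ℕ.<-irrefl ≡.refl (ℕ.+-cancelˡ-≤ (t + t) (suc K) K (begin
        t + t + suc K          ≡⟨ lem₁ t (suc K) ⟩
        (t + suc K) + t        ≡⟨ ≡.cong (_+ t) star ⟨
        (x + i) + t            ≡⟨ ℕ.+-assoc x i t ⟩
        x + (i + t)            ≤⟨ ℕ.+-monoʳ-≤ x (≤∸⇒+≤ 1≤i (ℕ.≤-trans (≤-conj⇒≤-nth i c ν-sorted 1≤c c≤K) (ℕ.≤-reflexive nth-c))) ⟩
        x + (y + c)            ≤⟨ ℕ.+-monoʳ-≤ x (ℕ.+-monoʳ-≤ y c≤K) ⟩
        x + (y + K)            ≡⟨ ℕ.+-assoc x y K ⟨
        x + y + K              ≡⟨ ≡.cong (_+ K) x+y≡ ⟩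
        t + t + K              ∎))
        where
        open ℕ.≤-Reasoning
        lem₁ : ∀ t k → t + t + k ≡ (t + k) + t
        lem₁ = ℕSolver.solve-∀
      cases (no c≰K) = c≰K (≤-nth⇒≤-conj i c ν-sorted 1≤i 1≤c (ℕ.≤-trans (ℕ.m+n≤o⇒m≤o∸n i
        (ℕ.+-cancelˡ-≤ x (i + t) (y + c) (begin
          x + (i + t)          ≡⟨ ℕ.+-assoc x i t ⟨
          (x + i) + t          ≡⟨ ≡.cong (_+ t) star ⟩
          (t + suc K) + t      ≡⟨ lem₁ t (suc K) ⟩
          t + t + suc K        ≡⟨ ≡.cong (_+ suc K) x+y≡ ⟨
          x + y + suc K        ≡⟨ ℕ.+-assoc x y (suc K) ⟩
          x + (y + suc K)      ≤⟨ ℕ.+-monoʳ-≤ x (ℕ.+-monoʳ-≤ y (ℕ.≰⇒> c≰K)) ⟩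
          x + (y + c)          ∎))) (ℕ.≤-reflexive (≡.sym nth-c))))
        where
        open ℕ.≤-Reasoning
        lem₁ : ∀ t k → (t + k) + t ≡ t + t + k
        lem₁ = ℕSolver.solve-∀

  -- A second bead on runner 0 would sit at `t`, which is its own mirror image. A third bead on
  -- runner `i` would lie beyond 2t and have no mirror image. A second one, at t + i, has the bottom
  -- place of runner t - i as its mirror image and so forces that runner to be empty.
  orthogonal⇒bounded : Orthogonal ν → Bounded t n
  orthogonal⇒bounded orth = n₀≤1 , pair-≤2
    where
    n₀≤1 : n 0 ≤ 1
    n₀≤1 = ℕ.≮⇒≥ impossible
      where
      impossible : ¬ (1 < n 0)
      impossible l = absurd (mirror orth t ℕ.≤-refl (ℕ.≤-reflexive (≡.sym t∈)))
        where
        t∈ : multiplicity t beads ≡ 1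
        t∈ = ≡.subst (λ v → multiplicity v beads ≡ 1)
          (≡.trans (ℕ.+-identityʳ (t · 1)) (ℕ.*-identityʳ t)) (bead-present 1 0 1≤t l)
        absurd : ¬ (∃[ y ] (t + y ≡ t + t × multiplicity y beads ≡ 0))
        absurd (y , e , y∉) = contradiction (≡.trans (≡.sym t∈) (≡.subst (λ v → multiplicity v beads ≡ 0)
          (ℕ.+-cancelˡ-≡ t y t e) y∉)) λ ()
    double : ∀ i j → 1 ≤ i → 1 ≤ j → i + j ≡ t → 2 ≤ n i → n i ≤ 2 × n j ≡ 0
    double i j 1≤i 1≤j e 2≤nᵢ = ℕ.≮⇒≥ triple , ℕ.n<1⇒n≡0 (ℕ.≰⇒> occupied)
      where
      i<t : i < t
      i<t = ℕ.<-≤-trans (ℕ.m<m+n i 1≤j) (ℕ.≤-reflexive e)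
      j<t : j < t
      j<t = ℕ.<-≤-trans (ℕ.m<n+m j 1≤i) (ℕ.≤-reflexive e)
      t≤ : ∀ k → t ≤ t · suc k + i
      t≤ k = ℕ.≤-trans (ℕ.m≤m*n t (suc k)) (ℕ.m≤m+n _ i)
      triple : ¬ (2 < n i)
      triple l = absurd (mirror orth (t · 2 + i) (t≤ 1) (ℕ.≤-reflexive (≡.sym (bead-present 2 i i<t l))))
        where
        absurd : ¬ (∃[ y ] (t · 2 + i + y ≡ t + t × multiplicity y beads ≡ 0))
        absurd (y , e' , _) = ℕ.>⇒≢ (ℕ.<-≤-trans (ℕ.m<m+n (t + t) 1≤i)
          (ℕ.≤-trans (ℕ.≤-reflexive (≡.cong (_+ i) (≡.sym t*2≡))) (ℕ.m≤m+n _ y))) e'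
          where
          t*2≡ : t · 2 ≡ t + t
          t*2≡ = ≡.trans (ℕ.*-comm t 2) (≡.cong (_+_ t) (ℕ.+-identityʳ t))
      occupied : ¬ (1 ≤ n j)
      occupied l = absurd (mirror orth (t · 1 + i) (t≤ 0) (ℕ.≤-reflexive (≡.sym (bead-present 1 i i<t 2≤nᵢ))))
        where
        absurd : ¬ (∃[ y ] (t · 1 + i + y ≡ t + t × multiplicity y beads ≡ 0))
        absurd (y , e' , y∉) = contradiction (≡.trans (≡.sym (bead-present 0 j j<t l))
          (≡.subst (λ v → multiplicity v beads ≡ 0) y≡ y∉)) λ ()
          where
          y≡ : y ≡ t · 0 + j
          y≡ = ≡.trans (ℕ.+-cancelˡ-≡ i _ j (ℕ.+-cancelˡ-≡ t _ _ (≡.trans (≡.sym (ℕ.+-assoc t i y))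
            (≡.trans (≡.cong (λ z → z + i + y) (≡.sym (ℕ.*-identityʳ t))) (≡.trans e' (≡.cong (_+_ t) (≡.sym e)))))))
            (≡.cong (_+ j) (≡.sym (ℕ.*-zeroʳ t)))
    pair-≤2 : ∀ i j → 1 ≤ i → 1 ≤ j → i + j ≡ t → n i + n j ≤ 2
    pair-≤2 i j 1≤i 1≤j e = cases (2 ℕ.≤? n i) (2 ℕ.≤? n j)
      where
      cases : Dec (2 ≤ n i) → Dec (2 ≤ n j) → n i + n j ≤ 2
      cases (yes l) _ = ℕ.+-mono-≤ (proj₁ (double i j 1≤i 1≤j e l)) (ℕ.≤-reflexive (proj₂ (double i j 1≤i 1≤j e l)))
      cases (no _) (yes l) = ℕ.+-mono-≤ (ℕ.≤-reflexive (proj₂ (double j i 1≤j 1≤i (≡.trans (ℕ.+-comm j i) e) l)))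
        (proj₁ (double j i 1≤j 1≤i (≡.trans (ℕ.+-comm j i) e) l))
      cases (no nᵢ<2) (no nⱼ<2) = ℕ.+-mono-≤ (s≤s⁻¹ (ℕ.≰⇒> nᵢ<2)) (s≤s⁻¹ (ℕ.≰⇒> nⱼ<2))

  module _ (balanced : Balanced t n) where

    n-≤2 : ∀ i → i < t → n i ≤ 2
    n-≤2 zero _ = ℕ.≤-trans (ℕ.≤-reflexive (proj₁ balanced)) (s≤s z≤n)
    n-≤2 (suc i) l = ℕ.≤-trans (ℕ.m≤m+n _ (n (t ∸ suc i))) (ℕ.≤-reflexive
      (proj₂ balanced (suc i) (t ∸ suc i) (s≤s z≤n) (ℕ.m<n⇒0<n∸m l) (ℕ.m+[n∸m]≡n (ℕ.<⇒≤ l))))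

    far-empty : ∀ j i → i < t → 2 ≤ j → multiplicity (t · j + i) beads ≡ 0
    far-empty j i l 2≤j = bead-absent j i l (ℕ.≤-trans (n-≤2 i l) 2≤j)

    -- A balanced abacus has at most two beads on a runner and a single one on runner 0, so neither
    -- `t` nor any place from 2t on is occupied.
    bead-form : ∀ x → t ≤ x → 1 ≤ multiplicity x beads → ∃[ a ] (x ≡ t + suc a × suc a < t)
    bead-form x t≤x x∈ = form (decompose x)
      where
      decompose : ∀ x → ∃[ j ] ∃[ i ] (x ≡ t · j + i × i < t)
      decompose zero = 0 , 0 , ≡.sym (≡.trans (ℕ.+-identityʳ _) (ℕ.*-zeroʳ t)) , 1≤t
      decompose (suc x) with decompose x
      ... | j , i , e , l with suc i ℕ.≟ t
      ...   | yes i≡ = suc j , 0 , ≡.trans (≡.cong suc e) (≡.trans (≡.sym (ℕ.+-suc (t · j) i))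
              (≡.trans (≡.cong (_+_ (t · j)) i≡) (≡.trans (ℕ.+-comm (t · j) t)
              (≡.trans (≡.sym (ℕ.*-suc t j)) (≡.sym (ℕ.+-identityʳ _)))))) , 1≤t
      ...   | no i≢ = j , suc i , ≡.trans (≡.cong suc e) (≡.sym (ℕ.+-suc (t · j) i)) , ℕ.≤∧≢⇒< l i≢
      form : ∃[ j ] ∃[ i ] (x ≡ t · j + i × i < t) → ∃[ a ] (x ≡ t + suc a × suc a < t)
      form (zero , i , e , l) = contradiction t≤x (ℕ.<⇒≱ (ℕ.≤-trans (s≤s (ℕ.≤-reflexive
        (≡.trans e (≡.cong (_+ i) (ℕ.*-zeroʳ t))))) l))
      form (suc zero , zero , e , l) = contradiction (≡.trans (≡.cong (λ v → multiplicity v beads) e)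
        (bead-absent 1 0 1≤t (ℕ.≤-reflexive (proj₁ balanced)))) (ℕ.>⇒≢ x∈)
      form (suc zero , suc a , e , l) = a , ≡.trans e (≡.cong (_+ suc a) (ℕ.*-identityʳ t)) , l
      form (suc (suc j) , i , e , l) = contradiction (≡.trans (≡.cong (λ v → multiplicity v beads) e)
        (far-empty (suc (suc j)) i l (s≤s (s≤s z≤n)))) (ℕ.>⇒≢ x∈)

    -- t - a is the bottom place of its runner and t + a the second place of the opposite runner.
    -- Each of the sizes (2,0), (1,1), (0,2) fills exactly one of the two.
    mirror-sum : ∀ a → 1 ≤ a → a < t → multiplicity (t ∸ a) beads + multiplicity (t + a) beads ≡ 1
    mirror-sum a 1≤a a<t = ≡.trans (≡.cong₂ _+_
        (≡.trans (≡.cong (λ v → multiplicity v beads) (≡.cong (_+ (t ∸ a)) (≡.sym (ℕ.*-zeroʳ t)))) (bead-≡ 0 (t ∸ a) (ℕ.∸-monoʳ-< 1≤a (ℕ.<⇒≤ a<t))))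
        (≡.trans (≡.cong (λ v → multiplicity v beads) (≡.cong (_+ a) (≡.sym (ℕ.*-identityʳ t)))) (bead-≡ 1 a a<t)))
      (values (n (t ∸ a)) (n a) (proj₂ balanced (t ∸ a) a (ℕ.m<n⇒0<n∸m a<t) 1≤a (ℕ.m∸n+n≡m (ℕ.<⇒≤ a<t))))
      where
      values : ∀ p q → p + q ≡ 2 → (if 0 <ᵇ p then 1 else 0) + (if 1 <ᵇ q then 1 else 0) ≡ 1
      values zero (suc (suc zero)) ≡.refl = ≡.refl
      values (suc zero) (suc zero) ≡.refl = ≡.refl
      values (suc (suc zero)) zero ≡.refl = ≡.refl
      values (suc (suc (suc _))) _ ()

    -- The difference of the two values of `conj` counts the beads from t - a to t + a: one in each
    -- mirror pair and none at `t`.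
    conj-mirror : ∀ a → a < t → conj beads (t ∸ a) ≡ conj beads (suc (t + a)) + a
    conj-mirror zero _ = ≡.trans (conj-suc beads t) (≡.cong₂ _+_ (≡.cong (conj beads ∘ suc) (≡.sym (ℕ.+-identityʳ t)))
      (≡.trans (≡.cong (λ v → multiplicity v beads) (≡.trans (≡.sym (ℕ.*-identityʳ t)) (≡.sym (ℕ.+-identityʳ (t · 1)))))
        (bead-absent 1 0 1≤t (ℕ.≤-reflexive (proj₁ balanced)))))
    conj-mirror (suc a) a<t = begin
      conj beads (t ∸ suc a)
        ≡⟨ conj-suc beads (t ∸ suc a) ⟩
      conj beads (suc (t ∸ suc a)) + lowM
        ≡⟨ ≡.cong (λ v → conj beads v + lowM) (≡.sym (ℕ.+-∸-assoc 1 (ℕ.<⇒≤ a<t))) ⟩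
      conj beads (t ∸ a) + lowM
        ≡⟨ ≡.cong (_+ lowM) (conj-mirror a (ℕ.<⇒≤ a<t)) ⟩
      conj beads (suc (t + a)) + a + lowM
        ≡⟨ ≡.cong (λ v → conj beads v + a + lowM) (≡.sym (ℕ.+-suc t a)) ⟩
      conj beads (t + suc a) + a + lowM
        ≡⟨ ≡.cong (λ z → z + a + lowM) (conj-suc beads (t + suc a)) ⟩
      conj beads (suc (t + suc a)) + highM + a + lowM
        ≡⟨ lem (conj beads (suc (t + suc a))) highM a lowM ⟩
      conj beads (suc (t + suc a)) + (a + (lowM + highM))
        ≡⟨ ≡.cong (λ z → conj beads (suc (t + suc a)) + (a + z)) (mirror-sum (suc a) (s≤s z≤n) a<t) ⟩
      conj beads (suc (t + suc a)) + (a + 1)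
        ≡⟨ ≡.cong (_+_ (conj beads (suc (t + suc a)))) (ℕ.+-comm a 1) ⟩
      conj beads (suc (t + suc a)) + suc a ∎
      where
      open ≡.≡-Reasoning
      lowM highM : ℕ
      lowM = multiplicity (t ∸ suc a) beads
      highM = multiplicity (t + suc a) beads
      lem : ∀ x h a l → x + h + a + l ≡ x + (a + (l + h))
      lem = ℕSolver.solve-∀

    -- Let the i-th bead be t + a + 1. Its mirror image y = t - a - 1 is a gap with exactly K = i +
    -- a beads above it. The K-th bead lies above `y` and the next one below, which says that the
    -- i-th part of the conjugate is `K`, whereas the i-th part of `ν` is K + 1.
    balanced⇒orthogonal : Orthogonal ν
    balanced⇒orthogonal i 1≤i i≤rank = ≡⇒orthogonal {nth ν i} {i} {conj ν i} (main (bead-form x t≤x x∈))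
      where
      x : ℕ
      x = nth beads i
      i≤r : i ≤ conj beads t
      i≤r = ℕ.≤-trans i≤rank (ℕ.≤-reflexive rank-≡)
      i≤t : i ≤ t
      i≤t = ℕ.≤-trans i≤r (conj-≤t t)
      t≤x : t ≤ x
      t≤x = ≤-conj⇒≤-nth t i beads-sorted 1≤i i≤r
      x∈ : 1 ≤ multiplicity x beads
      x∈ = multiplicity-nth beads i 1≤i (ℕ.≤-trans i≤t (ℕ.≤-reflexive (≡.sym length-beads)))
      conj-x : conj beads x ≡ i
      conj-x = ℕ.≤-antisym
        (ℕ.≤-trans (ℕ.≤-reflexive (conj-suc beads x)) (ℕ.≤-trans (ℕ.+-monoʳ-≤ (conj beads (suc x)) (multiplicity-≤1 x))
          (ℕ.≤-trans (ℕ.≤-reflexive (ℕ.+-comm (conj beads (suc x)) 1))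
            (ℕ.≰⇒> (λ i≤ → ℕ.<-irrefl ≡.refl (≤-conj⇒≤-nth (suc x) i beads-sorted 1≤i i≤))))))
        (≤-nth⇒≤-conj x i beads-sorted (ℕ.≤-trans 1≤t t≤x) 1≤i ℕ.≤-refl)
      main : ∃[ a ] (x ≡ t + suc a × suc a < t) → nth ν i ≡ suc (conj ν i)
      main (a , x≡ , a<t) = ≡.trans nth-i (≡.cong suc (≡.sym (ℕ.≤-antisym conj-≤K K≤conj)))
        where
        y K : ℕ
        y = t ∸ suc a
        K = i + a
        y+a : y + suc a ≡ t
        y+a = ℕ.m∸n+n≡m (ℕ.<⇒≤ a<t)
        1≤K : 1 ≤ K
        1≤K = ℕ.≤-trans 1≤i (ℕ.m≤m+n i a)
        nth-i : nth ν i ≡ suc K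
        nth-i = ≡.trans (nth-ν i 1≤i i≤t) (≡.trans (≡.cong (λ z → (z + i) ∸ t) x≡)
          (≡.trans (≡.cong (_∸ t) (ℕ.+-assoc t (suc a) i)) (≡.trans (ℕ.m+n∸m≡n t (suc a + i))
            (≡.cong suc (ℕ.+-comm a i)))))
        conj-sy : conj beads (suc y) ≡ K
        conj-sy = ≡.trans (≡.cong (conj beads) (≡.sym (ℕ.+-∸-assoc 1 (ℕ.<⇒≤ a<t))))
          (≡.trans (conj-mirror a (ℕ.<⇒≤ a<t)) (≡.cong (_+ a) (≡.trans (≡.cong (conj beads)
            (≡.trans (≡.sym (ℕ.+-suc t a)) (≡.sym x≡))) conj-x)))
        mirror-empty : multiplicity y beads ≡ 0
        mirror-empty = ℕ.n<1⇒n≡0 (ℕ.≤-trans (ℕ.+-monoʳ-≤ 1 (ℕ.≤-refl)) (ℕ.≤-trans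
          (ℕ.≤-reflexive (ℕ.+-comm 1 _)) (ℕ.≤-trans (ℕ.+-monoʳ-≤ (multiplicity y beads)
            (≡.subst (λ v → 1 ≤ multiplicity v beads) x≡ x∈))
          (ℕ.≤-reflexive (mirror-sum (suc a) (s≤s z≤n) a<t)))))
        conj-y : conj beads y ≡ K
        conj-y = ≡.trans (conj-suc beads y) (≡.trans (≡.cong₂ _+_ conj-sy mirror-empty) (ℕ.+-identityʳ K))
        K≤t : K ≤ t
        K≤t = ℕ.≤-trans (ℕ.≤-reflexive (≡.sym conj-sy)) (conj-≤t (suc y))
        K≤conj : K ≤ conj ν i
        K≤conj = ≤-nth⇒≤-conj i K ν-sorted 1≤i 1≤K (ℕ.≤-trans (ℕ.m+n≤o⇒m≤o∸n i (begin
          i + t                   ≡⟨ ≡.cong (_+_ i) y+a ⟨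
          i + (y + suc a)         ≡⟨ lem i y a ⟩
          suc y + K               ≤⟨ ℕ.+-monoˡ-≤ K (≤-conj⇒≤-nth (suc y) K beads-sorted 1≤K (ℕ.≤-reflexive (≡.sym conj-sy))) ⟩
          nth beads K + K         ∎)) (ℕ.≤-reflexive (≡.sym (nth-ν K 1≤K K≤t))))
          where
          open ℕ.≤-Reasoning
          lem : ∀ i y a → i + (y + suc a) ≡ suc y + (i + a)
          lem = ℕSolver.solve-∀
        conj-≤K : conj ν i ≤ K
        conj-≤K = ℕ.≮⇒≥ λ K< → ℕ.<-irrefl ≡.refl (begin
          suc (i + t)                   ≤⟨ s≤s (≤∸⇒+≤ 1≤i (ℕ.≤-trans (≤-conj⇒≤-nth i (suc K) ν-sorted (s≤s z≤n) K<)
                                             (ℕ.≤-reflexive (nth-ν (suc K) (s≤s z≤n) (ℕ.≤-trans K< (conj-ν-≤t i)))))) ⟩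
          suc (nth beads (suc K)) + suc K   ≤⟨ ℕ.+-monoˡ-≤ (suc K) (ℕ.≰⇒> (λ y≤ → ℕ.<-irrefl ≡.refl (ℕ.≤-trans
                                             (≤-nth⇒≤-conj y (suc K) beads-sorted (ℕ.m<n⇒0<n∸m a<t) (s≤s z≤n) y≤)
                                             (ℕ.≤-reflexive conj-y)))) ⟩
          y + suc K                     ≡⟨ lem y i a ⟩
          i + (y + suc a)               ≡⟨ ≡.cong (_+_ i) y+a ⟩
          i + t                         ∎)
          where
          open ℕ.≤-Reasoning
          lem : ∀ y i a → y + suc (i + a) ≡ i + (y + suc a)
          lem = ℕSolver.solve-∀

-- Determinants as iterated contractions

module Contraction {c ℓ : Level} (R : CommutativeRing c ℓ) where
  open CommutativeRing R renaming (_+_ to _+R_; _*_ to _*R_)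
  open RingDefs R
  open RingProperties ring
  open SetoidReasoning setoid
  module +S = CommutativeSemigroupProperties +-commutativeSemigroup
  module *S = CommutativeSemigroupProperties *-commutativeSemigroup

  signN-suc : ∀ n → signN (suc n) ≈ - signN n
  signN-suc n rewrite isEven-suc n with isEven n
  ... | true = refl
  ... | false = sym (-‿involutive 1#)

  signN-+ : ∀ m n → signN (m + n) ≈ signN m *R signN n
  signN-+ zero n = sym (*-identityˡ _)
  signN-+ (suc m) n = begin
    signN (suc (m + n))        ≈⟨ signN-suc (m + n) ⟩
    - signN (m + n)            ≈⟨ -‿cong (signN-+ m n) ⟩
    - (signN m *R signN n)     ≈⟨ -‿distribˡ-* _ _ ⟩
    - signN m *R signN n       ≈⟨ *-congʳ (signN-suc m) ⟨
    signN (suc m) *R signN n   ∎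

  signN-square : ∀ n → signN n *R signN n ≈ 1#
  signN-square n with isEven n
  ... | true = *-identityˡ 1#
  ... | false = trans (-1*x≈-x (- 1#)) (-‿involutive 1#)

  signN-cancel : ∀ n x → signN n *R (signN n *R x) ≈ x
  signN-cancel n x = trans (sym (*-assoc _ _ _)) (trans (*-congʳ (signN-square n)) (*-identityˡ x))

  signN-≉0 : ¬ (1# ≈ 0#) → ∀ n → ¬ (signN n ≈ 0#)
  signN-≉0 1≉0 n eq = 1≉0 (trans (sym (signN-square n)) (trans (*-congʳ eq) (zeroˡ _)))

  -- Contraction of an alternating function G of column lists with the row r; iterating it
  -- over the rows is the Laplace expansion of the determinant.
  contract : (ℕ → Carrier) → (List ℕ → Carrier) → List ℕ → Carrier
  contract r G [] = 0#
  contract r G (c ∷ S) = r c *R G S - contract r (G ∘ (c ∷_)) S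

  contractAll : List (ℕ → Carrier) → (List ℕ → Carrier) → List ℕ → Carrier
  contractAll rs G = foldr contract G rs

  -- With as many rows as columns, the constant function is only evaluated at the empty list, where
  -- 1 is the empty determinant.
  listDet : List (ℕ → Carrier) → List ℕ → Carrier
  listDet rs = contractAll rs (λ _ → 1#)

  contract-cong : ∀ {r G G'} → (∀ S → G S ≈ G' S) → ∀ S → contract r G S ≈ contract r G' S
  contract-cong e [] = refl
  contract-cong e (c ∷ S) = +-cong (*-congˡ (e S)) (-‿cong (contract-cong (λ S → e (c ∷ S)) S))

  -- The combination is the shape of one unfolded contraction, as it occurs in `contract-anticomm`.
  contract-linear : ∀ r a G H S →
    contract r (λ S → a *R G S - H S) S ≈ a *R contract r G S - contract r H S
  contract-linear r a G H [] = begin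
    0#              ≈⟨ -‿inverseʳ 0# ⟨
    0# - 0#         ≈⟨ +-congʳ (zeroʳ a) ⟨
    a *R 0# - 0#    ∎
  contract-linear r a G H (c ∷ S) = begin
    r c *R (a *R G S - H S) - contract r (λ S → a *R G (c ∷ S) - H (c ∷ S)) S
      ≈⟨ +-cong (x[y-z]≈xy-xz _ _ _) (-‿cong (contract-linear r a _ _ S)) ⟩
    (r c *R (a *R G S) - r c *R H S) - (a *R g - k)
      ≈⟨ +-congˡ (sym (-‿+-comm _ _)) ⟩
    (r c *R (a *R G S) - r c *R H S) +R (- (a *R g) +R - - k)
      ≈⟨ +S.interchange _ _ _ _ ⟩
    (r c *R (a *R G S) - a *R g) +R (- (r c *R H S) +R - - k)
      ≈⟨ +-cong (+-congʳ (*S.x∙yz≈y∙xz _ _ _)) (-‿+-comm _ _) ⟩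
    (a *R (r c *R G S) - a *R g) - (r c *R H S - k)
      ≈⟨ +-congʳ (x[y-z]≈xy-xz _ _ _) ⟨
    a *R (r c *R G S - g) - (r c *R H S - k) ∎
    where
    g = contract r (G ∘ (c ∷_)) S
    k = contract r (H ∘ (c ∷_)) S

  contract-scale : ∀ r a G S → contract r (λ S → a *R G S) S ≈ a *R contract r G S
  contract-scale r a G [] = sym (zeroʳ a)
  contract-scale r a G (c ∷ S) = begin
    r c *R (a *R G S) - contract r (λ S → a *R G (c ∷ S)) S
      ≈⟨ +-cong (*S.x∙yz≈y∙xz _ _ _) (-‿cong (contract-scale r a _ S)) ⟩
    a *R (r c *R G S) - a *R contract r (G ∘ (c ∷_)) S
      ≈⟨ x[y-z]≈xy-xz _ _ _ ⟨
    a *R (r c *R G S - contract r (G ∘ (c ∷_)) S) ∎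

  -- Interior products by covectors anticommute. The terms in which one of the two rows takes the
  -- first column trade places, and those in which neither does are the induction hypothesis.
  contract-anticomm : ∀ r s G S → contract r (contract s G) S ≈ - contract s (contract r G) S
  contract-anticomm r s G [] = sym -0#≈0#
  contract-anticomm r s G (c ∷ S) = begin
    a - contract r (λ S → s c *R G S - contract s (G ∘ (c ∷_)) S) S
      ≈⟨ +-congˡ (-‿cong (contract-linear r (s c) _ _ S)) ⟩
    a - (b - contract r (contract s (G ∘ (c ∷_))) S)
      ≈⟨ +-congˡ (-‿cong (+-congˡ (-‿cong (contract-anticomm r s (G ∘ (c ∷_)) S)))) ⟩
    a - (b - - y)
      ≈⟨ +-congˡ (-‿cong (+-congˡ (-‿involutive y))) ⟩
    a - (b +R y)
      ≈⟨ +-congˡ (-‿+-comm b y) ⟨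
    a +R (- b - y)
      ≈⟨ +S.x∙yz≈y∙xz _ _ _ ⟩
    - b +R (a - y)
      ≈⟨ +-congˡ (-‿involutive _) ⟨
    - b +R (- - (a - y))
      ≈⟨ -‿+-comm _ _ ⟩
    - (b - (a - y))
      ≈⟨ -‿cong (+-congˡ (-‿cong (contract-linear s (r c) _ _ S))) ⟨
    - (b - contract s (λ S → r c *R G S - contract r (G ∘ (c ∷_)) S) S) ∎
    where
    a = r c *R contract s G S
    b = s c *R contract r G S
    y = contract s (contract r (G ∘ (c ∷_))) S

  0-0≈0 : ∀ {x y} → x ≈ 0# → y ≈ 0# → x - y ≈ 0#
  0-0≈0 p q = trans (+-cong p (-‿cong q)) (-‿inverseʳ 0#)

  -- Deleting a column cannot increase the number of `q`-columns. This serves a single row in front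
  -- of a group of rows that is too large for its columns.
  contract-zero : ∀ (q : ℕ → Bool) r G S →
    (∀ S' → count q S' ≤ count q S → G S' ≈ 0#) → contract r G S ≈ 0#
  contract-zero q r G [] e = refl
  contract-zero q r G (c ∷ S) e with q c in qc
  ... | true = 0-0≈0 (trans (*-congˡ (e S (ℕ.n≤1+n _))) (zeroʳ _))
      (contract-zero q r _ S (λ S' l → e (c ∷ S') (lem S' l)))
    where
    lem : ∀ S' → count q S' ≤ count q S → count q (c ∷ S') ≤ suc (count q S)
    lem S' l rewrite qc = s≤s l
  ... | false = 0-0≈0 (trans (*-congˡ (e S ℕ.≤-refl)) (zeroʳ _))
      (contract-zero q r _ S (λ S' l → e (c ∷ S') (lem S' l)))
    where
    lem : ∀ S' → count q S' ≤ count q S → count q (c ∷ S') ≤ count q S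
    lem S' l rewrite qc = l

  SupportedOn : (ℕ → Bool) → (ℕ → Carrier) → Set ℓ
  SupportedOn q r = ∀ c → q c ≡ false → r c ≈ 0#

  contract-supported : ∀ q r G S → SupportedOn q r →
    (∀ S' → count q S' < count q S → G S' ≈ 0#) → contract r G S ≈ 0#
  contract-supported q r G [] _ e = refl
  contract-supported q r G (c ∷ S) sup e with q c in qc
  ... | true = 0-0≈0 (trans (*-congˡ (e S ℕ.≤-refl)) (zeroʳ _))
      (contract-supported q r _ S sup (λ S' l → e (c ∷ S') (lem S' l)))
    where
    lem : ∀ S' → count q S' < count q S → count q (c ∷ S') < suc (count q S)
    lem S' l rewrite qc = s≤s l
  ... | false = 0-0≈0 (trans (*-congʳ (sup c qc)) (zeroˡ _))
      (contract-supported q r _ S sup (λ S' l → e (c ∷ S') (lem S' l)))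
    where
    lem : ∀ S' → count q S' < count q S → count q (c ∷ S') < count q S
    lem S' l rewrite qc = l

  -- Pigeonhole: a nonzero term of the expansion would give the rows distinct `q`-columns, and there
  -- are too few of them.
  contractAll-supported : ∀ q rs G S → All (SupportedOn q) rs → count q S < length rs →
    contractAll rs G S ≈ 0#
  contractAll-supported q (r ∷ rs) G S (p ∷ ps) (s≤s l) = contract-supported q r _ S p
    (λ S' l' → contractAll-supported q rs G S' ps (ℕ.≤-trans l' l))

  -- Only the last column survives, and it is reached by crossing `S`, with one change of sign for
  -- each column crossed.
  contract-snoc : ∀ r G S c → All (λ d → r d ≈ 0#) S →
    contract r G (S ∷ʳ c) ≈ signN (length S) *R (r c *R G S)
  contract-snoc r G [] c [] = begin
    r c *R G [] - 0#         ≈⟨ +-congˡ -0#≈0# ⟩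
    r c *R G [] +R 0#        ≈⟨ +-identityʳ _ ⟩
    r c *R G []              ≈⟨ *-identityˡ _ ⟨
    1# *R (r c *R G [])      ∎
  contract-snoc r G (d ∷ S) c (p ∷ ps) = begin
    r d *R G (S ∷ʳ c) - contract r (G ∘ (d ∷_)) (S ∷ʳ c)
      ≈⟨ +-cong (trans (*-congʳ p) (zeroˡ _)) (-‿cong (contract-snoc r _ S c ps)) ⟩
    0# - signN (length S) *R (r c *R G (d ∷ S))
      ≈⟨ +-identityˡ _ ⟩
    - (signN (length S) *R (r c *R G (d ∷ S)))
      ≈⟨ -‿distribˡ-* _ _ ⟩
    - signN (length S) *R (r c *R G (d ∷ S))
      ≈⟨ *-congʳ (signN-suc (length S)) ⟨
    signN (suc (length S)) *R (r c *R G (d ∷ S)) ∎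

  contract-ends : ∀ r G j S i → All (λ d → r d ≈ 0#) S →
    contract r G (j ∷ S ∷ʳ i) ≈ r j *R G (S ∷ʳ i) - signN (length S) *R (r i *R G (j ∷ S))
  contract-ends r G j S i ps = +-congˡ (-‿cong (contract-snoc r _ S i ps))

  -- Both rows live on the two end columns, so their 2 × 2 minor splits off. Whichever of them takes
  -- `i` has to cross `S`, which gives the two products their common sign.
  contract-pair : ∀ r s G j S i → All (λ d → r d ≈ 0#) S → All (λ d → s d ≈ 0#) S →
    contract r (contract s G) (j ∷ S ∷ʳ i)
      ≈ signN (length S) *R ((r j *R s i - r i *R s j) *R G S)
  contract-pair r s G j S i ps qs = begin
    contract r (contract s G) (j ∷ S ∷ʳ i)
      ≈⟨ contract-ends r (contract s G) j S i ps ⟩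
    r j *R contract s G (S ∷ʳ i) - e *R (r i *R (s j *R G S - contract s (G ∘ (j ∷_)) S))
      ≈⟨ +-cong (*-congˡ (contract-snoc s G S i qs))
                (-‿cong (*-congˡ (*-congˡ (+-congˡ (-‿cong (zero-row s _ S qs)))))) ⟩
    r j *R (e *R (s i *R G S)) - e *R (r i *R (s j *R G S - 0#))
      ≈⟨ +-cong (*S.x∙yz≈y∙xz _ _ _) (-‿cong (*-congˡ (*-congˡ (trans (+-congˡ -0#≈0#) (+-identityʳ _))))) ⟩
    e *R (r j *R (s i *R G S)) - e *R (r i *R (s j *R G S))
      ≈⟨ x[y-z]≈xy-xz _ _ _ ⟨
    e *R (r j *R (s i *R G S) - r i *R (s j *R G S))
      ≈⟨ *-congˡ (+-cong (*-assoc _ _ _) (-‿cong (*-assoc _ _ _))) ⟨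
    e *R ((r j *R s i) *R G S - (r i *R s j) *R G S)
      ≈⟨ *-congˡ ([y-z]x≈yx-zx _ _ _) ⟨
    e *R ((r j *R s i - r i *R s j) *R G S) ∎
    where
    e = signN (length S)
    zero-row : ∀ r G S → All (λ d → r d ≈ 0#) S → contract r G S ≈ 0#
    zero-row r G [] _ = refl
    zero-row r G (d ∷ S) (p ∷ ps) = 0-0≈0 (trans (*-congʳ p) (zeroˡ _)) (zero-row r _ S ps)

  sumR-cong : ∀ n {f g : Fin n → Carrier} → (∀ i → f i ≈ g i) →
    sumR (tabulate f) ≈ sumR (tabulate g)
  sumR-cong zero e = refl
  sumR-cong (suc n) e = +-cong (e Fin.zero) (sumR-cong n (e ∘ Fin.suc))

  sumR-neg : ∀ n (f : Fin n → Carrier) → sumR (tabulate (-_ ∘ f)) ≈ - sumR (tabulate f)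
  sumR-neg zero f = sym -0#≈0#
  sumR-neg (suc n) f = trans (+-congˡ (sumR-neg n (f ∘ Fin.suc))) (-‿+-comm _ _)

  laplaceTerm : ∀ {n} → (ℕ → Carrier) → (List ℕ → Carrier) → (Fin (suc n) → ℕ) →
    Fin (suc n) → Carrier
  laplaceTerm r G cs j = signN (Fin.toℕ j) *R (r (cs j) *R G (tabulate (cs ∘ Fin.punchIn j)))

  -- The first summand is the head of `contract`. In the others the index is shifted by one, hence
  -- the minus sign, and the first column is kept, hence `G'`.
  sum-laplaceTerm : ∀ n r G (cs : Fin (suc n) → ℕ) →
    sumR (tabulate (laplaceTerm r G cs)) ≈ contract r G (tabulate cs)
  sum-laplaceTerm zero r G cs = +-cong (*-identityˡ _) (sym -0#≈0#)
  sum-laplaceTerm (suc n) r G cs = +-cong (*-identityˡ _) (begin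
    sumR (tabulate (laplaceTerm r G cs ∘ Fin.suc))
      ≈⟨ sumR-cong (suc n) {laplaceTerm r G cs ∘ Fin.suc} { -_ ∘ laplaceTerm r G' (cs ∘ Fin.suc)}
           (λ j → trans (*-congʳ (signN-suc (Fin.toℕ j))) (sym (-‿distribˡ-* _ _))) ⟩
    sumR (tabulate (-_ ∘ laplaceTerm r G' (cs ∘ Fin.suc)))
      ≈⟨ sumR-neg (suc n) (laplaceTerm r G' (cs ∘ Fin.suc)) ⟩
    - sumR (tabulate (laplaceTerm r G' (cs ∘ Fin.suc)))
      ≈⟨ -‿cong (sum-laplaceTerm n r G' (cs ∘ Fin.suc)) ⟩
    - contract r G' (tabulate (cs ∘ Fin.suc)) ∎)
    where
    G' = G ∘ (cs Fin.zero ∷_)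

  det-listDet : ∀ {n} (M : Fin n → Fin n → Carrier) (f : Fin n → ℕ → Carrier) (cs : Fin n → ℕ) →
    (∀ a b → M a b ≈ f a (cs b)) → det M ≈ listDet (tabulate f) (tabulate cs)
  det-listDet {zero} M f cs e = refl
  det-listDet {suc n} M f cs e = begin
    det M
      ≡⟨ ≡.cong sumR (map-tabulate id term) ⟩
    sumR (tabulate term)
      ≈⟨ sumR-cong (suc n) {term} {laplaceTerm (f Fin.zero) (listDet (tabulate (f ∘ Fin.suc))) cs}
           (λ j → *-congˡ (*-cong (e Fin.zero j)
           (det-listDet _ (f ∘ Fin.suc) (cs ∘ Fin.punchIn j) (λ a b → e (Fin.suc a) (Fin.punchIn j b))))) ⟩
    sumR (tabulate (laplaceTerm (f Fin.zero) (listDet (tabulate (f ∘ Fin.suc))) cs))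
      ≈⟨ sum-laplaceTerm n (f Fin.zero) (listDet (tabulate (f ∘ Fin.suc))) cs ⟩
    contract (f Fin.zero) (listDet (tabulate (f ∘ Fin.suc))) (tabulate cs) ∎
    where
    term : Fin (suc n) → Carrier
    term j = signN (Fin.toℕ j) *R
      (M Fin.zero j *R det (λ a b → M (Fin.suc a) (Fin.punchIn j b)))

-- Complete homogeneous polynomials at the roots of unity

module CompleteHomogeneous {c ℓ : Level} (R : CommutativeRing c ℓ) where
  open CommutativeRing R renaming (_+_ to _+R_; _*_ to _*R_)
  open RingDefs R
  open RingProperties ring
  open SetoidReasoning setoid
  module +S = CommutativeSemigroupProperties +-commutativeSemigroup
  module *S = CommutativeSemigroupProperties *-commutativeSemigroup

  sumR-applyUpTo-scale : ∀ n a (f g : ℕ → Carrier) → (∀ j → f j ≈ a *R g j) →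
    sumR (applyUpTo f n) ≈ a *R sumR (applyUpTo g n)
  sumR-applyUpTo-scale zero a f g e = sym (zeroʳ a)
  sumR-applyUpTo-scale (suc n) a f g e = trans
    (+-cong (e 0) (sumR-applyUpTo-scale n a (f ∘ suc) (g ∘ suc) (e ∘ suc)))
    (sym (distribˡ a _ _))

  hN-zero : ∀ xs → hN 0 xs ≈ 1#
  hN-zero [] = refl
  hN-zero (x ∷ xs) = trans (+-identityʳ _) (trans (*-identityˡ _) (hN-zero xs))

  hN-cons : ∀ k x xs → hN (suc k) (x ∷ xs) ≈ hN (suc k) xs +R x *R hN k (x ∷ xs)
  hN-cons k x xs = +-cong (*-identityˡ _) (begin
    sumR (map f (applyUpTo suc (suc k)))
      ≡⟨ ≡.cong sumR (map-applyUpTo suc f (suc k)) ⟩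
    sumR (applyUpTo (f ∘ suc) (suc k))
      ≈⟨ sumR-applyUpTo-scale (suc k) x (f ∘ suc) g (λ j → *-assoc _ _ _) ⟩
    x *R sumR (applyUpTo g (suc k))
      ≡⟨ ≡.cong (λ l → x *R sumR l) (map-upTo g (suc k)) ⟨
    x *R hN k (x ∷ xs) ∎)
    where
    f g : ℕ → Carrier
    f j = pow x j *R hN (suc k ∸ j) xs
    g j = pow x j *R hN (k ∸ j) xs

  -- `hN` singles out the first variable, so the recursion in the last variable is an instance of
  -- symmetry; it follows by induction on the degree and on the number of variables.
  hN-snoc : ∀ k y xs → hN (suc k) (xs ∷ʳ y) ≈ hN (suc k) xs +R y *R hN k (xs ∷ʳ y)
  hN-snoc k y [] = hN-cons k y []
  hN-snoc zero y (x ∷ xs) = begin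
    hN 1 (x ∷ xs ∷ʳ y)                              ≈⟨ hN-cons 0 x (xs ∷ʳ y) ⟩
    hN 1 (xs ∷ʳ y) +R x *R hN 0 (x ∷ xs ∷ʳ y)       ≈⟨ +-cong (hN-snoc 0 y xs) (*-congˡ (trans (hN-zero (x ∷ xs ∷ʳ y)) (sym (hN-zero (x ∷ xs))))) ⟩
    hN 1 xs +R y *R hN 0 (xs ∷ʳ y) +R x *R hN 0 (x ∷ xs)
      ≈⟨ +S.xy∙z≈xz∙y _ _ _ ⟩
    hN 1 xs +R x *R hN 0 (x ∷ xs) +R y *R hN 0 (xs ∷ʳ y)
      ≈⟨ +-cong (sym (hN-cons 0 x xs)) (*-congˡ (trans (hN-zero (xs ∷ʳ y)) (sym (hN-zero (x ∷ xs ∷ʳ y))))) ⟩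
    hN 1 (x ∷ xs) +R y *R hN 0 (x ∷ xs ∷ʳ y) ∎
  hN-snoc (suc k) y (x ∷ xs) = begin
    hN (2 + k) (x ∷ xs ∷ʳ y)
      ≈⟨ hN-cons (suc k) x (xs ∷ʳ y) ⟩
    hN (2 + k) (xs ∷ʳ y) +R x *R hN (suc k) (x ∷ xs ∷ʳ y)
      ≈⟨ +-cong (hN-snoc (suc k) y xs) (trans (*-congˡ (hN-snoc k y (x ∷ xs))) (distribˡ _ _ _)) ⟩
    (hN (2 + k) xs +R y *R hN (suc k) (xs ∷ʳ y)) +R (x *R hN (suc k) (x ∷ xs) +R x *R (y *R hN k (x ∷ xs ∷ʳ y)))
      ≈⟨ +S.interchange _ _ _ _ ⟩
    (hN (2 + k) xs +R x *R hN (suc k) (x ∷ xs)) +R (y *R hN (suc k) (xs ∷ʳ y) +R x *R (y *R hN k (x ∷ xs ∷ʳ y)))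
      ≈⟨ +-cong (hN-cons (suc k) x xs) (trans (*-congˡ (hN-cons k x (xs ∷ʳ y))) (trans (distribˡ _ _ _) (+-congˡ (*S.x∙yz≈y∙xz _ _ _)))) ⟨
    hN (2 + k) (x ∷ xs) +R y *R hN (suc k) (x ∷ xs ∷ʳ y) ∎

  hN-scale : ∀ a k xs → hN k (map (a *R_) xs) ≈ pow a k *R hN k xs
  hN-scale a zero xs = trans (hN-zero (map (a *R_) xs)) (sym (trans (*-identityˡ _) (hN-zero xs)))
  hN-scale a (suc k) [] = sym (zeroʳ _)
  hN-scale a (suc k) (x ∷ xs) = begin
    hN (suc k) (map (a *R_) (x ∷ xs))
      ≈⟨ hN-cons k (a *R x) (map (a *R_) xs) ⟩
    hN (suc k) (map (a *R_) xs) +R (a *R x) *R hN k (map (a *R_) (x ∷ xs))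
      ≈⟨ +-cong (hN-scale a (suc k) xs) (*-congˡ (hN-scale a k (x ∷ xs))) ⟩
    pow a (suc k) *R hN (suc k) xs +R (a *R x) *R (pow a k *R hN k (x ∷ xs))
      ≈⟨ +-congˡ (*S.interchange _ _ _ _) ⟩
    pow a (suc k) *R hN (suc k) xs +R pow a (suc k) *R (x *R hN k (x ∷ xs))
      ≈⟨ distribˡ _ _ _ ⟨
    pow a (suc k) *R (hN (suc k) xs +R x *R hN k (x ∷ xs))
      ≈⟨ *-congˡ (hN-cons k x xs) ⟨
    pow a (suc k) *R hN (suc k) (x ∷ xs) ∎

  pow-+ : ∀ x m n → pow x (m + n) ≈ pow x m *R pow x n
  pow-+ x zero n = sym (*-identityˡ _)
  pow-+ x (suc m) n = trans (*-congˡ (pow-+ x m n)) (sym (*-assoc _ _ _))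

  module Roots (noZeroDivisors : ∀ x y → x *R y ≈ 0# → (x ≈ 0#) ⊎ (y ≈ 0#))
    (u : ℕ) (ω : Carrier) (ωᵗ≈1 : pow ω (suc u) ≈ 1#)
    (ωᵏ≉1 : ∀ k → 1 ≤ k → k < suc u → ¬ (pow ω k ≈ 1#)) where

    t : ℕ
    t = suc u

    pow-multiple : ∀ q → pow ω (q · t) ≈ 1#
    pow-multiple zero = refl
    pow-multiple (suc q) = trans (pow-+ ω t (q · t))
      (trans (*-cong ωᵗ≈1 (pow-multiple q)) (*-identityˡ 1#))

    hPow : ℕ → ℕ → Carrier
    hPow s k = hN k (rootsList ω s)

    hPow-snoc : ∀ s k → hPow (suc s) (suc k) ≈ hPow s (suc k) +R pow ω s *R hPow (suc s) k
    hPow-snoc s k = ≡.subst (λ zs → hN (suc k) zs ≈ hPow s (suc k) +R pow ω s *R hN k zs)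
      (≡.trans (≡.sym (map-++ (pow ω) (upTo s) (s ∷ []))) (≡.cong (map (pow ω)) (upTo-∷ʳ s)))
      (hN-snoc k (pow ω s) (rootsList ω s))

    -- 1, ω, ..., ω ^ s is also 1 followed by ω times the list with one root fewer; homogeneity
    -- extracts the power of ω.
    hPow-cons : ∀ s k → hPow (suc s) (suc k) ≈ pow ω (suc k) *R hPow s (suc k) +R hPow (suc s) k
    hPow-cons s k = begin
      hPow (suc s) (suc k)
        ≈⟨ hN-cons k 1# (map (pow ω) (applyUpTo suc s)) ⟩
      hN (suc k) (map (pow ω) (applyUpTo suc s)) +R 1# *R hPow (suc s) k
        ≈⟨ +-cong (reflexive (≡.cong (hN (suc k)) shift)) (*-identityˡ _) ⟩
      hN (suc k) (map (ω *R_) (rootsList ω s)) +R hPow (suc s) k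
        ≈⟨ +-congʳ (hN-scale ω (suc k) (rootsList ω s)) ⟩
      pow ω (suc k) *R hPow s (suc k) +R hPow (suc s) k ∎
      where
      shift : map (pow ω) (applyUpTo suc s) ≡ map (ω *R_) (rootsList ω s)
      shift = ≡.trans (map-applyUpTo suc (pow ω) s)
        (≡.trans (≡.sym (map-upTo (pow ω ∘ suc) s)) (map-∘ (upTo s)))

    cancel-root : ∀ a x → ¬ (a ≈ 1#) → x ≈ a *R x → x ≈ 0#
    cancel-root a x a≉1 e with noZeroDivisors (1# - a) x
      (trans ([y-z]x≈yx-zx _ _ _) (x≈y⇒x∙y⁻¹≈ε (trans (*-identityˡ x) e)))
    ... | inj₁ p = ⊥-elim (a≉1 (sym (x∙y⁻¹≈ε⇒x≈y 1# a p)))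
    ... | inj₂ p = p

    -- Take s = t in both recursions. As ω ^ t is 1, the terms with t + 1 variables cancel, and a
    -- multiple of the value by 1 - ω ^ (k + 1) remains, which is zero.
    hPow-nonmultiple : ∀ k → ¬ (suc k % t ≡ 0) → hPow t (suc k) ≈ 0#
    hPow-nonmultiple k ≢0 = cancel-root (pow ω (suc k)) _ root (+-cancelʳ (hPow (suc t) k) _ _ (begin
      hPow t (suc k) +R hPow (suc t) k
        ≈⟨ +-congˡ (trans (*-congʳ ωᵗ≈1) (*-identityˡ _)) ⟨
      hPow t (suc k) +R pow ω t *R hPow (suc t) k
        ≈⟨ trans (sym (hPow-snoc t k)) (hPow-cons t k) ⟩
      pow ω (suc k) *R hPow t (suc k) +R hPow (suc t) k ∎))
      where
      root : ¬ (pow ω (suc k) ≈ 1#)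
      root e with suc k % t in eq
      ... | zero = ≢0 ≡.refl
      ... | suc r = ωᵏ≉1 (suc r) (s≤s z≤n) (≡.subst (_< t) eq (m%n<n (suc k) t))
        (trans (sym (trans (pow-+ ω (suc r) (suc k / t · t)) (trans (*-congˡ (pow-multiple (suc k / t))) (*-identityʳ _))))
          (trans (reflexive (≡.cong (pow ω) (≡.trans (≡.cong (_+ suc k / t · t) (≡.sym eq)) (≡.sym (m≡m%n+[m/n]*n (suc k) t))))) e))

    -- When ω ^ suc k ≈ 1#, comparing the two recursions gives (1 - ω ^ s) h_k(1,…,ω ^ s) ≈ 0#.
    hPow-pred : ∀ k s → pow ω (suc k) ≈ 1# → 1 ≤ s → s < t → hPow (suc s) k ≈ 0#
    hPow-pred k s ωᵏ≈1 1≤s s<t = cancel-root (pow ω s) _ (ωᵏ≉1 s 1≤s s<t)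
      (+-cancelˡ (hPow s (suc k)) _ _ (begin
        hPow s (suc k) +R hPow (suc s) k
          ≈⟨ +-congʳ (trans (*-congʳ ωᵏ≈1) (*-identityˡ _)) ⟨
        pow ω (suc k) *R hPow s (suc k) +R hPow (suc s) k
          ≈⟨ trans (sym (hPow-cons s k)) (hPow-snoc s k) ⟩
        hPow s (suc k) +R pow ω s *R hPow (suc s) k ∎))

    hPow-one : ∀ k → hPow 1 k ≈ 1#
    hPow-one zero = hN-zero (1# ∷ [])
    hPow-one (suc k) = trans (hN-cons k 1# []) (trans (+-identityˡ _) (trans (*-identityˡ _) (hPow-one k)))

    -- The value is 1 for the single variable 1, and by `hPow-pred` adjoining a further root does
    -- not change it.
    hPow-multiple : ∀ k s → pow ω (suc k) ≈ 1# → s < t → hPow (suc s) (suc k) ≈ 1#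
    hPow-multiple k zero e l = hPow-one (suc k)
    hPow-multiple k (suc s) e l = begin
      hPow (2 + s) (suc k)
        ≈⟨ hPow-snoc (suc s) k ⟩
      hPow (suc s) (suc k) +R pow ω (suc s) *R hPow (2 + s) k
        ≈⟨ +-cong (hPow-multiple k s e (ℕ.<⇒≤ l)) (trans (*-congˡ (hPow-pred k (suc s) e (s≤s z≤n) l)) (zeroʳ _)) ⟩
      1# +R 0#
        ≈⟨ +-identityʳ 1# ⟩
      1# ∎

    hN-roots : ∀ k → hN k (rootsList ω t) ≈ (if k % t ≡ᵇ 0 then 1# else 0#)
    hN-roots zero = hN-zero (rootsList ω t)
    hN-roots (suc k) with suc k % t in eq
    ... | suc r = hPow-nonmultiple k (λ e → contradiction (≡.trans (≡.sym eq) e) λ ())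
    ... | zero = hPow-multiple k u (trans
        (reflexive (≡.cong (pow ω) (≡.trans (m≡m%n+[m/n]*n (suc k) t) (≡.cong (_+ suc k / t · t) eq))))
        (pow-multiple (suc k / t))) ℕ.≤-refl

-- The matrix entries

-- In the column c = t - j, this decides whether h_{λ_i-i-j} = 1, that is b ≥ 2t - c and t ∣ b + c.
reflected : ℕ → ℕ → ℕ → Bool
reflected u b c = ((c + b % suc u ≡ᵇ suc u) ∧ (1 ≤ᵇ b / suc u)) ∨ ((c + b % suc u ≡ᵇ 0) ∧ (2 ≤ᵇ b / suc u))

-- The interval from `k` to k + m - 1, largest first: this is the order of the matrix columns under
-- c = t - j, and it puts the two members of an outermost pair at the ends.
columns : ℕ → ℕ → List ℕ
columns k zero = []
columns k (suc m) = (k + m) ∷ columns k m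

tabulate-columns : ∀ t → tabulate {n = t} (λ j → t ∸ suc (Fin.toℕ j)) ≡ columns 0 t
tabulate-columns zero = ≡.refl
tabulate-columns (suc t) = ≡.cong (t ∷_) (tabulate-columns t)

betaGo-tabulate : ∀ {n} m j (v : Vec ℕ n) → betaGo m (suc j) (toList v) ≡
  tabulate {n = n} (λ a → nth (toList v) (suc (Fin.toℕ a)) + m ∸ suc (j + Fin.toℕ a))
betaGo-tabulate m j Vec.[] = ≡.refl
betaGo-tabulate m j (x Vec.∷ v) = ≡.cong₂ _∷_
  (≡.cong (λ i → x + m ∸ suc i) (≡.sym (ℕ.+-identityʳ j)))
  (≡.trans (betaGo-tabulate m (suc j) v) (tabulate-cong λ a →
    ≡.cong (λ i → nth (toList v) (suc (Fin.toℕ a)) + m ∸ suc i) (≡.sym (ℕ.+-suc j (Fin.toℕ a)))))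

beta-tabulate : ∀ {n} (v : Vec ℕ n) → beta (toList v) ≡
  tabulate {n = n} (λ a → nth (toList v) (suc (Fin.toℕ a)) + n ∸ suc (Fin.toℕ a))
beta-tabulate {n} v rewrite length-toList v = betaGo-tabulate n 0 v

-- In use c + j = t and x + t = b + i, so that this index of h, like the one in `minus-difference`,
-- depends on the row only through its beta number `b`.
plus-difference : ∀ x i j b c → x + (c + j) ≡ b + i → (+ x) ℤ.- (+ i) ℤ.+ (+ j) ≡ b ⊖ c
plus-difference x i j b c e = begin
  X ℤ.- I ℤ.+ J                          ≡⟨ lhs X I J C ⟩
  (X ℤ.+ (C ℤ.+ J)) ℤ.- I ℤ.- C          ≡⟨ ≡.cong (λ z → z ℤ.- I ℤ.- C) (≡.cong +_ e) ⟩
  (B ℤ.+ I) ℤ.- I ℤ.- C                  ≡⟨ rhs B I C ⟩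
  B ℤ.- C                                ≡⟨ ℤ.m-n≡m⊖n b c ⟩
  b ⊖ c                                  ∎
  where
  open ≡.≡-Reasoning
  X = + x ; I = + i ; J = + j ; B = + b ; C = + c
  lhs : ∀ X I J C → X ℤ.- I ℤ.+ J ≡ (X ℤ.+ (C ℤ.+ J)) ℤ.- I ℤ.- C
  lhs = ℤSolver.solve-∀
  rhs : ∀ B I C → (B ℤ.+ I) ℤ.- I ℤ.- C ≡ B ℤ.- C
  rhs = ℤSolver.solve-∀

minus-difference : ∀ x i j b t → x + t ≡ b + i → (+ x) ℤ.- (+ i) ℤ.- (+ j) ≡ b ⊖ (t + j)
minus-difference x i j b t e = begin
  X ℤ.- I ℤ.- J                          ≡⟨ lhs X I J T' ⟩
  (X ℤ.+ T') ℤ.- I ℤ.- (T' ℤ.+ J)        ≡⟨ ≡.cong (λ z → z ℤ.- I ℤ.- (T' ℤ.+ J)) (≡.cong +_ e) ⟩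
  (B ℤ.+ I) ℤ.- I ℤ.- (T' ℤ.+ J)         ≡⟨ rhs B I (T' ℤ.+ J) ⟩
  B ℤ.- (T' ℤ.+ J)                       ≡⟨ ℤ.m-n≡m⊖n b (t + j) ⟩
  b ⊖ (t + j)                            ∎
  where
  open ≡.≡-Reasoning
  X = + x ; I = + i ; J = + j ; B = + b ; T' = + t
  lhs : ∀ X I J T' → X ℤ.- I ℤ.- J ≡ (X ℤ.+ T') ℤ.- I ℤ.- (T' ℤ.+ J)
  lhs = ℤSolver.solve-∀
  rhs : ∀ B I C → (B ℤ.+ I) ℤ.- I ℤ.- C ≡ B ℤ.- C
  rhs = ℤSolver.solve-∀

-- The two alternatives in `reflected` are j < t, where `j` is the residue of `b`, and j = t, where
-- c = 0 and b = (2 + k) t.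
reflected-complete : ∀ u b c j k → c + j ≡ suc u → b ≡ (suc u + j) + k · suc u → reflected u b c ≡ true
reflected-complete u b c j k c+j≡t b≡ with j ℕ.<? suc u
... | yes j<t = ≡.cong₂ (λ p q → (p ∧ q) ∨ ((c + b % suc u ≡ᵇ 0) ∧ (2 ≤ᵇ b / suc u))) (≡ᵇ-true c+ρ≡t) (≤ᵇ-true 1≤q)
  where
  b≡' : b ≡ j + suc k · suc u
  b≡' = ≡.trans b≡ (lem (suc u) j k)
    where
    lem : ∀ t j k → (t + j) + k · t ≡ j + (t + k · t)
    lem = ℕSolver.solve-∀
  c+ρ≡t : c + b % suc u ≡ suc u
  c+ρ≡t = ≡.trans (≡.cong (_+_ c) (≡.trans (≡.cong (_% suc u) b≡')
    (≡.trans ([m+kn]%n≡m%n j (suc k) (suc u)) (m<n⇒m%n≡m j<t)))) c+j≡t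
  1≤q : 1 ≤ b / suc u
  1≤q = m≥n⇒m/n>0 (ℕ.≤-trans (ℕ.≤-trans (ℕ.m≤m+n (suc u) j) (ℕ.m≤m+n (suc u + j) (k · suc u))) (ℕ.≤-reflexive (≡.sym b≡)))
... | no j≮t = lem₀ c≡0
  where
  c≡0 : c ≡ 0
  c≡0 = ℕ.n≤0⇒n≡0 (ℕ.+-cancelʳ-≤ (suc u) c 0 (ℕ.≤-trans (ℕ.+-monoʳ-≤ c (ℕ.≮⇒≥ j≮t)) (ℕ.≤-reflexive c+j≡t)))
  j≡t : j ≡ suc u
  j≡t = ≡.subst (λ c → c + j ≡ suc u) c≡0 c+j≡t
  b≡' : b ≡ (2 + k) · suc u
  b≡' = ≡.trans b≡ (≡.trans (≡.cong (λ j → (suc u + j) + k · suc u) j≡t) (ℕ.+-assoc (suc u) (suc u) (k · suc u)))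
  ρ≡0 : b % suc u ≡ 0
  ρ≡0 = ≡.trans (≡.cong (_% suc u) b≡') (m*n%n≡0 (2 + k) (suc u))
  2≤q : 2 ≤ b / suc u
  2≤q = ℕ.≤-trans (s≤s (s≤s z≤n)) (ℕ.≤-reflexive (≡.sym (≡.trans (≡.cong (_/ suc u) b≡') (m*n/n≡m (2 + k) (suc u)))))
  lem₀ : c ≡ 0 → reflected u b c ≡ true
  lem₀ ≡.refl rewrite ρ≡0 = ≤ᵇ-true 2≤q

reflected-sound : ∀ u b c → reflected u b c ≡ true →
  (c + b % suc u ≡ suc u × 1 ≤ b / suc u) ⊎ (c + b % suc u ≡ 0 × 2 ≤ b / suc u)
reflected-sound u b c e with c + b % suc u ≡ᵇ suc u in e₁ | 1 ≤ᵇ b / suc u in e₂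
... | true | true = inj₁ (≡ᵇ-true⁻¹ e₁ , ≤ᵇ-true⁻¹ e₂)
... | false | _ with c + b % suc u ≡ᵇ 0 in e₃ | 2 ≤ᵇ b / suc u in e₄
...   | true | true = inj₂ (≡ᵇ-true⁻¹ e₃ , ≤ᵇ-true⁻¹ e₄)
reflected-sound u b c e | true | false with c + b % suc u ≡ᵇ 0 in e₃ | 2 ≤ᵇ b / suc u in e₄
...   | true | true = inj₂ (≡ᵇ-true⁻¹ e₃ , ≤ᵇ-true⁻¹ e₄)

module Entries {c ℓ : Level} (R : CommutativeRing c ℓ) where
  open CommutativeRing R renaming (_+_ to _+R_; _*_ to _*R_)
  open RingDefs R
  open CompleteHomogeneous R
  open Contraction R

  indicator : Bool → Carrier
  indicator p = if p then 1# else 0#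

  row : ℕ → ℕ → ℕ → Carrier
  row u b c = indicator (c ≡ᵇ b % suc u) - indicator (reflected u b c)

  module WithRoots (noZeroDivisors : ∀ x y → x *R y ≈ 0# → (x ≈ 0#) ⊎ (y ≈ 0#))
    (u : ℕ) (ω : Carrier) (ωᵗ≈1 : pow ω (suc u) ≈ 1#)
    (ωᵏ≉1 : ∀ k → 1 ≤ k → k < suc u → ¬ (pow ω k ≈ 1#)) where
    open Roots noZeroDivisors u ω ωᵗ≈1 ωᵏ≉1

    Z : List Carrier
    Z = rootsList ω t

    h-hit : ∀ b d k → b ≡ d + k · t → h (b ⊖ d) Z ≈ 1#
    h-hit b d k ≡.refl rewrite ℤ.⊖-≥ (ℕ.m≤m+n d (k · t)) | ℕ.m+n∸m≡n d (k · t) =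
      trans (hN-roots (k · t)) (reflexive (≡.cong (λ r → indicator (r ≡ᵇ 0)) (m*n%n≡0 k t)))

    h-miss : ∀ b d → (∀ k → ¬ (b ≡ d + k · t)) → h (b ⊖ d) Z ≈ 0#
    h-miss b d miss with d ℕ.≤? b
    ... | yes d≤b rewrite ℤ.⊖-≥ d≤b = trans (hN-roots (b ∸ d)) (reflexive
          (≡.cong indicator (≡ᵇ-false (λ ρ≡0 → miss ((b ∸ d) / t) (≡.trans (≡.sym (ℕ.m+[n∸m]≡n d≤b))
            (≡.cong (_+_ d) (≡.trans (m≡m%n+[m/n]*n (b ∸ d) t) (≡.cong (_+ (b ∸ d) / t · t) ρ≡0))))))))
    ... | no d≰b rewrite ℤ.⊖-< (ℕ.≰⇒> d≰b) with d ∸ b | ℕ.m<n⇒0<n∸m (ℕ.≰⇒> d≰b)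
    ...   | suc e | _ = refl

    h-diagonal : ∀ b c → c < t → h (b ⊖ c) Z ≈ indicator (c ≡ᵇ b % t)
    h-diagonal b c c<t with c ≡ᵇ b % t in eq
    ... | true = h-hit b c (b / t) (≡.trans (m≡m%n+[m/n]*n b t) (≡.cong (_+ b / t · t) (≡.sym (≡ᵇ-true⁻¹ eq))))
    ... | false = h-miss b c (λ k b≡ → ≡ᵇ-false⁻¹ eq (≡.sym (≡.trans (≡.cong (_% t) b≡)
          (≡.trans ([m+kn]%n≡m%n c k t) (m<n⇒m%n≡m c<t)))))

    h-reflected : ∀ b c j → c + j ≡ t → h (b ⊖ (t + j)) Z ≈ indicator (reflected u b c)
    h-reflected b c j c+j≡t with reflected u b c in eq
    ... | false = h-miss b (t + j) (λ k b≡ → contradiction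
          (≡.trans (≡.sym (reflected-complete u b c j k c+j≡t b≡)) eq) λ ())
    ... | true with reflected-sound u b c eq
    ...   | inj₁ (c+ρ≡t , 1≤q) with b / t | m≡m%n+[m/n]*n b t
    ...     | suc q | b≡ = h-hit b (t + j) q (≡.trans b≡ (≡.trans
              (≡.cong (_+ suc q · t) (ℕ.+-cancelˡ-≡ c _ _ (≡.trans c+ρ≡t (≡.sym c+j≡t)))) (lem t j q)))
      where
      lem : ∀ t j k → j + (t + k · t) ≡ (t + j) + k · t
      lem = ℕSolver.solve-∀
    h-reflected b c j c+j≡t | true | inj₂ (c+ρ≡0 , 2≤q) with b / t | m≡m%n+[m/n]*n b t
    ...     | suc zero | _ = contradiction 2≤q λ { (s≤s ()) }
    ...     | suc (suc q) | b≡ = h-hit b (t + j) q (≡.trans b≡ (≡.trans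
              (≡.cong (_+ suc (suc q) · t) (ℕ.m+n≡0⇒n≡0 c c+ρ≡0)) (≡.trans (≡.sym (ℕ.+-assoc t t (q · t)))
              (≡.cong (λ j → (t + j) + q · t) (≡.trans (≡.sym c+j≡t) (≡.cong (_+ j) (ℕ.m+n≡0⇒m≡0 c c+ρ≡0)))))))

    orthChar-listDet : ∀ (lam : Vec ℕ t) →
      orthChar (toList lam) t Z ≈ listDet (map (row u) (beta (toList lam))) (columns 0 t)
    orthChar-listDet lam = trans
      (det-listDet {t} _ (row u ∘ b) (λ j → t ∸ suc (Fin.toℕ j)) entry)
      (reflexive (≡.cong₂ listDet
        (≡.trans (≡.sym (map-tabulate b (row u))) (≡.cong (map (row u)) (≡.sym (beta-tabulate lam))))
        (tabulate-columns t)))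
      where
      b : Fin t → ℕ
      b i = nth (toList lam) (suc (Fin.toℕ i)) + t ∸ suc (Fin.toℕ i)
      b+i : ∀ i → nth (toList lam) (suc (Fin.toℕ i)) + t ≡ b i + suc (Fin.toℕ i)
      b+i i = ≡.sym (ℕ.m∸n+n≡m (ℕ.≤-trans (toℕ<n i) (ℕ.m≤n+m t _)))
      entry : ∀ i j →
        h ((+ nth (toList lam) (suc (Fin.toℕ i))) ℤ.- (+ suc (Fin.toℕ i)) ℤ.+ (+ suc (Fin.toℕ j))) Z
        - h ((+ nth (toList lam) (suc (Fin.toℕ i))) ℤ.- (+ suc (Fin.toℕ i)) ℤ.- (+ suc (Fin.toℕ j))) Z
        ≈ row u (b i) (t ∸ suc (Fin.toℕ j))
      entry i j = +-cong
        (trans (reflexive (≡.cong (λ z → h z Z) (plus-difference (nth (toList lam) (suc (Fin.toℕ i))) (suc (Fin.toℕ i)) (suc (Fin.toℕ j)) (b i) (t ∸ suc (Fin.toℕ j))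
            (≡.trans (≡.cong (_+_ (nth (toList lam) (suc (Fin.toℕ i)))) c+j) (b+i i)))))
          (h-diagonal (b i) _ (s≤s (ℕ.m∸n≤m u (Fin.toℕ j)))))
        (-‿cong (trans (reflexive (≡.cong (λ z → h z Z) (minus-difference (nth (toList lam) (suc (Fin.toℕ i))) (suc (Fin.toℕ i)) (suc (Fin.toℕ j)) (b i) t (b+i i))))
          (h-reflected (b i) _ (suc (Fin.toℕ j)) c+j)))
        where
        c+j : t ∸ suc (Fin.toℕ j) + suc (Fin.toℕ j) ≡ t
        c+j = ℕ.m∸n+n≡m (toℕ<n j)

-- Evaluation of the determinant

columns-∷ʳ : ∀ k m → columns k (suc m) ≡ columns (suc k) m ∷ʳ k
columns-∷ʳ k zero = ≡.cong (_∷ []) (ℕ.+-identityʳ k)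
columns-∷ʳ k (suc m) = ≡.cong₂ _∷_ (ℕ.+-suc k m) (columns-∷ʳ k m)

length-columns : ∀ k m → length (columns k m) ≡ m
length-columns k zero = ≡.refl
length-columns k (suc m) = ≡.cong suc (length-columns k m)

columns-range : ∀ k m → All (λ c → k ≤ c × c < k + m) (columns k m)
columns-range k zero = []
columns-range k (suc m) = (ℕ.m≤m+n k m , ℕ.≤-reflexive (≡.sym (ℕ.+-suc k m)))
  ∷ All.map (λ (l , r) → l , ℕ.≤-trans r (ℕ.+-monoʳ-≤ k (ℕ.n≤1+n m))) (columns-range k m)

-- For the residue `x` of a row, the number of inversions created by putting that row in front of
-- `w`.
smaller : ℕ → ℕ → List ℕ → ℕ
smaller u x w = count (_<ᵇ x) (map (_% suc u) w)

class : ℕ → ℕ → List ℕ → List ℕ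
class u i = bfilter (λ b → b % suc u ≡ᵇ i)

-- The contents of the residue classes i and t - i, each listed decreasingly, for which the minor is nonzero.
data GoodPair (u : ℕ) : List ℕ → List ℕ → Set where
  left  : ∀ {b b'} → b' / suc u ≡ 0 → GoodPair u (b ∷ b' ∷ []) []
  split : ∀ {b b'} → b / suc u ≡ 0 ⊎ b' / suc u ≡ 0 → GoodPair u (b ∷ []) (b' ∷ [])
  right : ∀ {b b'} → b' / suc u ≡ 0 → GoodPair u [] (b ∷ b' ∷ [])

data GoodMiddle (u : ℕ) : List ℕ → Set where
  middle : ∀ {b} → b / suc u ≡ 0 → GoodMiddle u (b ∷ [])

-- The bound is 1 rather than 0 because in column 0 the reflected entry appears only from quotient 2
-- on; this is where the case λ^(0) = (1) comes from.
data GoodZero (u : ℕ) : List ℕ → Set where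
  zeroClass : ∀ {b} → b / suc u ≤ 1 → GoodZero u (b ∷ [])

-- What is still to be decided once the pairs with a member below `k` have been split off.
GoodFrom : ℕ → (ℕ → List ℕ) → ℕ → Set
GoodFrom u cls k = (∀ i j → k ≤ i → i < j → i + j ≡ suc u → GoodPair u (cls i) (cls j))
  × (∀ i → k ≤ i → i + i ≡ suc u → GoodMiddle u (cls i))

-- The part of the binomial sum in ε that belongs to the interval of `m` residues starting at `k`.
-- It is built in the order in which `evaluate` removes the pairs, whose upper members carry the
-- binomials.
triangular : (ℕ → ℕ) → ℕ → ℕ → ℕ
triangular n k zero = 0
triangular n k (suc zero) = 0
triangular n k (suc (suc m)) = suc (n (k + suc m)) C 2 + triangular n (suc k) m

-- Counts the second beads on the runners of the interval; from k = 1 on, and for good classes, this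
-- is the rank of the core.
excess : (ℕ → ℕ) → ℕ → ℕ → ℕ
excess n k zero = 0
excess n k (suc zero) = 0
excess n k (suc (suc m)) = ((n k ∸ 1) + (n (k + suc m) ∸ 1)) + excess n (suc k) m

GoodPair-length : ∀ {u l l'} → GoodPair u l l' → length l + length l' ≡ 2
GoodPair-length (left _) = ≡.refl
GoodPair-length (split _) = ≡.refl
GoodPair-length (right _) = ≡.refl

module SignedDeterminant {c ℓ : Level} (R : CommutativeRing c ℓ) (u : ℕ) where
  open CommutativeRing R renaming (_+_ to _+R_; _*_ to _*R_)
  open RingDefs R
  open RingProperties ring
  open SetoidReasoning setoid
  open Contraction R hiding (module +S; module *S)
  module *S = CommutativeSemigroupProperties *-commutativeSemigroup
  open Entries R

  t : ℕ
  t = suc u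

  rowDet : List ℕ → List ℕ → Carrier
  rowDet w = listDet (map (row u) w)

  -- The sign makes this invariant under exchanging neighbouring rows with distinct residues.
  signedDet : List ℕ → List ℕ → Carrier
  signedDet w S = signN (inversions (map (_% t) w)) *R rowDet w S

  signedDet-∷ : ∀ x w S →
    signedDet (x ∷ w) S ≈ signN (smaller u (x % t) w) *R contract (row u x) (signedDet w) S
  signedDet-∷ x w S = begin
    signN (smaller u (x % t) w + inversions (map (_% t) w)) *R contract (row u x) (rowDet w) S
      ≈⟨ *-congʳ (signN-+ (smaller u (x % t) w) _) ⟩
    (signN (smaller u (x % t) w) *R signN (inversions (map (_% t) w))) *R contract (row u x) (rowDet w) S
      ≈⟨ *-assoc _ _ _ ⟩
    signN (smaller u (x % t) w) *R (signN (inversions (map (_% t) w)) *R contract (row u x) (rowDet w) S)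
      ≈⟨ *-congˡ (contract-scale (row u x) _ (rowDet w) S) ⟨
    signN (smaller u (x % t) w) *R contract (row u x) (signedDet w) S ∎

  -- `smaller-≡` is what makes the relation compatible with a further row in front: the sign in
  -- `signedDet-∷` depends on the residues of the tail.
  record _∼_ (w w' : List ℕ) : Set ℓ where
    constructor _,_
    field
      smaller-≡ : ∀ x → smaller u x w ≡ smaller u x w'
      signedDet-≈ : ∀ S → signedDet w S ≈ signedDet w' S
  open _∼_

  ∼-refl : ∀ {w} → w ∼ w
  ∼-refl = (λ _ → ≡.refl) , (λ _ → refl)

  ∼-trans : ∀ {w w' w''} → w ∼ w' → w' ∼ w'' → w ∼ w''
  ∼-trans (s , d) (s' , d') = (λ x → ≡.trans (s x) (s' x)) , (λ S → trans (d S) (d' S))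

  ∼-sym : ∀ {w w'} → w ∼ w' → w' ∼ w
  ∼-sym (s , d) = (λ x → ≡.sym (s x)) , (λ S → sym (d S))

  ∼-prep : ∀ x {w w'} → w ∼ w' → (x ∷ w) ∼ (x ∷ w')
  ∼-prep x {w} {w'} (s , d) = smaller-∷ , λ S → begin
    signedDet (x ∷ w) S
      ≈⟨ signedDet-∷ x w S ⟩
    signN (smaller u (x % t) w) *R contract (row u x) (signedDet w) S
      ≈⟨ *-cong (reflexive (≡.cong signN (s (x % t)))) (contract-cong d S) ⟩
    signN (smaller u (x % t) w') *R contract (row u x) (signedDet w') S
      ≈⟨ signedDet-∷ x w' S ⟨
    signedDet (x ∷ w') S ∎
    where
    smaller-∷ : ∀ y → smaller u y (x ∷ w) ≡ smaller u y (x ∷ w')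
    smaller-∷ y with x % t <ᵇ y
    ... | true = ≡.cong suc (s y)
    ... | false = s y

  signedDet-∷∷ : ∀ x y w S → signedDet (x ∷ y ∷ w) S ≈
    (signN (smaller u (x % t) (y ∷ w)) *R signN (smaller u (y % t) w)) *R
      contract (row u x) (contract (row u y) (signedDet w)) S
  signedDet-∷∷ x y w S = begin
    signedDet (x ∷ y ∷ w) S
      ≈⟨ signedDet-∷ x (y ∷ w) S ⟩
    signN (smaller u (x % t) (y ∷ w)) *R contract (row u x) (signedDet (y ∷ w)) S
      ≈⟨ *-congˡ (trans (contract-cong (signedDet-∷ y w) S) (contract-scale _ _ _ S)) ⟩
    signN (smaller u (x % t) (y ∷ w)) *R (signN (smaller u (y % t) w) *R
      contract (row u x) (contract (row u y) (signedDet w)) S)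
      ≈⟨ *-assoc _ _ _ ⟨
    _ ∎

  smaller-∷< : ∀ {x y} w → y % t < x → smaller u x (y ∷ w) ≡ suc (smaller u x w)
  smaller-∷< w l rewrite <ᵇ-true l = ≡.refl

  smaller-∷≥ : ∀ {x y} w → ¬ (y % t < x) → smaller u x (y ∷ w) ≡ smaller u x w
  smaller-∷≥ w nl rewrite <ᵇ-false nl = ≡.refl

  -- The exchange negates the determinant and removes exactly one inversion, so the two signs
  -- cancel.
  ∼-swap> : ∀ x y w → y % t < x % t → (x ∷ y ∷ w) ∼ (y ∷ x ∷ w)
  ∼-swap> x y w y<x = smaller-swap , λ S → begin
    signedDet (x ∷ y ∷ w) S
      ≈⟨ signedDet-∷∷ x y w S ⟩
    (signN (smaller u (x % t) (y ∷ w)) *R signN (smaller u (y % t) w)) *R xy S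
      ≈⟨ *-congʳ (*-congʳ (trans (reflexive (≡.cong signN (smaller-∷< {x % t} {y} w y<x))) (signN-suc (smaller u (x % t) w)))) ⟩
    (- signN (smaller u (x % t) w) *R signN (smaller u (y % t) w)) *R xy S
      ≈⟨ *-cong (sym (-‿distribˡ-* _ _)) (contract-anticomm _ _ _ S) ⟩
    (- (signN (smaller u (x % t) w) *R signN (smaller u (y % t) w))) *R - yx S
      ≈⟨ trans (sym (-‿distribˡ-* _ _)) (trans (-‿cong (sym (-‿distribʳ-* _ _))) (-‿involutive _)) ⟩
    (signN (smaller u (x % t) w) *R signN (smaller u (y % t) w)) *R yx S
      ≈⟨ *-congʳ (*-comm _ _) ⟩
    (signN (smaller u (y % t) w) *R signN (smaller u (x % t) w)) *R yx S
      ≈⟨ *-congʳ (*-congʳ (reflexive (≡.cong signN (smaller-∷≥ {y % t} {x} w (ℕ.<-asym y<x))))) ⟨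
    (signN (smaller u (y % t) (x ∷ w)) *R signN (smaller u (x % t) w)) *R yx S
      ≈⟨ signedDet-∷∷ y x w S ⟨
    signedDet (y ∷ x ∷ w) S ∎
    where
    xy yx : List ℕ → Carrier
    xy = contract (row u x) (contract (row u y) (signedDet w))
    yx = contract (row u y) (contract (row u x) (signedDet w))
    smaller-swap : ∀ z → smaller u z (x ∷ y ∷ w) ≡ smaller u z (y ∷ x ∷ w)
    smaller-swap z with x % t <ᵇ z | y % t <ᵇ z
    ... | true | true = ≡.refl
    ... | true | false = ≡.refl
    ... | false | true = ≡.refl
    ... | false | false = ≡.refl

  ∼-swap : ∀ x y w → x % t ≢ y % t → (x ∷ y ∷ w) ∼ (y ∷ x ∷ w)
  ∼-swap x y w x≢y with ℕ.<-cmp (x % t) (y % t)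
  ... | tri< x<y _ _ = ∼-sym (∼-swap> y x w x<y)
  ... | tri≈ _ x≡y _ = contradiction x≡y x≢y
  ... | tri> _ _ y<x = ∼-swap> x y w y<x

  ∼-insert : ∀ x p w → All (λ y → x % t ≢ y % t) p → (x ∷ p ++ w) ∼ (p ++ x ∷ w)
  ∼-insert x [] w [] = ∼-refl
  ∼-insert x (y ∷ p) w (x≢y ∷ ps) =
    ∼-trans (∼-swap x y (p ++ w) x≢y) (∼-prep y (∼-insert x p w ps))

  -- A stable partition by a property of the residue only moves rows past rows with a different
  -- residue.
  ∼-partition : ∀ (q : ℕ → Bool) w →
    w ∼ (bfilter (q ∘ (_% t)) w ++ bfilter (not ∘ q ∘ (_% t)) w)
  ∼-partition q [] = ∼-refl
  ∼-partition q (x ∷ w) with q (x % t) in qx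
  ... | true = ∼-prep x (∼-partition q w)
  ... | false = ∼-trans (∼-prep x (∼-partition q w)) (∼-insert x _ _
        (All.map (λ {y} qy x≡y → contradiction (≡.trans (≡.sym qy) (≡.trans (≡.cong q (≡.sym x≡y)) qx)) λ ())
          (bfilter-sound (q ∘ (_% t)) w)))

  signedDet-partition : ∀ (q : ℕ → Bool) w S →
    let p = bfilter (q ∘ (_% t)) w
        r = bfilter (not ∘ q ∘ (_% t)) w
    in signedDet w S ≈ signN (inversions (map (_% t) (p ++ r))) *R
         contractAll (map (row u) p) (rowDet r) S
  signedDet-partition q w S = trans (signedDet-≈ (∼-partition q w) S) (*-congˡ (reflexive
    (≡.cong (λ G → G S) (≡.trans (≡.cong listDet (map-++ (row u) p r))
      (foldr-++ contract _ (map (row u) p) (map (row u) r))))))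
    where
    p = bfilter (q ∘ (_% t)) w
    r = bfilter (not ∘ q ∘ (_% t)) w

  row-zero : ∀ b c → c ≢ b % t → c + b % t ≢ t → c + b % t ≢ 0 → row u b c ≈ 0#
  row-zero b c n₁ n₂ n₃ rewrite ≡ᵇ-false n₁ | ≡ᵇ-false n₂ | ≡ᵇ-false n₃ = -‿inverseʳ 0#

  row-own : ∀ b c → c ≡ b % t → c + c ≢ t → 1 ≤ c → row u b c ≈ 1#
  row-own b c ≡.refl n₁ 1≤c rewrite ≡ᵇ-true {b % t} ≡.refl | ≡ᵇ-false n₁
    | ≡ᵇ-false {b % t + b % t} (ℕ.>⇒≢ (ℕ.≤-trans 1≤c (ℕ.m≤m+n _ _))) =
    trans (+-congˡ -0#≈0#) (+-identityʳ 1#)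

  row-opposite : ∀ b c → c ≢ b % t → c + b % t ≡ t → row u b c ≈ - indicator (1 ≤ᵇ b / t)
  row-opposite b c n₁ e rewrite ≡ᵇ-false n₁ | e | ≡ᵇ-true {t} ≡.refl with 1 ≤ᵇ b / t
  ... | true = +-identityˡ _
  ... | false = +-identityˡ _

  module Levels (cls : ℕ → List ℕ) (cls-decreasing : ∀ i → AllPairs _>_ (cls i)) where

    n : ℕ → ℕ
    n = length ∘ cls

    -- The invariant of the recursion: as many rows as columns are left, and the classes in the
    -- interval are still complete.
    record Layer (k m : ℕ) (w : List ℕ) : Set where
      field
        range : All (λ b → k ≤ b % t × b % t < k + m) w
        size : length w ≡ m
        classes : ∀ i → k ≤ i → i < k + m → class u i w ≡ cls i

    -- The decision is made on the classes and not on the ring element. This lets a nonzero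
    -- character imply the condition without excluded middle.
    Decided : Set → Carrier → Carrier → Set ℓ
    Decided Good x y = (Good × x ≈ y) ⊎ (¬ Good × x ≈ 0#)

    -- Splitting off the residues k and t - k

    module PairStep (k m : ℕ) (1≤k : 1 ≤ k) (t≡ : k + (k + suc m) ≡ t)
      (w : List ℕ) (level : Layer k (suc (suc m)) w) where
      open Layer level

      j : ℕ
      j = k + suc m

      k<j : k < j
      k<j = ℕ.m<m+n k (s≤s z≤n)

      inPair : ℕ → Bool
      inPair r = (r ≡ᵇ k) ∨ (r ≡ᵇ j)

      pair rest : List ℕ
      pair = bfilter (inPair ∘ (_% t)) w
      rest = bfilter (not ∘ inPair ∘ (_% t)) w

      inPair⁻¹ : ∀ {r} → inPair r ≡ true → r ≡ k ⊎ r ≡ j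
      inPair⁻¹ {r} e with ∨-true⁻¹ {r ≡ᵇ k} e
      ... | inj₁ p = inj₁ (≡ᵇ-true⁻¹ p)
      ... | inj₂ p = inj₂ (≡ᵇ-true⁻¹ p)

      inPair-k : inPair k ≡ true
      inPair-k rewrite ≡ᵇ-true {k} ≡.refl = ≡.refl

      inPair-j : inPair j ≡ true
      inPair-j rewrite ≡ᵇ-true {j} ≡.refl with j ≡ᵇ k
      ... | true = ≡.refl
      ... | false = ≡.refl

      outside : ∀ {r} → r ≢ k → r ≢ j → inPair r ≡ false
      outside n₁ n₂ rewrite ≡ᵇ-false n₁ | ≡ᵇ-false n₂ = ≡.refl

      outside⁻¹ : ∀ {r} → inPair r ≡ false → r ≢ k × r ≢ j
      outside⁻¹ {r} e = ≡ᵇ-false⁻¹ (∨-false⁻¹ˡ {r ≡ᵇ k} e) , ≡ᵇ-false⁻¹ (∨-false⁻¹ʳ {r ≡ᵇ k} e)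

      -- The pair is closed under r ↦ t - r, so the own and the reflected column of a row are both
      -- in the pair or both outside. The matrix thus has a block for the pair and a block for the
      -- rest.
      inPair-reflect : ∀ {r s} → r + s ≡ t → inPair r ≡ true → inPair s ≡ true
      inPair-reflect {r} {s} e q with inPair⁻¹ {r} q
      ... | inj₁ ≡.refl rewrite ℕ.+-cancelˡ-≡ k s j (≡.trans e (≡.sym t≡)) = inPair-j
      ... | inj₂ ≡.refl rewrite ℕ.+-cancelˡ-≡ j s k (≡.trans e (≡.trans (≡.sym t≡) (ℕ.+-comm k j))) = inPair-k

      inPair-zero : inPair 0 ≡ false
      inPair-zero = outside (ℕ.<⇒≢ 1≤k) (ℕ.<⇒≢ (ℕ.≤-trans 1≤k (ℕ.<⇒≤ k<j)))

      middleColumns : List ℕ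
      middleColumns = columns (suc k) m

      middle-outside : All (λ c → inPair c ≡ false) middleColumns
      middle-outside = All.map (λ (l , r) → outside (ℕ.>⇒≢ l)
        (ℕ.<⇒≢ (ℕ.≤-trans r (ℕ.≤-reflexive (≡.sym (ℕ.+-suc k m)))))) (columns-range (suc k) m)

      columns≡ : columns k (suc (suc m)) ≡ j ∷ middleColumns ∷ʳ k
      columns≡ = ≡.cong (j ∷_) (columns-∷ʳ k m)

      pair-supported : ∀ {b} → inPair (b % t) ≡ true → SupportedOn inPair (row u b)
      pair-supported {b} qb c qc = row-zero b c
        (λ e → contradiction (≡.trans (≡.sym qb) (≡.trans (≡.cong inPair (≡.sym e)) qc)) λ ())
        (λ e → contradiction (≡.trans (≡.sym (inPair-reflect {b % t} {c} (≡.trans (ℕ.+-comm (b % t) c) e) qb)) qc) λ ())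
        (λ e → contradiction (≡.trans (≡.sym qb) (≡.trans (≡.cong inPair (ℕ.m+n≡0⇒n≡0 c e)) inPair-zero)) λ ())

      rest-supported : ∀ {b} → inPair (b % t) ≡ false → SupportedOn (not ∘ inPair) (row u b)
      rest-supported {b} qb c nqc = row-zero b c
        (λ e → contradiction (≡.trans (≡.sym qc) (≡.trans (≡.cong inPair e) qb)) λ ())
        (λ e → contradiction (≡.trans (≡.sym (inPair-reflect {c} {b % t} e qc)) qb) λ ())
        (λ e → contradiction (≡.trans (≡.sym qc) (≡.trans (≡.cong inPair (ℕ.m+n≡0⇒m≡0 c e)) inPair-zero)) λ ())
        where
        qc = not-false⁻¹ {inPair c} nqc

      pair-sound : All (λ b → inPair (b % t) ≡ true) pair
      pair-sound = bfilter-sound (inPair ∘ (_% t)) w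

      rest-sound : All (λ b → inPair (b % t) ≡ false) rest
      rest-sound = All.map not-true⁻¹ (bfilter-sound (not ∘ inPair ∘ (_% t)) w)

      length-pair-rest : length pair + length rest ≡ suc (suc m)
      length-pair-rest = ≡.trans (length-bfilter-not (inPair ∘ (_% t)) w) size

      class-k : class u k pair ≡ cls k
      class-k = ≡.trans (bfilter-absorb (λ b e → ≡.trans (≡.cong inPair (≡ᵇ-true⁻¹ {b % t} e)) inPair-k) w)
        (classes k ℕ.≤-refl (ℕ.m<m+n k (s≤s z≤n)))

      class-j : class u j pair ≡ cls j
      class-j = ≡.trans (bfilter-absorb (λ b e → ≡.trans (≡.cong inPair (≡ᵇ-true⁻¹ {b % t} e)) inPair-j) w)
        (classes j (ℕ.<⇒≤ k<j) (ℕ.≤-reflexive (≡.sym (ℕ.+-suc k (suc m)))))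

      class-lengths : ∀ {p} → All (λ b → inPair (b % t) ≡ true) p →
        length (class u k p) + length (class u j p) ≡ length p
      class-lengths [] = ≡.refl
      class-lengths {b ∷ p} (q ∷ qs) with inPair⁻¹ {b % t} q
      ... | inj₁ e rewrite ≡ᵇ-true e | ≡ᵇ-false {b % t} {j} (λ e' → ℕ.<⇒≢ k<j (≡.trans (≡.sym e) e')) =
        ≡.cong suc (class-lengths qs)
      ... | inj₂ e rewrite ≡ᵇ-true e | ≡ᵇ-false {b % t} {k} (λ e' → ℕ.<⇒≢ k<j (≡.trans (≡.sym e') e)) =
        ≡.trans (ℕ.+-suc _ _) (≡.cong suc (class-lengths qs))

      GoodPair⇒length : GoodPair u (cls k) (cls j) → length pair ≡ 2
      GoodPair⇒length good = ≡.trans (≡.sym (class-lengths pair-sound))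
        (≡.trans (≡.cong₂ (λ l l' → length l + length l') class-k class-j) (GoodPair-length good))

      count-∷ʳ-middle : ∀ (q : ℕ → Bool) S →
        count q (j ∷ S ∷ʳ k) ≡ count q (j ∷ []) + (count q S + count q (k ∷ []))
      count-∷ʳ-middle q S rewrite bfilter-++ q S (k ∷ []) with q j
      ... | true = ≡.cong suc (length-++ (bfilter q S))
      ... | false = length-++ (bfilter q S)

      allColumns : List ℕ
      allColumns = j ∷ middleColumns ∷ʳ k

      count-pair : count inPair allColumns ≡ 2
      count-pair = ≡.trans (count-∷ʳ-middle inPair middleColumns) (≡.cong₂ _+_
        (≡.trans (count-single inPair j) (≡.cong (if_then 1 else 0) inPair-j))
        (≡.cong₂ _+_ (≡.cong length (bfilter-none middle-outside))
          (≡.trans (count-single inPair k) (≡.cong (if_then 1 else 0) inPair-k))))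

      count-rest : count (not ∘ inPair) allColumns ≤ m
      count-rest = ℕ.≤-trans (ℕ.≤-reflexive (≡.trans (count-∷ʳ-middle (not ∘ inPair) middleColumns) (≡.cong₂ _+_
        (≡.trans (count-single (not ∘ inPair) j) (≡.cong (λ p → if not p then 1 else 0) inPair-j))
        (≡.trans (≡.cong (_+_ (count (not ∘ inPair) middleColumns)) (≡.trans (count-single (not ∘ inPair) k)
          (≡.cong (λ p → if not p then 1 else 0) inPair-k))) (ℕ.+-identityʳ _)))))
        (ℕ.≤-trans (length-bfilter (not ∘ inPair) middleColumns) (ℕ.≤-reflexive (length-columns (suc k) m)))

      partitioned : ∀ S → signedDet w S ≈ signN (inversions (map (_% t) (pair ++ rest))) *R
        contractAll (map (row u) pair) (rowDet rest) S
      partitioned = signedDet-partition inPair w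

      vanish : ∀ S → contractAll (map (row u) pair) (rowDet rest) S ≈ 0# → signedDet w S ≈ 0#
      vanish S e = trans (partitioned S) (trans (*-congˡ e) (zeroʳ _))

      rowDet-rest-vanish : ∀ S → count (not ∘ inPair) S < length rest → rowDet rest S ≈ 0#
      rowDet-rest-vanish S l = contractAll-supported (not ∘ inPair) (map (row u) rest) _ S
        (All.map⁺ (All.map (λ {b} → rest-supported {b}) rest-sound))
        (ℕ.≤-trans l (ℕ.≤-reflexive (≡.sym (length-map (row u) rest))))

      -- For the class sizes (2,0), (1,1), (0,2) of `k` and `j` this is `t`, 1 and 3 + t. Over all
      -- good pairs the binomials give the sum in ε, and the multiples of `t` add up to `t` times
      -- the rank.
      exponent : ℕ
      exponent = suc (n j) C 2 + t · ((n k ∸ 1) + (n j ∸ 1))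

      Result : Set ℓ
      Result = Decided (GoodPair u (cls k) (cls j))
        (signedDet w allColumns)
        (signN exponent *R signedDet rest middleColumns)

      rest-range : All (λ b → suc k ≤ b % t × b % t < suc k + m) rest
      rest-range = go (bfilter-All (not ∘ inPair ∘ (_% t)) range) rest-sound
        where
        go : ∀ {l} → All (λ b → k ≤ b % t × b % t < k + suc (suc m)) l →
          All (λ b → inPair (b % t) ≡ false) l → All (λ b → suc k ≤ b % t × b % t < suc k + m) l
        go [] [] = []
        go {b ∷ _} ((l , r) ∷ ps) (q ∷ qs) = (ℕ.≤∧≢⇒< l (λ e → proj₁ (outside⁻¹ {b % t} q) (≡.sym e)) ,
          ℕ.≤-trans (ℕ.≤∧≢⇒< (s≤s⁻¹ (ℕ.≤-trans r (ℕ.≤-reflexive (ℕ.+-suc k (suc m))))) (proj₂ (outside⁻¹ {b % t} q)))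
            (ℕ.≤-reflexive (ℕ.+-suc k m))) ∷ go ps qs

      rest-classes : ∀ i → suc k ≤ i → i < suc k + m → class u i rest ≡ cls i
      rest-classes i l r = ≡.trans
        (bfilter-absorb (λ b e → ≡.cong not (≡.trans (≡.cong inPair (≡ᵇ-true⁻¹ {b % t} e))
          (outside (ℕ.>⇒≢ l) (ℕ.<⇒≢ (ℕ.≤-trans r (ℕ.≤-reflexive (≡.sym (ℕ.+-suc k m)))))))) w)
        (classes i (ℕ.<⇒≤ l) (ℕ.≤-trans r (ℕ.≤-trans (ℕ.≤-reflexive (≡.sym (ℕ.+-suc k m)))
          (ℕ.+-monoʳ-≤ k (ℕ.n≤1+n (suc m))))))

      length-rest : length pair ≡ 2 → length rest ≡ m
      length-rest e = ℕ.suc-injective (ℕ.suc-injective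
        (≡.trans (≡.cong (_+ length rest) (≡.sym e)) length-pair-rest))

      j≢k : j ≢ k
      j≢k = ℕ.>⇒≢ k<j

      none-below-k : count (_<ᵇ k) (map (_% t) rest) ≡ 0
      none-below-k = ≡.cong length (bfilter-none (All.map⁺ (All.map
        (λ (l , _) → <ᵇ-false (ℕ.<-asym l)) rest-range)))

      all-below-j : length pair ≡ 2 → count (_<ᵇ j) (map (_% t) rest) ≡ m
      all-below-j e = ≡.trans (≡.cong length (bfilter-all (All.map⁺ (All.map
        (λ (_ , r) → <ᵇ-true (ℕ.≤-trans r (ℕ.≤-reflexive (≡.sym (ℕ.+-suc k m))))) rest-range))))
        (≡.trans (length-map (_% t) rest) (length-rest e))

      -- The residues of the pair stand in front. `k` is below and `j` above every residue of
      -- `rest`, so against `rest` each `j` contributes `m` inversions and each `k` none.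
      inv : List ℕ → ℕ
      inv l = inversions (l ++ map (_% t) rest)

      inv-kk : inv (k ∷ k ∷ []) ≡ 0 + inv []
      inv-kk rewrite <ᵇ-false (ℕ.<-irrefl {k} ≡.refl) | none-below-k = ≡.refl

      inv-kj : length pair ≡ 2 → inv (k ∷ j ∷ []) ≡ m + inv []
      inv-kj e rewrite <ᵇ-false (ℕ.<-asym k<j) | none-below-k | all-below-j e = ≡.refl

      inv-jk : length pair ≡ 2 → inv (j ∷ k ∷ []) ≡ suc m + inv []
      inv-jk e rewrite <ᵇ-true k<j | none-below-k | all-below-j e = ≡.refl

      inv-jj : length pair ≡ 2 → inv (j ∷ j ∷ []) ≡ m + m + inv []
      inv-jj e rewrite <ᵇ-false (ℕ.<-irrefl {j} ≡.refl) | all-below-j e = ≡.sym (ℕ.+-assoc m m _)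

      class-hit : ∀ i b p → b % t ≡ i → class u i (b ∷ p) ≡ b ∷ class u i p
      class-hit i b p e rewrite ≡ᵇ-true e = ≡.refl

      class-miss : ∀ i b p → b % t ≢ i → class u i (b ∷ p) ≡ class u i p
      class-miss i b p ne rewrite ≡ᵇ-false ne = ≡.refl

      high : ℕ → Carrier
      high b = indicator (1 ≤ᵇ b / t)

      row-kk : ∀ b → b % t ≡ k → row u b k ≈ 1#
      row-kk b e = row-own b k (≡.sym e) (λ e' → ℕ.<⇒≢ (ℕ.+-monoʳ-< k k<j) (≡.trans e' (≡.sym t≡))) 1≤k

      row-kj : ∀ b → b % t ≡ k → row u b j ≈ - high b
      row-kj b e = row-opposite b j (λ e' → j≢k (≡.trans e' e))
        (≡.trans (≡.cong (_+_ j) e) (≡.trans (ℕ.+-comm j k) t≡))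

      row-jj : ∀ b → b % t ≡ j → row u b j ≈ 1#
      row-jj b e = row-own b j (≡.sym e) (λ e' → ℕ.>⇒≢ (ℕ.+-monoˡ-< j k<j) (≡.trans e' (≡.sym t≡)))
        (ℕ.≤-trans 1≤k (ℕ.<⇒≤ k<j))

      row-jk : ∀ b → b % t ≡ j → row u b k ≈ - high b
      row-jk b e = row-opposite b k (λ e' → j≢k (≡.sym (≡.trans e' e)))
        (≡.trans (≡.cong (_+_ k) e) t≡)

      minor : ℕ → ℕ → Carrier
      minor b₁ b₂ = row u b₁ j *R row u b₂ k - row u b₁ k *R row u b₂ j

      module Two (b₁ b₂ : ℕ) (pair≡ : pair ≡ b₁ ∷ b₂ ∷ []) where

        two : length pair ≡ 2
        two = ≡.cong length pair≡

        sound : All (λ b → inPair (b % t) ≡ true) (b₁ ∷ b₂ ∷ [])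
        sound = ≡.subst (All _) pair≡ pair-sound

        vanishing : ∀ b → inPair (b % t) ≡ true → All (λ c → row u b c ≈ 0#) middleColumns
        vanishing b q = All.map (λ {c} → pair-supported {b} q c) middle-outside

        expand : contractAll (map (row u) pair) (rowDet rest) allColumns
          ≈ signN m *R (minor b₁ b₂ *R rowDet rest middleColumns)
        expand with sound
        ... | q₁ ∷ q₂ ∷ [] = trans (reflexive (≡.cong (λ p → contractAll (map (row u) p) (rowDet rest) allColumns) pair≡))
          (trans (contract-pair (row u b₁) (row u b₂) (rowDet rest) j middleColumns k
            (vanishing b₁ q₁) (vanishing b₂ q₂))
            (*-congʳ (reflexive (≡.cong signN (length-columns (suc k) m)))))

        degenerate : minor b₁ b₂ ≈ 0# → signedDet w allColumns ≈ 0#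
        degenerate e = vanish _ (trans expand (trans (*-congˡ (trans (*-congʳ e) (zeroˡ _))) (zeroʳ _)))

        -- Three signs are collected: `v` inversions caused by the pair, `m` inner columns crossed
        -- in the expansion, and the sign `d` of the minor.
        nondegenerate : ∀ r₁ r₂ → b₁ % t ≡ r₁ → b₂ % t ≡ r₂ → ∀ v d →
          inv (r₁ ∷ r₂ ∷ []) ≡ v + inv [] → minor b₁ b₂ ≈ signN d → isEven (v + (m + d)) ≡ isEven exponent →
          signedDet w allColumns ≈ signN exponent *R signedDet rest middleColumns
        nondegenerate r₁ r₂ e₁ e₂ v d inv≡ minor≈ parity = begin
          signedDet w allColumns
            ≈⟨ partitioned allColumns ⟩
          signN (inversions (map (_% t) (pair ++ rest))) *R
            contractAll (map (row u) pair) (rowDet rest) allColumns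
            ≈⟨ *-cong (reflexive (≡.cong signN inv-all)) (trans expand (*-congˡ (*-congʳ minor≈))) ⟩
          signN (v + inv []) *R (signN m *R (signN d *R G))
            ≈⟨ *-cong (signN-+ v _) (trans (sym (*-assoc _ _ _)) (*-congʳ (sym (signN-+ m d)))) ⟩
          (signN v *R signN (inv [])) *R (signN (m + d) *R G)
            ≈⟨ *S.interchange _ _ _ _ ⟩
          (signN v *R signN (m + d)) *R (signN (inv []) *R G)
            ≈⟨ *-congʳ (trans (sym (signN-+ v (m + d)))
                 (reflexive (≡.cong (λ p → if p then 1# else - 1#) parity))) ⟩
          signN exponent *R (signN (inv []) *R G) ∎
          where
          G = rowDet rest middleColumns
          inv-all : inversions (map (_% t) (pair ++ rest)) ≡ v + inv []
          inv-all = ≡.trans (≡.cong (λ p → inversions (map (_% t) (p ++ rest))) pair≡)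
            (≡.trans (≡.cong₂ (λ x y → inv (x ∷ y ∷ [])) e₁ e₂) inv≡)

        cls-k : class u k (b₁ ∷ b₂ ∷ []) ≡ cls k
        cls-k = ≡.trans (≡.cong (class u k) (≡.sym pair≡)) class-k

        cls-j : class u j (b₁ ∷ b₂ ∷ []) ≡ cls j
        cls-j = ≡.trans (≡.cong (class u j) (≡.sym pair≡)) class-j

        -- Of two different numbers with the same residue the larger has a positive quotient; so in
        -- a class of size two only the quotient of the smaller number is in question.
        higher : ∀ i → b₁ % t ≡ i → b₂ % t ≡ i → cls i ≡ b₁ ∷ b₂ ∷ [] → (1 ≤ᵇ b₁ / t) ≡ true
        higher i e₁ e₂ e with b₁ / t in q | ≡.subst (AllPairs _>_) e (cls-decreasing i)
        ... | suc _ | _ = ≡.refl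
        ... | zero | (b₁>b₂ ∷ []) ∷ _ = contradiction b₁>b₂ (ℕ.≤⇒≯ (ℕ.≤-trans (ℕ.≤-reflexive
          (≡.trans (m≡m%n+[m/n]*n b₁ t) (≡.trans (≡.cong (λ q → b₁ % t + q · t) q)
          (≡.trans (ℕ.+-identityʳ _) (≡.trans e₁ (≡.sym e₂)))))) (m%n≤m b₂ t)))

        exponent-≡ : ∀ {a b} → a ≡ cls k → b ≡ cls j →
          suc (length b) C 2 + t · ((length a ∸ 1) + (length b ∸ 1)) ≡ exponent
        exponent-≡ ≡.refl ≡.refl = ≡.refl

        good : ∀ {a b} → a ≡ cls k → b ≡ cls j → GoodPair u a b → GoodPair u (cls k) (cls j)
        good ≡.refl ≡.refl g = g

        bad : ∀ {a b} → a ≡ cls k → b ≡ cls j → ¬ GoodPair u a b → ¬ GoodPair u (cls k) (cls j)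
        bad ≡.refl ≡.refl g = g

        low : ∀ b → (1 ≤ᵇ b / t) ≡ false → b / t ≡ 0
        low b e = ℕ.n<1⇒n≡0 (ℕ.≰⇒> (≤ᵇ-false⁻¹ e))

        not-low : ∀ b → (1 ≤ᵇ b / t) ≡ true → b / t ≢ 0
        not-low b e q = contradiction (≡.trans (≡.sym e) (≡.cong (1 ≤ᵇ_) q)) λ ()

        high≈ : ∀ b {p} → (1 ≤ᵇ b / t) ≡ p → high b ≈ indicator p
        high≈ b e = reflexive (≡.cong indicator e)

        -- With one row in each class the minor is 1 minus this product, up to sign: it vanishes if
        -- both quotients are positive and is 1 or -1 otherwise.
        high-product : ∀ b b' → ((b / t ≡ 0 ⊎ b' / t ≡ 0) × high b *R high b' ≈ 0#)
          ⊎ (¬ (b / t ≡ 0 ⊎ b' / t ≡ 0) × high b *R high b' ≈ 1#)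
        high-product b b' with b / t | b' / t
        ... | zero | _ = inj₁ (inj₁ ≡.refl , zeroˡ _)
        ... | suc _ | zero = inj₁ (inj₂ ≡.refl , zeroʳ _)
        ... | suc _ | suc _ = inj₂ ((λ { (inj₁ ()) ; (inj₂ ()) }) , *-identityˡ _)

        neg-product : ∀ x y → - x *R - y ≈ x *R y
        neg-product x y = trans (sym (-‿distribˡ-* x (- y)))
          (trans (-‿cong (sym (-‿distribʳ-* x y))) (-‿involutive _))

        module BothLeft (e₁ : b₁ % t ≡ k) (e₂ : b₂ % t ≡ k) where

          ck : b₁ ∷ b₂ ∷ [] ≡ cls k
          ck = ≡.trans (≡.sym (≡.trans (class-hit k b₁ (b₂ ∷ []) e₁) (≡.cong (b₁ ∷_) (class-hit k b₂ [] e₂)))) cls-k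

          cj : [] ≡ cls j
          cj = ≡.trans (≡.sym (≡.trans (class-miss j b₁ (b₂ ∷ []) (λ e → j≢k (≡.trans (≡.sym e) e₁)))
            (class-miss j b₂ [] (λ e → j≢k (≡.trans (≡.sym e) e₂))))) cls-j

          minor≈ : minor b₁ b₂ ≈ - 1# - - high b₂
          minor≈ = +-cong
            (trans (*-cong (row-kj b₁ e₁) (row-kk b₂ e₂)) (trans (*-identityʳ _)
              (-‿cong (high≈ b₁ (higher k e₁ e₂ (≡.sym ck))))))
            (-‿cong (trans (*-cong (row-kk b₁ e₁) (row-kj b₂ e₂)) (*-identityˡ _)))

          -- The exponent is `t` here, and t = 2k + m + 1.
          parity : isEven (0 + (m + 1)) ≡ isEven exponent
          parity = ≡.trans (≡.sym (isEven-double k (m + 1))) (≡.cong isEven (≡.trans (lem k m)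
            (≡.trans t≡ (≡.trans (≡.sym (ℕ.*-identityʳ t)) (exponent-≡ ck cj)))))
            where
            lem : ∀ k m → k + k + (m + 1) ≡ k + (k + suc m)
            lem = ℕSolver.solve-∀

          decide : Result
          decide with 1 ≤ᵇ b₂ / t in h₂
          ... | false = inj₁ (good ck cj (left (low b₂ h₂)) ,
            nondegenerate k k e₁ e₂ 0 1 inv-kk (trans minor≈ (trans (+-congˡ (-‿cong (-‿cong (high≈ b₂ h₂))))
              (trans (+-congˡ (-‿involutive 0#)) (+-identityʳ _)))) parity)
          ... | true = inj₂ (bad ck cj (λ { (left q) → not-low b₂ h₂ q }) ,
            degenerate (trans minor≈ (trans (+-congˡ (-‿cong (-‿cong (high≈ b₂ h₂)))) (-‿inverseʳ _))))

        module BothRight (e₁ : b₁ % t ≡ j) (e₂ : b₂ % t ≡ j) where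

          ck : [] ≡ cls k
          ck = ≡.trans (≡.sym (≡.trans (class-miss k b₁ (b₂ ∷ []) (λ e → j≢k (≡.trans (≡.sym e₁) e)))
            (class-miss k b₂ [] (λ e → j≢k (≡.trans (≡.sym e₂) e))))) cls-k

          cj : b₁ ∷ b₂ ∷ [] ≡ cls j
          cj = ≡.trans (≡.sym (≡.trans (class-hit j b₁ (b₂ ∷ []) e₁) (≡.cong (b₁ ∷_) (class-hit j b₂ [] e₂)))) cls-j

          minor≈ : minor b₁ b₂ ≈ - high b₂ - - 1#
          minor≈ = +-cong
            (trans (*-cong (row-jj b₁ e₁) (row-jk b₂ e₂)) (*-identityˡ _))
            (-‿cong (trans (*-cong (row-jk b₁ e₁) (row-jj b₂ e₂)) (trans (*-identityʳ _)
              (-‿cong (high≈ b₁ (higher j e₁ e₂ (≡.sym cj)))))))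

          -- The exponent is 3 + t here, and t = 2k + m + 1, so both sides have the parity of `m`.
          parity : isEven (m + m + (m + 0)) ≡ isEven exponent
          parity = ≡.trans (≡.trans (isEven-double m (m + 0))
            (≡.sym (isEven-double (2 + k) (m + 0)))) (≡.cong isEven (≡.trans (lem k m)
            (≡.trans (≡.cong (_+_ 3) (≡.trans t≡ (≡.sym (ℕ.*-identityʳ t)))) (exponent-≡ ck cj))))
            where
            lem : ∀ k m → 2 + k + (2 + k) + (m + 0) ≡ 3 + (k + (k + suc m))
            lem = ℕSolver.solve-∀

          decide : Result
          decide with 1 ≤ᵇ b₂ / t in h₂
          ... | false = inj₁ (good ck cj (right (low b₂ h₂)) ,
            nondegenerate j j e₁ e₂ (m + m) 0 (inv-jj two) (trans minor≈ (trans (+-congʳ (-‿cong (high≈ b₂ h₂)))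
              (trans (+-cong -0#≈0# (-‿involutive 1#)) (+-identityˡ _)))) parity)
          ... | true = inj₂ (bad ck cj (λ { (right q) → not-low b₂ h₂ q }) ,
            degenerate (trans minor≈ (trans (+-congʳ (-‿cong (high≈ b₂ h₂))) (-‿inverseʳ _))))

        module LeftRight (e₁ : b₁ % t ≡ k) (e₂ : b₂ % t ≡ j) where

          ck : b₁ ∷ [] ≡ cls k
          ck = ≡.trans (≡.sym (≡.trans (class-hit k b₁ (b₂ ∷ []) e₁)
            (≡.cong (b₁ ∷_) (class-miss k b₂ [] (λ e → j≢k (≡.trans (≡.sym e₂) e)))))) cls-k

          cj : b₂ ∷ [] ≡ cls j
          cj = ≡.trans (≡.sym (≡.trans (class-miss j b₁ (b₂ ∷ []) (λ e → j≢k (≡.trans (≡.sym e) e₁)))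
            (class-hit j b₂ [] e₂))) cls-j

          minor≈ : minor b₁ b₂ ≈ high b₁ *R high b₂ - 1#
          minor≈ = +-cong (trans (*-cong (row-kj b₁ e₁) (row-jk b₂ e₂)) (neg-product _ _))
            (-‿cong (trans (*-cong (row-kk b₁ e₁) (row-jj b₂ e₂)) (*-identityˡ _)))

          parity : isEven (m + (m + 1)) ≡ isEven exponent
          parity = ≡.trans (≡.cong isEven (≡.sym (ℕ.+-assoc m m 1))) (≡.trans (isEven-double m 1)
            (≡.cong isEven (≡.trans (≡.cong suc (≡.sym (ℕ.*-zeroʳ t))) (exponent-≡ ck cj))))

          decide : Result
          decide with high-product b₁ b₂
          ... | inj₁ (p , eq) = inj₁ (good ck cj (split p) ,
            nondegenerate k j e₁ e₂ m 1 (inv-kj two) (trans minor≈ (trans (+-congʳ eq) (+-identityˡ _))) parity)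
          ... | inj₂ (p , eq) = inj₂ (bad ck cj (λ { (split q) → p q }) ,
            degenerate (trans minor≈ (trans (+-congʳ eq) (-‿inverseʳ 1#))))

        module RightLeft (e₁ : b₁ % t ≡ j) (e₂ : b₂ % t ≡ k) where

          ck : b₂ ∷ [] ≡ cls k
          ck = ≡.trans (≡.sym (≡.trans (class-miss k b₁ (b₂ ∷ []) (λ e → j≢k (≡.trans (≡.sym e₁) e)))
            (class-hit k b₂ [] e₂))) cls-k

          cj : b₁ ∷ [] ≡ cls j
          cj = ≡.trans (≡.sym (≡.trans (class-hit j b₁ (b₂ ∷ []) e₁)
            (≡.cong (b₁ ∷_) (class-miss j b₂ [] (λ e → j≢k (≡.trans (≡.sym e) e₂)))))) cls-j

          minor≈ : minor b₁ b₂ ≈ 1# - high b₁ *R high b₂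
          minor≈ = +-cong (trans (*-cong (row-jj b₁ e₁) (row-kk b₂ e₂)) (*-identityˡ _))
            (-‿cong (trans (*-cong (row-jk b₁ e₁) (row-kj b₂ e₂)) (neg-product _ _)))

          parity : isEven (suc m + (m + 0)) ≡ isEven exponent
          parity = ≡.trans (≡.cong isEven (lem m)) (≡.trans (isEven-double m 1)
            (≡.cong isEven (≡.trans (≡.cong suc (≡.sym (ℕ.*-zeroʳ t))) (exponent-≡ ck cj))))
            where
            lem : ∀ m → suc m + (m + 0) ≡ m + m + 1
            lem = ℕSolver.solve-∀

          decide : Result
          decide with high-product b₂ b₁
          ... | inj₁ (p , eq) = inj₁ (good ck cj (split p) ,
            nondegenerate j k e₁ e₂ (suc m) 0 (inv-jk two) (trans minor≈
              (trans (+-congˡ (-‿cong (trans (*-comm _ _) eq))) (trans (+-congˡ -0#≈0#) (+-identityʳ _)))) parity)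
          ... | inj₂ (p , eq) = inj₂ (bad ck cj (λ { (split q) → p q }) ,
            degenerate (trans minor≈ (trans (+-congˡ (-‿cong (trans (*-comm _ _) eq))) (-‿inverseʳ 1#))))

        decideTwo : Result
        decideTwo with sound
        ... | q₁ ∷ q₂ ∷ [] with inPair⁻¹ {b₁ % t} q₁ | inPair⁻¹ {b₂ % t} q₂
        ...   | inj₁ e₁ | inj₁ e₂ = BothLeft.decide e₁ e₂
        ...   | inj₁ e₁ | inj₂ e₂ = LeftRight.decide e₁ e₂
        ...   | inj₂ e₁ | inj₁ e₂ = RightLeft.decide e₁ e₂
        ...   | inj₂ e₁ | inj₂ e₂ = BothRight.decide e₁ e₂

      wrong-length : length pair ≢ 2 → ¬ GoodPair u (cls k) (cls j)
      wrong-length ne g = ne (GoodPair⇒length g)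

      -- With fewer than two pair rows, the remaining rows outnumber the inner columns; with more
      -- than two, the pair rows outnumber their own two columns.
      decide : Result
      decide = cases pair ≡.refl
        where
        rest-long : ∀ p → pair ≡ p → length p ≤ 1 → m < length rest
        rest-long p e l = ℕ.+-cancelˡ-≤ 1 _ _ (ℕ.≤-trans (ℕ.≤-reflexive (≡.sym length-pair-rest))
          (ℕ.+-monoˡ-≤ (length rest) (ℕ.≤-trans (ℕ.≤-reflexive (≡.cong length e)) l)))
        cases : ∀ p → pair ≡ p → Result
        cases [] e = inj₂ (wrong-length (λ e' → contradiction (≡.trans (≡.sym (≡.cong length e)) e') λ ()) ,
          vanish allColumns (trans (reflexive (≡.cong (λ p → contractAll (map (row u) p) (rowDet rest) allColumns) e))
            (rowDet-rest-vanish allColumns (ℕ.≤-trans (s≤s count-rest) (rest-long [] e z≤n)))))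
        cases (b ∷ []) e = inj₂ (wrong-length (λ e' → contradiction (≡.trans (≡.sym (≡.cong length e)) e') λ ()) ,
          vanish allColumns (trans (reflexive (≡.cong (λ p → contractAll (map (row u) p) (rowDet rest) allColumns) e))
            (contract-zero (not ∘ inPair) (row u b) (rowDet rest) allColumns
              (λ S' l → rowDet-rest-vanish S' (ℕ.≤-trans (s≤s (ℕ.≤-trans l count-rest)) (rest-long (b ∷ []) e ℕ.≤-refl))))))
        cases (b₁ ∷ b₂ ∷ []) e = Two.decideTwo b₁ b₂ e
        cases (b₁ ∷ b₂ ∷ b₃ ∷ p) e = inj₂ (wrong-length (λ e' → contradiction (≡.trans (≡.sym (≡.cong length e)) e') λ ()) ,
          vanish allColumns (contractAll-supported inPair (map (row u) pair) (rowDet rest) allColumns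
            (All.map⁺ (All.map (λ {b} → pair-supported {b}) pair-sound))
            (ℕ.≤-trans (s≤s (ℕ.≤-reflexive count-pair)) (ℕ.≤-trans (s≤s (s≤s (s≤s z≤n)))
              (ℕ.≤-reflexive (≡.sym (≡.trans (length-map (row u) pair) (≡.cong length e))))))))

      rest-level : length pair ≡ 2 → Layer (suc k) m rest
      rest-level e = record { range = rest-range ; size = length-rest e ; classes = rest-classes }

    -- For the residue t / 2 the own and the reflected column coincide, so both indicators
    -- contribute to the same entry.
    row-middle : ∀ b k → b % t ≡ k → k + k ≡ t → row u b k ≈ 1# - indicator (1 ≤ᵇ b / t)
    row-middle b k ≡.refl e rewrite ≡ᵇ-true {b % t} ≡.refl | e | ≡ᵇ-true {t} ≡.refl with 1 ≤ᵇ b / t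
    ... | true = refl
    ... | false = refl

    -- The equation k + (k + m) = t + 1 says that the interval of residues ends at t - k. Removing
    -- both ends preserves it, down to the middle residue or to the empty interval.
    evaluate : ∀ m k w → 1 ≤ k → k + (k + m) ≡ suc t → Layer k m w →
      Decided (GoodFrom u cls k) (signedDet w (columns k m)) (signN (triangular n k m + t · excess n k m))
    evaluate zero k [] 1≤k t≡ level = inj₁ (
      ((λ i j k≤i i<j e → contradiction e (ℕ.>⇒≢ (too-large i j k≤i (ℕ.≤-trans k≤i (ℕ.<⇒≤ i<j))))) ,
       (λ i k≤i e → contradiction e (ℕ.>⇒≢ (too-large i i k≤i k≤i)))) ,
      trans (*-identityˡ 1#) (sym (reflexive (≡.cong signN (ℕ.*-zeroʳ t)))))
      where
      -- No pair and no middle residue is left, since already 2k = t + 1.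
      too-large : ∀ i j → k ≤ i → k ≤ j → t < i + j
      too-large i j k≤i k≤j = ℕ.≤-trans (ℕ.≤-reflexive (≡.trans (≡.sym t≡) (≡.cong (_+_ k) (ℕ.+-identityʳ k))))
        (ℕ.+-mono-≤ k≤i k≤j)
    evaluate zero k (_ ∷ _) 1≤k t≡ level with Layer.size level
    ... | ()
    evaluate (suc zero) k [] 1≤k t≡ level with Layer.size level
    ... | ()
    evaluate (suc zero) k (_ ∷ _ ∷ _) 1≤k t≡ level with Layer.size level
    ... | ()
    evaluate (suc zero) k (b ∷ []) 1≤k t≡ level = outcome _ ≡.refl
      where
      open Layer level
      k+k≡t : k + k ≡ t
      k+k≡t = ℕ.suc-injective (≡.trans (lem k) t≡)
        where
        lem : ∀ k → suc (k + k) ≡ k + (k + 1)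
        lem = ℕSolver.solve-∀
      res≡k : b % t ≡ k
      res≡k with range
      ... | (l , r) ∷ [] = ℕ.≤-antisym (s≤s⁻¹ (ℕ.≤-trans r (ℕ.≤-reflexive (ℕ.+-comm k 1)))) l
      cls≡ : b ∷ [] ≡ cls k
      cls≡ = ≡.trans hit (classes k ℕ.≤-refl (ℕ.≤-reflexive (ℕ.+-comm 1 k)))
        where
        hit : b ∷ [] ≡ class u k (b ∷ [])
        hit rewrite ≡ᵇ-true res≡k = ≡.refl
      det≈ : signedDet (b ∷ []) (columns k 1) ≈ 1# - indicator (1 ≤ᵇ b / t)
      det≈ = trans (*-identityˡ _) (trans (+-cong (*-identityʳ _) -0#≈0#) (trans (+-identityʳ _)
        (trans (reflexive (≡.cong (row u b) (ℕ.+-identityʳ k))) (row-middle b k res≡k k+k≡t))))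
      only-k : ∀ i → k ≤ i → i + i ≡ t → i ≡ k
      only-k i k≤i e with ℕ.<-cmp k i
      ... | tri< k<i _ _ = contradiction (≡.trans k+k≡t (≡.sym e)) (ℕ.<⇒≢ (ℕ.+-mono-< k<i k<i))
      ... | tri≈ _ k≡i _ = ≡.sym k≡i
      ... | tri> _ _ i<k = contradiction k≤i (ℕ.<⇒≱ i<k)
      outcome : ∀ p → (1 ≤ᵇ b / t) ≡ p → Decided (GoodFrom u cls k) (signedDet (b ∷ []) (columns k 1)) (signN (0 + t · 0))
      outcome true h = inj₂ ((λ (_ , mid) → bad (≡.subst (GoodMiddle u) (≡.sym cls≡) (mid k ℕ.≤-refl k+k≡t))) ,
          trans det≈ (trans (+-congˡ (-‿cong (reflexive (≡.cong indicator h)))) (-‿inverseʳ 1#)))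
        where
        bad : ¬ GoodMiddle u (b ∷ [])
        bad (middle q) = contradiction (≡.trans (≡.sym h) (≡.cong (1 ≤ᵇ_) q)) λ ()
      outcome false h = inj₁ (
          ((λ i j k≤i i<j e → contradiction (≡.trans k+k≡t (≡.sym e))
              (ℕ.<⇒≢ (ℕ.≤-<-trans (ℕ.+-monoˡ-≤ k k≤i) (ℕ.+-monoʳ-< i (ℕ.≤-<-trans k≤i i<j))))) ,
           (λ i k≤i e → ≡.subst (GoodMiddle u) (≡.trans cls≡ (≡.cong cls (≡.sym (only-k i k≤i e))))
              (middle (ℕ.n<1⇒n≡0 (ℕ.≰⇒> (≤ᵇ-false⁻¹ h)))))) ,
          trans det≈ (trans (+-congˡ (trans (-‿cong (reflexive (≡.cong indicator h))) -0#≈0#))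
            (trans (+-identityʳ 1#) (sym (reflexive (≡.cong signN (ℕ.*-zeroʳ t)))))))
    evaluate (suc (suc m)) k w 1≤k t≡ level = outcome decide
      where
      t≡' : k + (k + suc m) ≡ t
      t≡' = ℕ.suc-injective (≡.trans (lem k m) t≡)
        where
        lem : ∀ k m → suc (k + (k + suc m)) ≡ k + (k + suc (suc m))
        lem = ℕSolver.solve-∀
      open PairStep k m 1≤k t≡' w level
      t≡'' : suc k + (suc k + m) ≡ suc t
      t≡'' = ≡.trans (lem k m) t≡
        where
        lem : ∀ k m → suc k + (suc k + m) ≡ k + (k + suc (suc m))
        lem = ℕSolver.solve-∀
      Goal : Set ℓ
      Goal = Decided (GoodFrom u cls k) (signedDet w (columns k (suc (suc m))))
        (signN (triangular n k (suc (suc m)) + t · excess n k (suc (suc m))))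
      toColumns : ∀ {x} → signedDet w allColumns ≈ x → signedDet w (columns k (suc (suc m))) ≈ x
      toColumns {x} = ≡.subst (λ S → signedDet w S ≈ x) (≡.sym columns≡)
      extend : GoodPair u (cls k) (cls j) → GoodFrom u cls (suc k) → GoodFrom u cls k
      extend g (pairs , mid) = pairs' , mid'
        where
        pairs' : ∀ i i' → k ≤ i → i < i' → i + i' ≡ t → GoodPair u (cls i) (cls i')
        pairs' i i' k≤i i<i' e with k ℕ.≟ i
        ... | yes ≡.refl rewrite ℕ.+-cancelˡ-≡ k i' j (≡.trans e (≡.sym t≡')) = g
        ... | no k≢i = pairs i i' (ℕ.≤∧≢⇒< k≤i k≢i) i<i' e
        mid' : ∀ i → k ≤ i → i + i ≡ t → GoodMiddle u (cls i)
        mid' i k≤i e with k ℕ.≟ i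
        ... | yes ≡.refl = contradiction (ℕ.+-cancelˡ-≡ k k j (≡.trans e (≡.sym t≡'))) (ℕ.<⇒≢ k<j)
        ... | no k≢i = mid i (ℕ.≤∧≢⇒< k≤i k≢i) e
      restrict : GoodFrom u cls k → GoodFrom u cls (suc k)
      restrict (pairs , mid) = (λ i i' l → pairs i i' (ℕ.<⇒≤ l)) , (λ i l → mid i (ℕ.<⇒≤ l))
      outcome : Result → Goal
      outcome (inj₂ (b , x≈0)) = inj₂ ((λ (pairs , _) → b (pairs k j ℕ.≤-refl k<j t≡')) , toColumns x≈0)
      outcome (inj₁ (g , x≈)) with evaluate m (suc k) rest (s≤s z≤n) t≡'' (rest-level (GoodPair⇒length g))
      ... | inj₂ (b , y≈0) = inj₂ (b ∘ restrict , toColumns (trans x≈ (trans (*-congˡ y≈0) (zeroʳ _))))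
      ... | inj₁ (gs , y≈) = inj₁ (extend g gs , toColumns (trans x≈ (trans (*-congˡ y≈)
          (trans (sym (signN-+ exponent _)) (reflexive (≡.cong signN
            (lem (suc (n j) C 2) t ((n k ∸ 1) + (n j ∸ 1)) (triangular n (suc k) m) (excess n (suc k) m))))))))
        where
        lem : ∀ a t b x y → (a + t · b) + (x + t · y) ≡ (a + x) + t · (b + y)
        lem = ℕSolver.solve-∀

    row-zero-zero : ∀ b → b % t ≡ 0 → row u b 0 ≈ 1# - indicator (2 ≤ᵇ b / t)
    row-zero-zero b e rewrite e = refl

    -- Splitting off the residue 0

    module ZeroStep (w : List ℕ) (level : Layer 0 t w) where
      open Layer level

      -- A residue is never t; including the column t makes the rows with residue 0
      -- supported on the columns of this class.
      inZero : ℕ → Bool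
      inZero r = (r ≡ᵇ 0) ∨ (r ≡ᵇ t)

      zeros rest : List ℕ
      zeros = bfilter (inZero ∘ (_% t)) w
      rest = bfilter (not ∘ inZero ∘ (_% t)) w

      inZero⁻¹ : ∀ {b} → inZero (b % t) ≡ true → b % t ≡ 0
      inZero⁻¹ {b} e with ∨-true⁻¹ {b % t ≡ᵇ 0} e
      ... | inj₁ p = ≡ᵇ-true⁻¹ p
      ... | inj₂ p = contradiction (≡ᵇ-true⁻¹ p) (ℕ.<⇒≢ (m%n<n b t))

      outside⁻¹ : ∀ {r} → inZero r ≡ false → r ≢ 0 × r ≢ t
      outside⁻¹ {r} e = ≡ᵇ-false⁻¹ (∨-false⁻¹ˡ {r ≡ᵇ 0} e) , ≡ᵇ-false⁻¹ (∨-false⁻¹ʳ {r ≡ᵇ 0} e)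

      zeros-sound : All (λ b → b % t ≡ 0) zeros
      zeros-sound = All.map (λ {b} → inZero⁻¹ {b}) (bfilter-sound (inZero ∘ (_% t)) w)

      rest-sound : All (λ b → inZero (b % t) ≡ false) rest
      rest-sound = All.map not-true⁻¹ (bfilter-sound (not ∘ inZero ∘ (_% t)) w)

      zeros-supported : ∀ {b} → b % t ≡ 0 → SupportedOn inZero (row u b)
      zeros-supported {b} e c q = row-zero b c
        (λ e' → proj₁ (outside⁻¹ {c} q) (≡.trans e' e))
        (λ e' → proj₂ (outside⁻¹ {c} q) (≡.trans (≡.sym (≡.trans (≡.cong (_+_ c) e) (ℕ.+-identityʳ c))) e'))
        (λ e' → proj₁ (outside⁻¹ {c} q) (ℕ.m+n≡0⇒m≡0 c e'))

      rest-supported : ∀ {b} → inZero (b % t) ≡ false → SupportedOn (not ∘ inZero) (row u b)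
      rest-supported {b} q c nq with outside⁻¹ {b % t} q | ∨-true⁻¹ {c ≡ᵇ 0} (not-false⁻¹ {inZero c} nq)
      ... | n₀ , nₜ | inj₁ p rewrite ≡ᵇ-true⁻¹ {c} {0} p = row-zero b 0 (n₀ ∘ ≡.sym) nₜ n₀
      ... | n₀ , nₜ | inj₂ p rewrite ≡ᵇ-true⁻¹ {c} {t} p = row-zero b t (nₜ ∘ ≡.sym)
            (λ e → n₀ (ℕ.+-cancelˡ-≡ t _ 0 (≡.trans e (≡.sym (ℕ.+-identityʳ t))))) λ ()

      zeros≡ : zeros ≡ cls 0
      zeros≡ = ≡.trans (≡.sym (bfilter-all (All.map ≡ᵇ-true zeros-sound)))
        (≡.trans (bfilter-absorb (λ b e → ≡.cong inZero (≡ᵇ-true⁻¹ {b % t} e)) w) (classes 0 z≤n (s≤s z≤n)))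

      length-zeros-rest : length zeros + length rest ≡ suc u
      length-zeros-rest = ≡.trans (length-bfilter-not (inZero ∘ (_% t)) w) size

      middleColumns allColumns : List ℕ
      middleColumns = columns 1 u
      allColumns = middleColumns ∷ʳ 0

      middle-outside : All (λ c → inZero c ≡ false) middleColumns
      middle-outside = All.map (λ { {suc c} (_ , r) → ≡ᵇ-false (ℕ.<⇒≢ r) }) (columns-range 1 u)

      count-zeros : count inZero allColumns ≡ 1
      count-zeros = ≡.trans (≡.cong length (bfilter-++ inZero middleColumns (0 ∷ [])))
        (≡.cong (λ l → length (l ++ 0 ∷ [])) (bfilter-none middle-outside))

      count-rest : count (not ∘ inZero) allColumns ≤ u
      count-rest = ℕ.≤-trans (ℕ.≤-reflexive (≡.trans (≡.cong length (bfilter-++ (not ∘ inZero) middleColumns (0 ∷ [])))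
        (≡.trans (length-++ (bfilter (not ∘ inZero) middleColumns)) (ℕ.+-identityʳ _))))
        (ℕ.≤-trans (length-bfilter (not ∘ inZero) middleColumns) (ℕ.≤-reflexive (length-columns 1 u)))

      partitioned : ∀ {p} → zeros ≡ p → signedDet w allColumns ≈
        signN (inversions (map (_% t) (p ++ rest))) *R contractAll (map (row u) p) (rowDet rest) allColumns
      partitioned ≡.refl = signedDet-partition inZero w allColumns

      rest-range : All (λ b → 1 ≤ b % t × b % t < 1 + u) rest
      rest-range = All.map (λ {b} q → ℕ.n≢0⇒n>0 (proj₁ (outside⁻¹ {b % t} q)) , m%n<n b t) rest-sound

      rest-level : ∀ {b} → zeros ≡ b ∷ [] → Layer 1 u rest
      rest-level e = record
        { range = rest-range
        ; size = ℕ.suc-injective (≡.trans (≡.cong (λ l → length l + length rest) (≡.sym e)) length-zeros-rest)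
        ; classes = λ i l r → ≡.trans (bfilter-absorb (λ b e' → ≡.cong not
            (≡.trans (≡.cong inZero (≡ᵇ-true⁻¹ {b % t} e')) (outside l r))) w) (classes i z≤n r)
        }
        where
        outside : ∀ {i} → 1 ≤ i → i < t → inZero i ≡ false
        outside (s≤s z≤n) r = ≡ᵇ-false (ℕ.<⇒≢ r)

      -- The term `u` in the exponent is the sign for reaching the column 0 across the other `u`
      -- columns.
      Result : Set ℓ
      Result = Decided (GoodZero u (cls 0) × GoodFrom u cls 1) (signedDet w (columns 0 t))
        (signN (u + (triangular n 1 u + t · excess n 1 u)))

      degenerate : ¬ GoodZero u (cls 0) → signedDet w allColumns ≈ 0# → Result
      degenerate b e = inj₂ (b ∘ proj₁ , ≡.subst (λ S → signedDet w S ≈ 0#) (≡.sym (columns-∷ʳ 0 u)) e)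

      single : ∀ b → zeros ≡ b ∷ [] → Result
      single b e = outcome (2 ≤ᵇ b / t) ≡.refl
        where
        res≡0 : b % t ≡ 0
        res≡0 with ≡.subst (All _) e zeros-sound
        ... | p ∷ [] = p
        none-smaller : inversions (map (_% t) (b ∷ rest)) ≡ inversions (map (_% t) rest)
        none-smaller rewrite res≡0 = ≡.cong (_+ inversions (map (_% t) rest)) (≡.cong length
          (bfilter-none (All.universal (λ _ → ≡.refl) (map (_% t) rest))))
        det≈ : signedDet w allColumns ≈
          signN u *R ((1# - indicator (2 ≤ᵇ b / t)) *R signedDet rest middleColumns)
        det≈ = begin
          signedDet w allColumns
            ≈⟨ partitioned e ⟩
          signN (inversions (map (_% t) (b ∷ rest))) *R contract (row u b) (rowDet rest) allColumns
            ≈⟨ *-cong (reflexive (≡.cong signN none-smaller))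
                 (contract-snoc (row u b) (rowDet rest) middleColumns 0
                   (All.map (λ {c} → zeros-supported {b} res≡0 c) middle-outside)) ⟩
          s *R (signN (length middleColumns) *R (row u b 0 *R G))
            ≈⟨ *S.x∙yz≈y∙xz _ _ _ ⟩
          signN (length middleColumns) *R (s *R (row u b 0 *R G))
            ≈⟨ *-cong (reflexive (≡.cong signN (length-columns 1 u))) (*S.x∙yz≈y∙xz _ _ _) ⟩
          signN u *R (row u b 0 *R (s *R G))
            ≈⟨ *-congˡ (*-congʳ (row-zero-zero b res≡0)) ⟩
          signN u *R ((1# - indicator (2 ≤ᵇ b / t)) *R (s *R G)) ∎
          where
          s = signN (inversions (map (_% t) rest))
          G = rowDet rest middleColumns
        outcome : ∀ p → (2 ≤ᵇ b / t) ≡ p → Result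
        outcome true h = degenerate (λ g → bad (≡.subst (GoodZero u) (≡.trans (≡.sym zeros≡) e) g))
          (trans det≈ (trans (*-congˡ (trans (*-congʳ (trans (+-congˡ (-‿cong (reflexive (≡.cong indicator h))))
            (-‿inverseʳ 1#))) (zeroˡ _))) (zeroʳ _)))
          where
          bad : ¬ GoodZero u (b ∷ [])
          bad (zeroClass q) = ℕ.<⇒≱ (≤ᵇ-true⁻¹ {2} h) q
        outcome false h with evaluate u 1 rest (s≤s z≤n) ≡.refl (rest-level e)
        ... | inj₂ (b' , y≈0) = inj₂ (b' ∘ proj₂ , ≡.subst (λ S → signedDet w S ≈ 0#) (≡.sym (columns-∷ʳ 0 u))
              (trans det≈ (trans (*-congˡ (trans (*-congˡ y≈0) (zeroʳ _))) (zeroʳ _))))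
        ... | inj₁ (g , y≈) = inj₁ ((≡.subst (GoodZero u) (≡.trans (≡.sym e) zeros≡)
                (zeroClass (s≤s⁻¹ (ℕ.≰⇒> (≤ᵇ-false⁻¹ {2} h)))) , g) ,
              ≡.subst (λ S → signedDet w S ≈ signN (u + (triangular n 1 u + t · excess n 1 u))) (≡.sym (columns-∷ʳ 0 u))
              (trans det≈ (trans (*-congˡ (trans (*-cong (trans (+-congˡ (trans (-‿cong (reflexive (≡.cong indicator h)))
                -0#≈0#)) (+-identityʳ 1#)) y≈) (*-identityˡ _))) (sym (signN-+ u _)))))

      -- The class 0 can only use the column 0, and the other rows only the remaining `u` columns,
      -- so any size other than one leads to zero.
      evaluateAll : Result
      evaluateAll = cases zeros ≡.refl
        where
        vanish : ∀ {p} → zeros ≡ p → contractAll (map (row u) p) (rowDet rest) allColumns ≈ 0# →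
          signedDet w allColumns ≈ 0#
        vanish e z = trans (partitioned e) (trans (*-congˡ z) (zeroʳ _))
        bad : ∀ {p} → zeros ≡ p → ¬ GoodZero u p → ¬ GoodZero u (cls 0)
        bad e b g = b (≡.subst (GoodZero u) (≡.trans (≡.sym zeros≡) e) g)
        cases : ∀ p → zeros ≡ p → Result
        cases [] e = degenerate (bad e λ ()) (vanish e (contractAll-supported (not ∘ inZero) (map (row u) rest) _ allColumns
          (All.map⁺ (All.map (λ {b} → rest-supported {b}) rest-sound))
          (ℕ.≤-trans (s≤s count-rest) (ℕ.≤-reflexive (≡.sym (≡.trans (length-map (row u) rest)
            (≡.trans (≡.cong (λ l → length l + length rest) (≡.sym e)) length-zeros-rest)))))))
        cases (b ∷ []) e = single b e
        cases (b₁ ∷ b₂ ∷ p) e = degenerate (bad e λ ()) (vanish e (contractAll-supported inZero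
          (map (row u) (b₁ ∷ b₂ ∷ p)) _ allColumns
          (All.map⁺ (All.map (λ {b} → zeros-supported {b}) (≡.subst (All _) e zeros-sound)))
          (ℕ.≤-trans (s≤s (ℕ.≤-reflexive count-zeros)) (s≤s (s≤s z≤n)))))

-- The sorting permutation

nth-lookup : ∀ {n} (v : Vec ℕ n) i → nth (toList v) (suc (Fin.toℕ i)) ≡ Vec.lookup v i
nth-lookup (x Vec.∷ v) Fin.zero = ≡.refl
nth-lookup (x Vec.∷ v) (Fin.suc i) = nth-lookup v i

beta-decreasing : ∀ {t} (lam : Vec ℕ t) → Decreasing lam → AllPairs _>_ (beta (toList lam))
beta-decreasing {t} lam dec = ≡.subst (AllPairs _>_) (≡.sym (beta-tabulate lam))
  (AllPairs.tabulate⁺-< λ {i} {j} i<j → ℕ.<-≤-trans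
    (ℕ.∸-monoʳ-< (s≤s i<j) (ℕ.≤-trans (toℕ<n j) (ℕ.m≤n+m t (nth (toList lam) (suc (Fin.toℕ j))))))
    (ℕ.∸-monoˡ-≤ (suc (Fin.toℕ i)) (ℕ.+-monoˡ-≤ t (≡.subst₂ _≤_ (≡.sym (nth-lookup lam j)) (≡.sym (nth-lookup lam i))
      (dec i j (ℕ.<⇒≤ i<j))))))

length-beta : ∀ {t} (lam : Vec ℕ t) → length (beta (toList lam)) ≡ t
length-beta lam = ≡.trans (≡.cong length (beta-tabulate lam)) (length-tabulate _)

-- Being the least entry, `s` is inverted with everything before it and with nothing after it.
inversions-insert : ∀ s xs ys → All (s <_) xs → All (s <_) ys →
  inversions (xs ++ s ∷ ys) ≡ length xs + inversions (xs ++ ys)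
inversions-insert s [] ys [] ps = ≡.cong (_+ inversions ys) (≡.cong length
  (bfilter-none (All.map (λ l → <ᵇ-false (ℕ.<-asym l)) ps)))
inversions-insert s (x ∷ xs) ys (p ∷ ps) qs = begin
  count (_<ᵇ x) (xs ++ s ∷ ys) + inversions (xs ++ s ∷ ys)
    ≡⟨ ≡.cong₂ _+_ smaller-insert (inversions-insert s xs ys ps qs) ⟩
  suc (count (_<ᵇ x) (xs ++ ys)) + (length xs + inversions (xs ++ ys))
    ≡⟨ ≡.cong suc (ℕ.+-assoc (count (_<ᵇ x) (xs ++ ys)) _ _) ⟨
  suc (count (_<ᵇ x) (xs ++ ys) + length xs + inversions (xs ++ ys))
    ≡⟨ ≡.cong (λ a → suc (a + inversions (xs ++ ys))) (ℕ.+-comm (count (_<ᵇ x) (xs ++ ys)) _) ⟩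
  suc (length xs + count (_<ᵇ x) (xs ++ ys) + inversions (xs ++ ys))
    ≡⟨ ≡.cong suc (ℕ.+-assoc (length xs) _ _) ⟩
  suc (length xs) + (count (_<ᵇ x) (xs ++ ys) + inversions (xs ++ ys)) ∎
  where
  open ≡.≡-Reasoning
  cons : count (_<ᵇ x) (s ∷ ys) ≡ suc (count (_<ᵇ x) ys)
  cons rewrite <ᵇ-true p = ≡.refl
  smaller-insert : count (_<ᵇ x) (xs ++ s ∷ ys) ≡ suc (count (_<ᵇ x) (xs ++ ys))
  smaller-insert = begin
    count (_<ᵇ x) (xs ++ s ∷ ys)
      ≡⟨ ≡.trans (≡.cong length (bfilter-++ _ xs (s ∷ ys))) (length-++ (bfilter (_<ᵇ x) xs)) ⟩
    count (_<ᵇ x) xs + count (_<ᵇ x) (s ∷ ys)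
      ≡⟨ ≡.trans (≡.cong (_+_ (count (_<ᵇ x) xs)) cons) (ℕ.+-suc (count (_<ᵇ x) xs) _) ⟩
    suc (count (_<ᵇ x) xs + count (_<ᵇ x) ys)
      ≡⟨ ≡.cong suc (≡.trans (≡.cong length (bfilter-++ _ xs ys)) (length-++ (bfilter (_<ᵇ x) xs))) ⟨
    suc (count (_<ᵇ x) (xs ++ ys)) ∎

module Sorting (u : ℕ) where

  block : ℕ → List ℕ → ℕ → List ℕ
  block s bs i = map proj₁ (bfilter (λ p → proj₂ p % suc u ≡ᵇ i) (indexed s bs))

  -- The initial segment of σ_λ that lists the entries of the residue classes below n.
  blocks : ℕ → List ℕ → ℕ → List ℕ
  blocks s bs n = concat (map (block s bs) (upTo n))

  blocks-suc : ∀ s bs n → blocks s bs (suc n) ≡ blocks s bs n ++ block s bs n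
  blocks-suc s bs n = begin
    concat (map (block s bs) (upTo (suc n)))
      ≡⟨ ≡.cong (concat ∘ map (block s bs)) (upTo-∷ʳ n) ⟨
    concat (map (block s bs) (upTo n ∷ʳ n))
      ≡⟨ ≡.cong concat (map-++ (block s bs) (upTo n) (n ∷ [])) ⟩
    concat (map (block s bs) (upTo n) ++ block s bs n ∷ [])
      ≡⟨ concat-++ (map (block s bs) (upTo n)) (block s bs n ∷ []) ⟨
    blocks s bs n ++ (block s bs n ++ [])
      ≡⟨ ≡.cong (blocks s bs n ++_) (++-identityʳ _) ⟩
    blocks s bs n ++ block s bs n ∎
    where
    open ≡.≡-Reasoning

  block-hit : ∀ s x bs → block s (x ∷ bs) (x % suc u) ≡ s ∷ block (suc s) bs (x % suc u)
  block-hit s x bs rewrite ≡ᵇ-true {x % suc u} ≡.refl = ≡.refl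

  block-miss : ∀ s x bs i → x % suc u ≢ i → block s (x ∷ bs) i ≡ block (suc s) bs i
  block-miss s x bs i ne rewrite ≡ᵇ-false ne = ≡.refl

  blocks-miss : ∀ s x bs n → n ≤ x % suc u → blocks s (x ∷ bs) n ≡ blocks (suc s) bs n
  blocks-miss s x bs zero _ = ≡.refl
  blocks-miss s x bs (suc n) l = ≡.trans (blocks-suc s (x ∷ bs) n) (≡.trans
    (≡.cong₂ _++_ (blocks-miss s x bs n (ℕ.<⇒≤ l)) (block-miss s x bs n (ℕ.>⇒≢ l)))
    (≡.sym (blocks-suc (suc s) bs n)))

  -- The new index `s` heads the block of its residue. It is therefore inserted right after the
  -- blocks of the smaller residues, and `ys` is what follows there.
  blocks-hit : ∀ s x bs n → x % suc u < n → ∃[ ys ]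
    (blocks s (x ∷ bs) n ≡ blocks (suc s) bs (x % suc u) ++ s ∷ ys ×
     blocks (suc s) bs n ≡ blocks (suc s) bs (x % suc u) ++ ys)
  blocks-hit s x bs (suc n) (s≤s l) with x % suc u ℕ.≟ n
  ... | yes e = block (suc s) bs n ,
        ≡.trans (blocks-suc s (x ∷ bs) n) (≡.cong₂ _++_
          (≡.trans (blocks-miss s x bs n (ℕ.≤-reflexive (≡.sym e))) (≡.cong (blocks (suc s) bs) (≡.sym e)))
          (≡.trans (≡.cong (block s (x ∷ bs)) (≡.sym e)) (≡.trans (block-hit s x bs) (≡.cong (λ i → s ∷ block (suc s) bs i) e)))) ,
        ≡.trans (blocks-suc (suc s) bs n) (≡.cong (λ i → blocks (suc s) bs i ++ block (suc s) bs n) (≡.sym e))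
  ... | no ne with blocks-hit s x bs n (ℕ.≤∧≢⇒< l ne)
  ...   | ys , e₁ , e₂ = ys ++ block (suc s) bs n ,
        ≡.trans (blocks-suc s (x ∷ bs) n) (≡.trans (≡.cong₂ _++_ e₁ (block-miss s x bs n ne))
          (++-assoc (blocks (suc s) bs (x % suc u)) (s ∷ ys) _)) ,
        ≡.trans (blocks-suc (suc s) bs n) (≡.trans (≡.cong (_++ block (suc s) bs n) e₂)
          (++-assoc (blocks (suc s) bs (x % suc u)) ys _))

  indexed-lower : ∀ s bs → All (λ p → s ≤ proj₁ p) (indexed s bs)
  indexed-lower s [] = []
  indexed-lower s (x ∷ bs) = ℕ.≤-refl ∷ All.map ℕ.<⇒≤ (indexed-lower (suc s) bs)

  blocks-lower : ∀ s bs n → All (s ≤_) (blocks s bs n)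
  blocks-lower s bs n = All.concat⁺ (All.map⁺ (All.universal
    (λ i → All.map⁺ (bfilter-All _ (indexed-lower s bs))) (upTo n)))

  length-blocks : ∀ s bs n → length (blocks s bs n) ≡ smaller u n bs
  length-blocks s [] zero = ≡.refl
  length-blocks s [] (suc n) = ≡.trans (≡.cong length (blocks-suc s [] n))
    (≡.trans (≡.cong length (++-identityʳ (blocks s [] n))) (length-blocks s [] n))
  length-blocks s (x ∷ bs) n with x % suc u ℕ.<? n
  ... | no nl = ≡.trans (≡.cong length (blocks-miss s x bs n (ℕ.≮⇒≥ nl)))
        (≡.trans (length-blocks (suc s) bs n) miss)
    where
    miss : smaller u n bs ≡ smaller u n (x ∷ bs)
    miss rewrite <ᵇ-false nl = ≡.refl
  ... | yes l with blocks-hit s x bs n l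
  ...   | ys , e₁ , e₂ = begin
    length (blocks s (x ∷ bs) n)
      ≡⟨ ≡.trans (≡.cong length e₁) (length-++ A) ⟩
    length A + suc (length ys)
      ≡⟨ ≡.trans (ℕ.+-suc (length A) _) (≡.cong suc (≡.sym (length-++ A))) ⟩
    suc (length (A ++ ys))
      ≡⟨ ≡.cong suc (≡.trans (≡.cong length (≡.sym e₂)) (length-blocks (suc s) bs n)) ⟩
    suc (smaller u n bs)
      ≡⟨ hit ⟨
    smaller u n (x ∷ bs) ∎
    where
    open ≡.≡-Reasoning
    A = blocks (suc s) bs (x % suc u)
    hit : smaller u n (x ∷ bs) ≡ suc (smaller u n bs)
    hit rewrite <ᵇ-true l = ≡.refl

  -- The least index `s` is preceded by one index for each later entry with a smaller residue, and
  -- these are also the inversions that the residue of `x` has at the head of the residue sequence.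
  inversions-blocks : ∀ s bs → inversions (blocks s bs (suc u)) ≡ inversions (map (_% suc u) bs)
  inversions-blocks s [] = ≡.cong inversions (all-empty (suc u))
    where
    all-empty : ∀ n → blocks s [] n ≡ []
    all-empty zero = ≡.refl
    all-empty (suc n) = ≡.trans (blocks-suc s [] n) (≡.trans (++-identityʳ _) (all-empty n))
  inversions-blocks s (x ∷ bs) with blocks-hit s x bs (suc u) (m%n<n x (suc u))
  ... | ys , e₁ , e₂ = begin
    inversions (blocks s (x ∷ bs) (suc u))
      ≡⟨ ≡.cong inversions e₁ ⟩
    inversions (A ++ s ∷ ys)
      ≡⟨ inversions-insert s A ys (blocks-lower (suc s) bs (x % suc u))
           (All.++⁻ʳ A (≡.subst (All (s <_)) e₂ (blocks-lower (suc s) bs (suc u)))) ⟩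
    length A + inversions (A ++ ys)
      ≡⟨ ≡.cong₂ _+_ (length-blocks (suc s) bs (x % suc u))
           (≡.trans (≡.cong inversions (≡.sym e₂)) (inversions-blocks (suc s) bs)) ⟩
    smaller u (x % suc u) bs + inversions (map (_% suc u) bs) ∎
    where
    open ≡.≡-Reasoning
    A = blocks (suc s) bs (x % suc u)

inversions-sigma : ∀ u lam → inversions (sigma (suc u) lam) ≡ inversions (map (_% suc u) (beta lam))
inversions-sigma u lam = Sorting.inversions-blocks u 1 (beta lam)

-- The condition and the sign

smaller-suc : ∀ u i bs → smaller u (suc i) bs ≡ smaller u i bs + length (class u i bs)
smaller-suc u i [] = ≡.refl
smaller-suc u i (b ∷ bs) with ℕ.<-cmp (b % suc u) i
... | tri< l ne _ rewrite <ᵇ-true l | <ᵇ-true (ℕ.m<n⇒m<1+n l) | ≡ᵇ-false ne = ≡.cong suc (smaller-suc u i bs)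
... | tri≈ nl e _ rewrite <ᵇ-false nl | <ᵇ-true (s≤s (ℕ.≤-reflexive e)) | ≡ᵇ-true e =
      ≡.trans (≡.cong suc (smaller-suc u i bs)) (≡.sym (ℕ.+-suc (smaller u i bs) _))
... | tri> nl ne l rewrite <ᵇ-false nl | <ᵇ-false (ℕ.≤⇒≯ l) | ≡ᵇ-false ne = smaller-suc u i bs

sum-classes : ∀ u bs m → sumBelow (λ i → length (class u i bs)) m ≡ smaller u m bs
sum-classes u bs zero = ≡.sym (≡.cong length (bfilter-none (All.universal (λ _ → ≡.refl) (map (_% suc u) bs))))
sum-classes u bs (suc m) = ≡.trans (≡.cong (_+ length (class u m bs)) (sum-classes u bs m)) (≡.sym (smaller-suc u m bs))

total-classes : ∀ u bs → sumBelow (λ i → length (class u i bs)) (suc u) ≡ length bs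
total-classes u bs = ≡.trans (sum-classes u bs (suc u)) (≡.trans (≡.cong length (bfilter-all
  (All.map⁺ (All.universal (λ b → <ᵇ-true (m%n<n b (suc u))) bs)))) (length-map (_% suc u) bs))

sum-map-upTo : ∀ (f : ℕ → ℕ) n → sum (map f (upTo n)) ≡ sumBelow f n
sum-map-upTo f zero = ≡.refl
sum-map-upTo f (suc n) = begin
  sum (map f (upTo (suc n)))             ≡⟨ ≡.cong (sum ∘ map f) (upTo-∷ʳ n) ⟨
  sum (map f (upTo n ∷ʳ n))              ≡⟨ ≡.cong sum (map-++ f (upTo n) (n ∷ [])) ⟩
  sum (map f (upTo n) ++ f n ∷ [])       ≡⟨ sum-++ (map f (upTo n)) (f n ∷ []) ⟩
  sum (map f (upTo n)) + (f n + 0)       ≡⟨ ≡.cong₂ _+_ (sum-map-upTo f n) (ℕ.+-identityʳ (f n)) ⟩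
  sumBelow f (suc n)                     ∎
  where
  open ≡.≡-Reasoning

-- Parity of the exponents

data Parity : ℕ → Set where
  even : ∀ p → Parity (p + p)
  odd  : ∀ p → Parity (suc (p + p))

parity : ∀ n → Parity n
parity zero = even 0
parity (suc n) with parity n
... | even p = odd p
... | odd p = ≡.subst Parity (≡.cong suc (ℕ.+-suc p p)) (even (suc p))

-- `triangular` runs through the upper half of the interval from the top, the sum in ε from the
-- bottom; so the first term on the left is the last summand on the right.
triangular-even : ∀ n p k → triangular n k (p + p) ≡ sumBelow (λ j → suc (n (j + (k + p))) C 2) p
triangular-even n zero k = ≡.refl
triangular-even n (suc p) k rewrite ℕ.+-suc p p = ≡.trans
  (≡.cong₂ _+_ (≡.cong (λ i → suc (n i) C 2) (lem k p)) (≡.trans (triangular-even n p (suc k))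
    (sumBelow-cong p (λ j _ → ≡.cong (λ a → suc (n (j + a)) C 2) (≡.sym (ℕ.+-suc k p))))))
  (ℕ.+-comm (suc (n (p + (k + suc p))) C 2) _)
  where
  lem : ∀ k p → k + suc (p + p) ≡ p + (k + suc p)
  lem = ℕSolver.solve-∀

triangular-odd : ∀ n p k → triangular n k (suc (p + p)) ≡ sumBelow (λ j → suc (n (j + suc (k + p))) C 2) p
triangular-odd n zero k = ≡.refl
triangular-odd n (suc p) k rewrite ℕ.+-suc p p = ≡.trans
  (≡.cong₂ _+_ (≡.cong (λ i → suc (n i) C 2) (lem k p)) (≡.trans (triangular-odd n p (suc k))
    (sumBelow-cong p (λ j _ → ≡.cong (λ a → suc (n (j + suc a)) C 2) (≡.sym (ℕ.+-suc k p))))))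
  (ℕ.+-comm (suc (n (p + suc (k + suc p))) C 2) _)
  where
  lem : ∀ k p → k + suc (suc (p + p)) ≡ p + suc (k + suc p)
  lem = ℕSolver.solve-∀

-- `excess` leaves out the middle residue; its class has exactly one row, so it would contribute 0.
excess-sum : ∀ n t m k → (∀ i → i + i ≡ t → n i ≡ 1) → k + (k + m) ≡ suc t →
  excess n k m ≡ sumBelow (λ i → n (k + i) ∸ 1) m
excess-sum n t zero k mid e = ≡.refl
excess-sum n t (suc zero) k mid e = ≡.sym (≡.cong (_∸ 1) (≡.trans (≡.cong n (ℕ.+-identityʳ k))
  (mid k (ℕ.suc-injective (≡.trans (lem k) e)))))
  where
  lem : ∀ k → suc (k + k) ≡ k + (k + 1)
  lem = ℕSolver.solve-∀
excess-sum n t (suc (suc m)) k mid e = begin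
  (n k ∸ 1) + top + excess n (suc k) m
    ≡⟨ ≡.cong (_+_ ((n k ∸ 1) + top)) (excess-sum n t m (suc k) mid (≡.trans (lem k m) e)) ⟩
  (n k ∸ 1) + top + sumBelow (λ i → n (suc k + i) ∸ 1) m
    ≡⟨ swap (n k ∸ 1) top _ ⟩
  (n k ∸ 1) + sumBelow (λ i → n (suc k + i) ∸ 1) m + top
    ≡⟨ ≡.cong (_+ top) (≡.cong₂ _+_ (≡.cong (λ i → n i ∸ 1) (≡.sym (ℕ.+-identityʳ k)))
         (sumBelow-cong m (λ i _ → ≡.cong (λ j → n j ∸ 1) (≡.sym (ℕ.+-suc k i))))) ⟩
  (n (k + 0) ∸ 1) + sumBelow (λ i → n (k + suc i) ∸ 1) m + top
    ≡⟨ ≡.cong (_+ top) (≡.sym (sumBelow-∷ (λ i → n (k + i) ∸ 1) m)) ⟩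
  sumBelow (λ i → n (k + i) ∸ 1) (suc (suc m)) ∎
  where
  open ≡.≡-Reasoning
  top = n (k + suc m) ∸ 1
  lem : ∀ k m → suc k + (suc k + m) ≡ k + (k + suc (suc m))
  lem = ℕSolver.solve-∀
  swap : ∀ a b c → a + b + c ≡ a + c + b
  swap = ℕSolver.solve-∀

-- `signZ` only sees the absolute value; modulo 2 neither this nor the minus sign in ε makes a
-- difference.
isEven-∣-∣ : ∀ a b → isEven ∣ ℤ.- (+ a) ℤ.+ (+ b) ∣ ≡ isEven (a + b)
isEven-∣-∣ a b rewrite ℤ.-m+n≡n⊖m a b with a ℕ.≤? b
... | yes a≤b rewrite ℤ.⊖-≥ a≤b = ≡.trans (≡.sym (isEven-double a (b ∸ a))) (≡.cong isEven
      (≡.trans (ℕ.+-assoc a a (b ∸ a)) (≡.cong (_+_ a) (ℕ.m+[n∸m]≡n a≤b))))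
... | no a≰b rewrite ℤ.⊖-< (ℕ.≰⇒> a≰b) | ℤ.∣-i∣≡∣i∣ (+ (a ∸ b)) = ≡.trans (≡.sym (isEven-double b (a ∸ b))) (≡.cong isEven
      (≡.trans (ℕ.+-assoc b b (a ∸ b)) (≡.trans (≡.cong (_+_ b) (ℕ.m+[n∸m]≡n (ℕ.<⇒≤ (ℕ.≰⇒> a≰b)))) (ℕ.+-comm b a))))

isEven-even : ∀ p → isEven (p + p) ≡ true
isEven-even p = ≡.trans (≡.cong isEven (≡.sym (ℕ.+-identityʳ (p + p)))) (isEven-double p 0)

isEven-odd : ∀ p → isEven (suc (p + p)) ≡ false
isEven-odd p = ≡.trans (isEven-suc (p + p)) (≡.cong not (isEven-even p))

half-even : ∀ p → (p + p) / 2 ≡ p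
half-even p = ≡.trans (≡.cong (_/ 2) (lem p)) (m*n/n≡m p 2)
  where
  lem : ∀ p → p + p ≡ p · 2
  lem = ℕSolver.solve-∀

half-odd : ∀ p → suc (p + p) / 2 ≡ p
half-odd p = ≡.trans (≡.cong (_/ 2) (lem p)) (≡.trans (+-distrib-/ 1 (p · 2) bound) (m*n/n≡m p 2))
  where
  lem : ∀ p → suc (p + p) ≡ 1 + p · 2
  lem = ℕSolver.solve-∀
  bound : 1 % 2 + p · 2 % 2 < 2
  bound = ≡.subst (λ r → 1 + r < 2) (≡.sym (m*n%n≡0 p 2)) ℕ.≤-refl

isEven⇒double : ∀ t → isEven t ≡ true → t / 2 + t / 2 ≡ t
isEven⇒double t e with parity t
... | even p = ≡.cong₂ _+_ (half-even p) (half-even p)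
... | odd p = contradiction (≡.trans (≡.sym (isEven-odd p)) e) λ ()

-- Translating the classes into core, quotient and ε

module Partition (u : ℕ) (lam : List ℕ) (size : length (beta lam) ≡ suc u)
  (decreasing : AllPairs _>_ (beta lam)) where

  t : ℕ
  t = suc u

  cls : ℕ → List ℕ
  cls = resClass t lam

  n : ℕ → ℕ
  n = nres t lam

  Good : Set
  Good = GoodZero u (cls 0) × GoodFrom u cls 1

  total : sumBelow n t ≡ t
  total = ≡.trans (total-classes u (beta lam)) size

  module Ab = Abacus u n total
  module Co = Core t (s≤s z≤n) n Ab.beads Ab.length-beads Ab.beads-sorted Ab.multiplicity-≤1 Ab.bead-≡

  cls-decreasing : ∀ i → AllPairs _>_ (cls i)
  cls-decreasing i = bfilter-AllPairs _ decreasing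

  cls-residue : ∀ i → All (λ b → b % t ≡ i) (cls i)
  cls-residue i = All.map (λ {b} e → ≡ᵇ-true⁻¹ {b % t} e) (bfilter-sound (λ b → b % t ≡ᵇ i) (beta lam))

  -- The quotient as a function of the class alone; at `cls i` it is `quotient t lam i` by
  -- definition.
  quotientOf : List ℕ → List ℕ
  quotientOf l = quotGo t (length l) 1 l

  quot-< : ∀ {b b'} → b' < b → b % t ≡ b' % t → b' / t < b / t
  quot-< {b} {b'} b'<b e = ℕ.≰⇒> λ q≤q' → ℕ.<⇒≱ b'<b (begin
    b                        ≡⟨ m≡m%n+[m/n]*n b t ⟩
    b % t + b / t · t        ≤⟨ ℕ.+-mono-≤ (ℕ.≤-reflexive e) (ℕ.*-monoˡ-≤ t q≤q') ⟩
    b' % t + b' / t · t      ≡⟨ m≡m%n+[m/n]*n b' t ⟨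
    b'                       ∎)
    where
    open ℕ.≤-Reasoning

  len-single : ∀ x → len (x ∷ []) ≤ 1
  len-single x = length-bfilter (1 ≤ᵇ_) (x ∷ [])

  len-∷0 : ∀ x → len (x ∷ 0 ∷ []) ≤ 1
  len-∷0 zero = z≤n
  len-∷0 (suc _) = ℕ.≤-refl

  len-quotientOf-two : ∀ b b' → b' / t ≡ 0 → len (quotientOf (b ∷ b' ∷ [])) ≤ 1
  len-quotientOf-two b b' e rewrite e = len-∷0 ((b / t + 1) ∸ 2)

  len-quotientOf-low : ∀ b → b / t ≡ 0 → len (quotientOf (b ∷ [])) ≡ 0
  len-quotientOf-low b e rewrite e = ≡.refl

  GoodPair⇒len : ∀ {l l'} → GoodPair u l l' → len (quotientOf l) + len (quotientOf l') ≤ 1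
  GoodPair⇒len (left {b} {b'} e) = ℕ.≤-trans (ℕ.≤-reflexive (ℕ.+-identityʳ _)) (len-quotientOf-two b b' e)
  GoodPair⇒len (right {b} {b'} e) = len-quotientOf-two b b' e
  GoodPair⇒len (split {b} {b'} (inj₁ e)) = ℕ.+-mono-≤ (ℕ.≤-reflexive (len-quotientOf-low b e)) (len-single ((b' / t + 1) ∸ 1))
  GoodPair⇒len (split {b} {b'} (inj₂ e)) = ℕ.+-mono-≤ (len-single ((b / t + 1) ∸ 1)) (ℕ.≤-reflexive (len-quotientOf-low b' e))

  -- The two quotients decrease strictly. If the smaller one were positive, the larger would be at
  -- least 2, and both parts would be nonzero after the shift.
  two-low : ∀ b b' → b' < b → b % t ≡ b' % t → len (quotientOf (b ∷ b' ∷ [])) ≤ 1 → b' / t ≡ 0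
  two-low b b' b'<b e l = go (b / t) (b' / t) (quot-< b'<b e) l
    where
    go : ∀ q q' → q' < q → len ((q + 1) ∸ 2 ∷ (q' + 2) ∸ 2 ∷ []) ≤ 1 → q' ≡ 0
    go q zero _ _ = ≡.refl
    go (suc zero) (suc q') (s≤s ()) _
    go (suc (suc q)) (suc q') _ l rewrite ℕ.+-comm q 1 | ℕ.+-comm q' 2 = contradiction l (λ { (s≤s ()) })

  single-low : ∀ b b' → len (quotientOf (b ∷ [])) + len (quotientOf (b' ∷ [])) ≤ 1 → b / t ≡ 0 ⊎ b' / t ≡ 0
  single-low b b' l = go (b / t) (b' / t) l
    where
    go : ∀ q q' → len ((q + 1) ∸ 1 ∷ []) + len ((q' + 1) ∸ 1 ∷ []) ≤ 1 → q ≡ 0 ⊎ q' ≡ 0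
    go zero q' _ = inj₁ ≡.refl
    go (suc q) zero _ = inj₂ ≡.refl
    go (suc q) (suc q') l rewrite ℕ.+-comm q 1 | ℕ.+-comm q' 1 = contradiction l (λ { (s≤s ()) })

  len⇒GoodPair : ∀ {r r'} l l' → AllPairs _>_ l → AllPairs _>_ l' →
    All (λ b → b % t ≡ r) l → All (λ b → b % t ≡ r') l' →
    length l + length l' ≡ 2 → len (quotientOf l) + len (quotientOf l') ≤ 1 → GoodPair u l l'
  len⇒GoodPair [] (b ∷ b' ∷ []) _ ((b>b' ∷ []) ∷ _) _ (e ∷ e' ∷ []) _ q =
    right (two-low b b' b>b' (≡.trans e (≡.sym e')) q)
  len⇒GoodPair (b ∷ []) (b' ∷ []) _ _ _ _ _ q = split (single-low b b' q)
  len⇒GoodPair (b ∷ b' ∷ []) [] ((b>b' ∷ []) ∷ _) _ (e ∷ e' ∷ []) _ _ q =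
    left (two-low b b' b>b' (≡.trans e (≡.sym e')) (ℕ.≤-trans (ℕ.≤-reflexive (≡.sym (ℕ.+-identityʳ _))) q))
  len⇒GoodPair [] [] _ _ _ _ () _
  len⇒GoodPair [] (_ ∷ []) _ _ _ _ () _
  len⇒GoodPair [] (_ ∷ _ ∷ _ ∷ _) _ _ _ _ () _
  len⇒GoodPair (_ ∷ []) [] _ _ _ _ () _
  len⇒GoodPair (_ ∷ []) (_ ∷ _ ∷ _) _ _ _ _ () _
  len⇒GoodPair (_ ∷ _ ∷ []) (_ ∷ _) _ _ _ _ () _
  len⇒GoodPair (_ ∷ _ ∷ _ ∷ _) _ _ _ _ _ () _

  GoodZero⇒quotient : ∀ {l} → GoodZero u l → nonzeroParts (quotientOf l) ≡ [] ⊎ nonzeroParts (quotientOf l) ≡ 1 ∷ []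
  GoodZero⇒quotient (zeroClass {b} q≤1) = go (b / t) q≤1
    where
    go : ∀ q → q ≤ 1 → nonzeroParts ((q + 1) ∸ 1 ∷ []) ≡ [] ⊎ nonzeroParts ((q + 1) ∸ 1 ∷ []) ≡ 1 ∷ []
    go zero _ = inj₁ ≡.refl
    go (suc zero) _ = inj₂ ≡.refl
    go (suc (suc _)) (s≤s ())

  quotient⇒GoodZero : ∀ l → length l ≡ 1 →
    nonzeroParts (quotientOf l) ≡ [] ⊎ nonzeroParts (quotientOf l) ≡ 1 ∷ [] → GoodZero u l
  quotient⇒GoodZero (b ∷ []) _ h = zeroClass (go (b / t) h)
    where
    go : ∀ q → nonzeroParts ((q + 1) ∸ 1 ∷ []) ≡ [] ⊎ nonzeroParts ((q + 1) ∸ 1 ∷ []) ≡ 1 ∷ [] → q ≤ 1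
    go zero _ = z≤n
    go (suc q) h rewrite ℕ.+-comm q 1 with h
    ... | inj₂ ≡.refl = ℕ.≤-refl

  GoodMiddle⇒quotient : ∀ {l} → GoodMiddle u l → nonzeroParts (quotientOf l) ≡ []
  GoodMiddle⇒quotient (middle {b} e) rewrite e = ≡.refl

  quotient⇒GoodMiddle : ∀ l → length l ≡ 1 → nonzeroParts (quotientOf l) ≡ [] → GoodMiddle u l
  quotient⇒GoodMiddle (b ∷ []) _ h = middle (go (b / t) h)
    where
    go : ∀ q → nonzeroParts ((q + 1) ∸ 1 ∷ []) ≡ [] → q ≡ 0
    go zero _ = ≡.refl
    go (suc q) h rewrite ℕ.+-comm q 1 = contradiction h λ ()

  GoodMiddle-length : ∀ {l} → GoodMiddle u l → length l ≡ 1
  GoodMiddle-length (middle _) = ≡.refl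

  GoodZero-length : ∀ {l} → GoodZero u l → length l ≡ 1
  GoodZero-length (zeroClass _) = ≡.refl

  good⇒balanced : Good → Balanced t n
  good⇒balanced (z , pairs , mid) = GoodZero-length z , sums
    where
    sums : ∀ i j → 1 ≤ i → 1 ≤ j → i + j ≡ t → n i + n j ≡ 2
    sums i j 1≤i 1≤j e with ℕ.<-cmp i j
    ... | tri< i<j _ _ = GoodPair-length (pairs i j 1≤i i<j e)
    ... | tri≈ _ ≡.refl _ = ≡.cong₂ _+_ (GoodMiddle-length (mid i 1≤i e)) (GoodMiddle-length (mid i 1≤i e))
    ... | tri> _ _ j<i = ≡.trans (ℕ.+-comm (n i) (n j)) (GoodPair-length (pairs j i 1≤j j<i (≡.trans (ℕ.+-comm j i) e)))

  half-≤ : t / 2 + t / 2 ≤ t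
  half-≤ = ℕ.≤-trans (ℕ.≤-reflexive (lem (t / 2))) (m/n*n≤m t 2)
    where
    lem : ∀ h → h + h ≡ h · 2
    lem = ℕSolver.solve-∀

  good⇒condition : Good → Condition t lam
  good⇒condition g@(z , pairs , mid) =
    Co.balanced⇒orthogonal (good⇒balanced g) ,
    (λ i 1≤i i≤t/2 i≢ → GoodPair⇒len (pairs i (t ∸ i) 1≤i
      (ℕ.≤∧≢⇒< (ℕ.m+n≤o⇒m≤o∸n i (twice i i≤t/2)) i≢)
      (ℕ.m+[n∸m]≡n (ℕ.≤-trans (ℕ.m≤m+n i i) (twice i i≤t/2))))) ,
    GoodZero⇒quotient z ,
    (λ e → GoodMiddle⇒quotient (mid (t / 2) (positive (t / 2) (isEven⇒double t e)) (isEven⇒double t e)))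
    where
    twice : ∀ i → i ≤ t / 2 → i + i ≤ t
    twice i l = ℕ.≤-trans (ℕ.+-mono-≤ l l) half-≤
    positive : ∀ h → h + h ≡ t → 1 ≤ h
    positive (suc h) _ = s≤s z≤n

  -- Orthogonality of the core fixes the sizes of the classes; the conditions on the t-quotient then
  -- bound the quotients within them.
  condition⇒good : Condition t lam → Good
  condition⇒good (orth , lens , zeroth , mid) =
    quotient⇒GoodZero (cls 0) (proj₁ balanced) zeroth , pairs , middles
    where
    balanced : Balanced t n
    balanced = bounded⇒balanced u n total (Co.orthogonal⇒bounded orth)
    pairs : ∀ i j → 1 ≤ i → i < j → i + j ≡ t → GoodPair u (cls i) (cls j)
    pairs i j 1≤i i<j e = len⇒GoodPair (cls i) (cls j) (cls-decreasing i) (cls-decreasing j)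
      (cls-residue i) (cls-residue j) (proj₂ balanced i j 1≤i (ℕ.≤-trans 1≤i (ℕ.<⇒≤ i<j)) e)
      (≡.subst (λ k → len (quotient t lam i) + len (quotient t lam k) ≤ 1) t∸i≡j
        (lens i 1≤i i≤t/2 (λ i≡ → ℕ.<⇒≢ i<j (≡.trans i≡ t∸i≡j))))
      where
      t∸i≡j : t ∸ i ≡ j
      t∸i≡j = ≡.trans (≡.cong (_∸ i) (≡.sym e)) (ℕ.m+n∸m≡n i j)
      i≤t/2 : i ≤ t / 2
      i≤t/2 = ℕ.≤-trans (ℕ.≤-reflexive (≡.sym (half-even i)))
        (/-monoˡ-≤ 2 (ℕ.≤-trans (ℕ.+-monoʳ-≤ i (ℕ.<⇒≤ i<j)) (ℕ.≤-reflexive e)))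
    middles : ∀ i → 1 ≤ i → i + i ≡ t → GoodMiddle u (cls i)
    middles i 1≤i e = quotient⇒GoodMiddle (cls i) (half (n i) (proj₂ balanced i i 1≤i 1≤i e))
      (≡.subst (λ k → nonzeroParts (quotient t lam k) ≡ []) (≡.trans (≡.cong (_/ 2) (≡.sym e)) (half-even i))
        (mid (≡.trans (≡.cong isEven (≡.sym e)) (isEven-even i))))
      where
      half : ∀ k → k + k ≡ 2 → k ≡ 1
      half (suc zero) _ = ≡.refl
      half (suc (suc k)) e = contradiction (ℕ.suc-injective (ℕ.suc-injective e))
        (λ e → ℕ.1+n≢0 (≡.trans (≡.sym (ℕ.+-suc k (suc k))) e))

  -- The rank counts the beads from `t` on, and runner 0 has none of these because `n 0` is 1.
  rank-excess : Good → rank (core t lam) ≡ excess n 1 u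
  rank-excess g@(_ , _ , mid) = begin
    rank (core t lam)                            ≡⟨ Co.rank-≡ ⟩
    conj Ab.beads t                              ≡⟨ Ab.conj-beads-t ⟩
    sumBelow (λ i → n i ∸ 1) t                   ≡⟨ sumBelow-∷ (λ i → n i ∸ 1) u ⟩
    (n 0 ∸ 1) + sumBelow (λ i → n (suc i) ∸ 1) u ≡⟨ ≡.cong (λ z → (z ∸ 1) + sumBelow (λ i → n (suc i) ∸ 1) u) (proj₁ (good⇒balanced g)) ⟩
    sumBelow (λ i → n (1 + i) ∸ 1) u             ≡⟨ excess-sum n t u 1 middle-one ≡.refl ⟨
    excess n 1 u                                 ∎
    where
    open ≡.≡-Reasoning
    middle-one : ∀ i → i + i ≡ t → n i ≡ 1
    middle-one (suc i) e = GoodMiddle-length (mid (suc i) (s≤s z≤n) e)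

  -- Spelled as in `epsilon`, so that it can stand for the sum there by definition.
  binomialSum : ℕ
  binomialSum = sum (map (λ i → suc (n i) C 2) (map (λ k → k + (t + 2) / 2) (upTo (t ∸ (t + 2) / 2))))

  sum-triangular : ∀ a p → (t + 2) / 2 ≡ a → t ∸ a ≡ p → binomialSum ≡ sumBelow (λ j → suc (n (j + a)) C 2) p
  sum-triangular a p ≡.refl ≡.refl = ≡.trans (≡.cong sum (≡.sym (map-∘ (upTo (t ∸ a)))))
    (sum-map-upTo (λ j → suc (n (j + a)) C 2) (t ∸ a))

  -- The start (t + 2) / 2 is the least residue above half of `t`: it is p + 1 for t = 2p + 1, and p
  -- + 2 for t = 2p + 2, where the middle residue p + 1 is passed over.
  binomialSum-triangular : binomialSum ≡ triangular n 1 u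
  binomialSum-triangular = go (parity u) ≡.refl
    where
    go : ∀ {u'} → Parity u' → u' ≡ u → binomialSum ≡ triangular n 1 u
    go (even p) e = ≡.trans (sum-triangular (1 + p) p
        (≡.trans (≡.cong (λ u → (suc u + 2) / 2) (≡.sym e)) (≡.trans (≡.cong (_/ 2) (lem p)) (half-odd (1 + p))))
        (≡.trans (≡.cong (λ u → u ∸ p) (≡.sym e)) (ℕ.m+n∸m≡n p p)))
      (≡.trans (≡.sym (triangular-even n p 1)) (≡.cong (triangular n 1) e))
      where
      lem : ∀ p → suc (p + p) + 2 ≡ suc ((1 + p) + (1 + p))
      lem = ℕSolver.solve-∀
    go (odd p) e = ≡.trans (sum-triangular (suc (1 + p)) p
        (≡.trans (≡.cong (λ u → (suc u + 2) / 2) (≡.sym e)) (≡.trans (≡.cong (_/ 2) (lem p)) (half-even (2 + p))))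
        (≡.trans (≡.cong (λ u → u ∸ suc p) (≡.sym e)) (ℕ.m+n∸m≡n p p)))
      (≡.trans (≡.sym (triangular-odd n p 1)) (≡.cong (triangular n 1) e))
      where
      lem : ∀ p → suc (suc (p + p)) + 2 ≡ (2 + p) + (2 + p)
      lem = ℕSolver.solve-∀

  -- For odd `t` the term `u` is even and t · r has the parity of the rank r. For even `t` the term
  -- t · r is even and `u` odd, while in ε the two copies of r cancel and leave 1.
  isEven-epsilon : Good → isEven ∣ epsilon t lam ∣ ≡ isEven (u + (triangular n 1 u + t · excess n 1 u))
  isEven-epsilon g = begin
    isEven ∣ ℤ.- (+ binomialSum) ℤ.+ (+ r) ℤ.+ (if isEven t then + (1 + r) else + 0) ∣
      ≡⟨ ≡.cong (λ z → isEven ∣ z ∣) (≡.trans (ℤ.+-assoc (ℤ.- (+ binomialSum)) (+ r) _)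
           (≡.cong (λ z → ℤ.- (+ binomialSum) ℤ.+ ((+ r) ℤ.+ z)) (if-+ (isEven t)))) ⟩
    isEven ∣ ℤ.- (+ binomialSum) ℤ.+ (+ (r + (if isEven t then 1 + r else 0))) ∣
      ≡⟨ isEven-∣-∣ binomialSum _ ⟩
    isEven (binomialSum + (r + (if isEven t then 1 + r else 0)))
      ≡⟨ ≡.cong₂ (λ a r → isEven (a + (r + (if isEven t then 1 + r else 0)))) binomialSum-triangular (rank-excess g) ⟩
    isEven (triangular n 1 u + (excess n 1 u + (if isEven t then 1 + excess n 1 u else 0)))
      ≡⟨ cases (parity u) ≡.refl (triangular n 1 u) (excess n 1 u) ⟩
    isEven (u + (triangular n 1 u + t · excess n 1 u)) ∎
    where
    open ≡.≡-Reasoning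
    r = rank (core t lam)
    if-+ : ∀ p → (if p then + (1 + r) else + 0) ≡ + (if p then 1 + r else 0)
    if-+ true = ≡.refl
    if-+ false = ≡.refl
    cases : ∀ {v} → Parity v → v ≡ u → ∀ a x →
      isEven (a + (x + (if isEven t then 1 + x else 0))) ≡ isEven (u + (a + t · x))
    cases (even p) ≡.refl a x rewrite isEven-odd p = ≡.trans (≡.cong isEven (≡.cong (_+_ a) (ℕ.+-identityʳ x)))
      (≡.trans (≡.sym (isEven-double (p + p · x) (a + x))) (≡.cong isEven (lem p a x)))
      where
      lem : ∀ p a x → (p + p · x) + (p + p · x) + (a + x) ≡ (p + p) + (a + suc (p + p) · x)
      lem = ℕSolver.solve-∀
    cases (odd p) ≡.refl a x rewrite isEven-even p = ≡.trans (≡.cong isEven (lem₁ a x))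
      (≡.trans (isEven-double x (a + 1)) (≡.trans (≡.sym (isEven-double (p + (1 + p) · x) (a + 1)))
        (≡.cong isEven (lem₂ p a x))))
      where
      lem₁ : ∀ a x → a + (x + (1 + x)) ≡ x + x + (a + 1)
      lem₁ = ℕSolver.solve-∀
      lem₂ : ∀ p a x → (p + (1 + p) · x) + (p + (1 + p) · x) + (a + 1) ≡ suc (p + p) + (a + suc (suc (p + p)) · x)
      lem₂ = ℕSolver.solve-∀

theorem6p2 : ∀ {c ℓ} (R : CommutativeRing c ℓ) →
  let open CommutativeRing R
      open RingDefs R
  in ¬ (1# ≈ 0#) →
     (∀ x y → x * y ≈ 0# → (x ≈ 0#) ⊎ (y ≈ 0#)) →
     (∀ n → ¬ (natR (suc n) ≈ 0#)) →
     (t : ℕ) → 2 ≤ t →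
     (ω : Carrier) → pow ω t ≈ 1# → (∀ k → 1 ≤ k → k < t → ¬ (pow ω k ≈ 1#)) →
     (lam : Vec ℕ t) → Decreasing lam →
     ((¬ (orthChar (toList lam) t (rootsList ω t) ≈ 0#) → Condition t (toList lam))
      × (Condition t (toList lam) → ¬ (orthChar (toList lam) t (rootsList ω t) ≈ 0#))
      × (Condition t (toList lam) →
           orthChar (toList lam) t (rootsList ω t)
             ≈ signZ (epsilon t (toList lam)) * signN (inversions (sigma t (toList lam)))))
theorem6p2 R 1≉0 noZeroDivisors _ (suc u) _ ω ωᵗ≈1 ωᵏ≉1 lam dec =
  necessary evaluateAll , sufficient , value evaluateAll
  where
  open CommutativeRing R renaming (_+_ to _+R_; _*_ to _*R_)
  open RingDefs R
  open Contraction R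
  open Entries.WithRoots R noZeroDivisors u ω ωᵗ≈1 ωᵏ≉1
  module Λ = Partition u (toList lam) (length-beta lam) (beta-decreasing lam dec)
  open SignedDeterminant R u using (signedDet; module Levels)
  open Levels Λ.cls Λ.cls-decreasing using (Layer; module ZeroStep)
  b : List ℕ
  b = beta (toList lam)
  level : Layer 0 (suc u) b
  level = record
    { range = All.universal (λ x → z≤n , m%n<n x (suc u)) b
    ; size = length-beta lam
    ; classes = λ _ _ _ → ≡.refl
    }
  open ZeroStep b level using (evaluateAll; Result)

  char sign : Carrier
  char = orthChar (toList lam) (suc u) (rootsList ω (suc u))
  sign = signN (inversions (sigma (suc u) (toList lam)))

  -- The square of a sign is 1, so the correction in `signedDet` can be compensated by a second
  -- copy, which is then rewritten as the sign of the sorting permutation.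
  char≈ : char ≈ sign *R signedDet b (columns 0 (suc u))
  char≈ = trans (orthChar-listDet lam) (trans
    (sym (signN-cancel (inversions (map (_% suc u) b)) _))
    (*-congʳ (reflexive (≡.cong signN (≡.sym (inversions-sigma u (toList lam)))))))

  necessary : Result → ¬ (char ≈ 0#) → Condition (suc u) (toList lam)
  necessary (inj₁ (good , _)) _ = Λ.good⇒condition good
  necessary (inj₂ (_ , vanishes)) char≉0 =
    contradiction (trans char≈ (trans (*-congˡ vanishes) (zeroʳ sign))) char≉0

  value : Result → Condition (suc u) (toList lam) → char ≈ signZ (epsilon (suc u) (toList lam)) *R sign
  value (inj₁ (good , signed≈)) _ = trans char≈ (trans (*-comm _ _) (*-congʳ (trans signed≈
    (reflexive (≡.cong (λ p → if p then 1# else - 1#) (≡.sym (Λ.isEven-epsilon good)))))))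
  value (inj₂ (bad , _)) condition = contradiction (Λ.condition⇒good condition) bad

  -- By `value` the character is a single power of -1, which cannot vanish in a nontrivial ring.
  sufficient : Condition (suc u) (toList lam) → ¬ (char ≈ 0#)
  sufficient condition char≈0 = signN-≉0 1≉0 (∣ epsilon (suc u) (toList lam) ∣ + inversions (sigma (suc u) (toList lam)))
    (trans (signN-+ ∣ epsilon (suc u) (toList lam) ∣ _) (trans (sym (value evaluateAll condition)) char≈0))
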